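{- There exists a deterministic algorithm that, given a directed graph $G=(V,E,w)$ with $n$ vertices and integer edge weights in the interval $[-W,W]$, solves the All-Pairs Nonnegative Prefix Paths problem on $G$ in $\tilde{O}(n^\omega W^\omega)$ time.
   Context: A path in $G$ is a sequence of vertices $u_0u_1\cdots u_k$ with $(u_i,u_{i+1})\in E$ for all $0\le i<k$ (vertices may repeat). A nonnegative prefix path from $u$ to $v$ is a finite path $u=u_0u_1\cdots u_k=v$ such that $\sum_{j=0}^{i-1} w(u_j,u_{j+1})\ge 0$ for all $1\le i\le k$. All-Pairs Nonnegative Prefix Paths problem: given $G$, determine for every pair of vertices $u,v\in V$ whether there exists a nonnegative prefix path from $u$ to $v$ in $G$. Here $\omega$ is the best exponent for matrix multiplication, and $\tilde{O}(f)$ stands for $O(f\,\mathrm{poly}\log f)$. -}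

module Defs where

open import Data.Nat.Base as ℕ using (ℕ; zero; suc; NonZero)
import Data.Nat.Properties as ℕ
open import Data.Nat.Logarithm using (⌈log₂_⌉)
open import Data.Integer.Base as ℤ using (ℤ; +_; -[1+_]; 0ℤ; 1ℤ; ∣_∣)
import Data.Integer.Properties as ℤ
open import Data.Rational.Unnormalised.Base as ℚᵘ using (ℚᵘ; mkℚᵘ)
open import Data.Fin.Base using (Fin; toℕ; fromℕ<; combine; remQuot)
open import Data.List.Base using (List; []; _∷_; length; take; foldr)
open import Data.Maybe.Base using (Maybe; just; nothing; maybe′)
open import Data.Product.Base using (Σ; ∃; ∃-syntax; _×_; _,_; uncurry)
open import Data.Sum.Base using (_⊎_)
open import Data.Bool.Base using (if_then_else_)
open import Relation.Nullary using (¬_; yes; no; contradiction)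
open import Relation.Nullary.Decidable using (⌊_⌋; _×-dec_)
open import Relation.Binary.PropositionalEquality using (_≡_; refl)
open import Relation.Binary.Construct.Closure.ReflexiveTransitive using (Star; ε; _◅_)
open import Algebra.Properties.Semiring.Sum ℤ.+-*-semiring using (sum)

------------------------------------------------------------------------
-- Graphs and nonnegative prefix paths

-- (u , v) ∈ E iff the entry is  just w , and then w is the weight of (u , v).
Graph : ℕ → Set
Graph n = Fin n → Fin n → Maybe ℤ

module _ {n : ℕ} (G : Graph n) where

  Edge : Fin n → Fin n → Set
  Edge u v = ∃[ w ] G u v ≡ just w

  Path : Fin n → Fin n → Set
  Path = Star Edge

  weights : ∀ {u v} → Path u v → List ℤ
  weights ε             = []
  weights ((w , _) ◅ p) = w ∷ weights p

  WeightsBoundedBy : ℕ → Set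
  WeightsBoundedBy W = ∀ u v w → G u v ≡ just w → (ℤ.- (+ W) ℤ.≤ w) × (w ℤ.≤ + W)

  NonnegativePrefixes : ∀ {u v} → Path u v → Set
  NonnegativePrefixes p = ∀ i → 1 ℕ.≤ i → i ℕ.≤ length (weights p) →
    0ℤ ℤ.≤ foldr ℤ._+_ 0ℤ (take i (weights p))

  NonnegativePrefixPath : Fin n → Fin n → Set
  NonnegativePrefixPath u v = Σ (Path u v) NonnegativePrefixes

------------------------------------------------------------------------
-- Machine model: a random access machine with logarithmic cost.  A
-- program is a finite while-program over integer arrays; it can name only
-- finitely many arrays, each indexed by ℤ.

infixl 7 _⊗_
infixl 6 _⊕_ _⊖_
infix  5 _[_]≔_
infix  4 if0<_then_else_ while0<_loop_
infixr 3 _⨾_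

data Expr : Set where
  lit         : ℤ → Expr
  _[_]        : ℕ → Expr → Expr
  _⊕_ _⊖_ _⊗_ : Expr → Expr → Expr

data Program : Set where
  skip            : Program
  _[_]≔_          : ℕ → Expr → Expr → Program
  _⨾_             : Program → Program → Program
  if0<_then_else_ : Expr → Program → Program → Program
  while0<_loop_   : Expr → Program → Program

Store : Set
Store = ℕ → ℤ → ℤ

_[_,_↦_] : Store → ℕ → ℤ → ℤ → Store
(σ [ x , i ↦ v ]) y j = if ⌊ (x ℕ.≟ y) ×-dec (i ℤ.≟ j) ⌋ then v else σ y j

⟦_⟧ : Expr → Store → ℤ
⟦ lit z   ⟧ σ = z
⟦ x [ e ] ⟧ σ = σ x (⟦ e ⟧ σ)
⟦ d ⊕ e   ⟧ σ = ⟦ d ⟧ σ ℤ.+ ⟦ e ⟧ σ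
⟦ d ⊖ e   ⟧ σ = ⟦ d ⟧ σ ℤ.- ⟦ e ⟧ σ
⟦ d ⊗ e   ⟧ σ = ⟦ d ⟧ σ ℤ.* ⟦ e ⟧ σ

-- Binary digits of the absolute value, plus one for the sign.
size : ℤ → ℕ
size z = suc ⌈log₂ suc ∣ z ∣ ⌉

-- Every value computed, indices included, is charged its size.
cost : Expr → Store → ℕ
cost (lit z)   σ = size z
cost (x [ e ]) σ = size (⟦ x [ e ] ⟧ σ) ℕ.+ cost e σ
cost (d ⊕ e)   σ = size (⟦ d ⊕ e ⟧ σ) ℕ.+ (cost d σ ℕ.+ cost e σ)
cost (d ⊖ e)   σ = size (⟦ d ⊖ e ⟧ σ) ℕ.+ (cost d σ ℕ.+ cost e σ)
cost (d ⊗ e)   σ = size (⟦ d ⊗ e ⟧ σ) ℕ.+ (cost d σ ℕ.+ cost e σ)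

-- ⟨ p , σ ⟩⇓⟨ σ′ , t ⟩ : started in σ, p halts in σ′ after time t.
data ⟨_,_⟩⇓⟨_,_⟩ : Program → Store → Store → ℕ → Set where

  skip : ∀ {σ} → ⟨ skip , σ ⟩⇓⟨ σ , 1 ⟩

  assign : ∀ {x d e σ} →
    ⟨ x [ d ]≔ e , σ ⟩⇓⟨ σ [ x , ⟦ d ⟧ σ ↦ ⟦ e ⟧ σ ] , cost d σ ℕ.+ cost e σ ⟩

  seq : ∀ {p q σ σ′ σ″ s t} →
    ⟨ p , σ ⟩⇓⟨ σ′ , s ⟩ → ⟨ q , σ′ ⟩⇓⟨ σ″ , t ⟩ →
    ⟨ p ⨾ q , σ ⟩⇓⟨ σ″ , s ℕ.+ t ⟩

  if-true : ∀ {e p q σ σ′ t} → 0ℤ ℤ.< ⟦ e ⟧ σ →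
    ⟨ p , σ ⟩⇓⟨ σ′ , t ⟩ →
    ⟨ if0< e then p else q , σ ⟩⇓⟨ σ′ , cost e σ ℕ.+ t ⟩

  if-false : ∀ {e p q σ σ′ t} → ¬ (0ℤ ℤ.< ⟦ e ⟧ σ) →
    ⟨ q , σ ⟩⇓⟨ σ′ , t ⟩ →
    ⟨ if0< e then p else q , σ ⟩⇓⟨ σ′ , cost e σ ℕ.+ t ⟩

  while-true : ∀ {e p σ σ′ σ″ s t} → 0ℤ ℤ.< ⟦ e ⟧ σ →
    ⟨ p , σ ⟩⇓⟨ σ′ , s ⟩ → ⟨ while0< e loop p , σ′ ⟩⇓⟨ σ″ , t ⟩ →
    ⟨ while0< e loop p , σ ⟩⇓⟨ σ″ , cost e σ ℕ.+ (s ℕ.+ t) ⟩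

  while-false : ∀ {e p σ} → ¬ (0ℤ ℤ.< ⟦ e ⟧ σ) →
    ⟨ while0< e loop p , σ ⟩⇓⟨ σ , cost e σ ⟩

deterministic : ∀ {p σ σ₁ σ₂ t₁ t₂} →
  ⟨ p , σ ⟩⇓⟨ σ₁ , t₁ ⟩ → ⟨ p , σ ⟩⇓⟨ σ₂ , t₂ ⟩ → (σ₁ ≡ σ₂) × (t₁ ≡ t₂)
deterministic skip skip = refl , refl
deterministic assign assign = refl , refl
deterministic (seq a b) (seq c d) with deterministic a c
... | refl , refl with deterministic b d
... | refl , refl = refl , refl
deterministic (if-true g a) (if-true h b) with deterministic a b
... | refl , refl = refl , refl
deterministic (if-true g a) (if-false h b) = contradiction g h
deterministic (if-false g a) (if-true h b) = contradiction h g
deterministic (if-false g a) (if-false h b) with deterministic a b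
... | refl , refl = refl , refl
deterministic (while-true g a b) (while-true h c d) with deterministic a c
... | refl , refl with deterministic b d
... | refl , refl = refl , refl
deterministic (while-true g a b) (while-false h) = contradiction g h
deterministic (while-false g) (while-true h c d) = contradiction h g
deterministic (while-false g) (while-false h) = refl , refl

------------------------------------------------------------------------
-- Input and output

Matrix : ℕ → Set
Matrix n = Fin n → Fin n → ℤ

-- Row-major storage: the (i , j) entry is at index  n * i + j .
rowMajor : ∀ {n} → Matrix n → ℤ → ℤ
rowMajor {n} A (+ k) with k ℕ.<? n ℕ.* n
... | yes k<n*n = uncurry A (remQuot n (fromℕ< k<n*n))
... | no  _     = 0ℤ
rowMajor A -[1+ _ ] = 0ℤ

-- Both problems below take n and two n × n matrices, stored in arrays
-- 0, 1 and 2; all other cells are initially zero.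
input : ∀ {n} → Matrix n → Matrix n → Store
input {n} A B 0 (+ 0) = + n
input     A B 1 i     = rowMajor A i
input     A B 2 i     = rowMajor B i
input     A B _ _     = 0ℤ

-- The resulting n × n matrix is expected in array 3.
output : ∀ {n} → Store → Matrix n
output σ i j = σ 3 (+ toℕ (combine i j))

adjacency : ∀ {n} → Graph n → Matrix n
adjacency G u v = maybe′ (λ _ → 1ℤ) 0ℤ (G u v)

weightMatrix : ∀ {n} → Graph n → Matrix n
weightMatrix G u v = maybe′ (λ w → w) 0ℤ (G u v)

IsProduct : ∀ {n} → Matrix n → Matrix n → Matrix n → Set
IsProduct A B C = ∀ i j → C i j ≡ sum (λ k → A i k ℤ.* B k j)

DecidesNonnegativePrefixPaths : ∀ {n} → Graph n → Matrix n → Set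
DecidesNonnegativePrefixPaths G R = ∀ u v →
  (R u v ≡ 1ℤ × NonnegativePrefixPath G u v) ⊎
  (R u v ≡ 0ℤ × ¬ NonnegativePrefixPath G u v)

------------------------------------------------------------------------
-- Running times

-- A real number τ, given by the rationals strictly above it:  τ r  means
-- that r exceeds the exponent.
Exponent : Set₁
Exponent = ℚᵘ → Set

rational : ℚᵘ → Exponent
rational q r = q ℚᵘ.< r

-- t ≤ K · Nʳ, cleared of roots and of negative powers.
_≤_·_^ℚ_ : ℕ → ℕ → ℕ → ℚᵘ → Set
t ≤ K · N ^ℚ mkℚᵘ (+ a)    d = t ℕ.^ suc d ℕ.≤ K ℕ.^ suc d ℕ.* N ℕ.^ a
t ≤ K · N ^ℚ mkℚᵘ -[1+ a ] d = t ℕ.^ suc d ℕ.* N ℕ.^ suc a ℕ.≤ K ℕ.^ suc d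

-- t ≤ K · N^τ.  For N ≥ 1 the infimum of Nʳ over the rationals r > τ is
-- N^τ, so τ itself need not be rational.
_≤_·_^_ : ℕ → ℕ → ℕ → Exponent → Set
t ≤ K · N ^ τ = ∀ r → τ r → t ≤ K · N ^ℚ r

polylog : ℕ → ℕ → ℕ → ℕ
polylog C c m = C ℕ.* suc ⌈log₂ m ⌉ ℕ.^ c

-- n × n integer matrices with entries in [-M , M] can be multiplied in
-- time Õ(n^τ), where the logarithmic factors may depend on n and M.
MatrixMultiplicationIn : Exponent → Set
MatrixMultiplicationIn τ =
  ∃[ p ] ∃[ C ] ∃[ c ]
    ∀ n M .{{_ : NonZero n}} .{{_ : NonZero M}} (A B : Matrix n) →
    (∀ i j → ∣ A i j ∣ ℕ.≤ M) → (∀ i j → ∣ B i j ∣ ℕ.≤ M) →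
    ∃[ σ ] ∃[ t ]
      ⟨ p , input A B ⟩⇓⟨ σ , t ⟩ ×
      IsProduct A B (output σ) ×
      t ≤ polylog C c (n ℕ.* M) · n ^ τ

-- The best exponent for matrix multiplication: the infimum of the
-- exponents that are achieved.
ω : Exponent
ω r = ∃[ q ] q ℚᵘ.< r × MatrixMultiplicationIn (rational q)

-- All-Pairs Nonnegative Prefix Paths can be solved in time Õ(n^τ W^τ).
-- The program is given G but not W.
AllPairsNonnegativePrefixPathsIn : Exponent → Set
AllPairsNonnegativePrefixPathsIn τ =
  ∃[ p ] ∃[ C ] ∃[ c ]
    ∀ n W .{{_ : NonZero n}} .{{_ : NonZero W}} (G : Graph n) →
    WeightsBoundedBy G W →
    ∃[ σ ] ∃[ t ]
      ⟨ p , input (adjacency G) (weightMatrix G) ⟩⇓⟨ σ , t ⟩ ×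
      DecidesNonnegativePrefixPaths G (output σ) ×
      t ≤ polylog C c (n ℕ.* W) · (n ℕ.* W) ^ τ

{-# OPTIONS --safe #-}

-- Let W ≥ 1 bound all absolute weights.  A vertex with energy l W + j, 0 ≤ j < W,
-- is the state (v , j) of a one-counter system with n W states and counter l; each
-- edge changes l by at most one.  Giving each vertex of a path only the energy
-- that the rest of the path requires, one sees that a nonnegative prefix path
-- from u to v exists iff ((u , 0) , 0) reaches ((v , 0) , 0), where energy may be
-- lost on the way.  Runs between two configurations of counter 0 need counter
-- values at most N² for N = n W, because the sets of pairs connected by nested
-- derivations of depth k stabilise after N² steps.  One round of Boolean products
-- replaces the system by the one that it induces on even counter values, so
-- O(log N) rounds reduce the question to ordinary reachability.  Each round takes
-- O(log N) products of N × N matrices.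
--
-- The products are computed by a relocated copy of the given program, in cells
-- that no earlier call has touched.  Their running times dominate everything else,
-- because a program that writes N² nonzero entries needs time N².
module Submission where

open import Defs
open import Algebra.Bundles using (AbelianGroup)
open import Data.Bool.Base using (Bool; true; false; T; not; _∧_; _∨_; if_then_else_)
open import Data.Bool.Properties using (T-∧; T-∨; T-≡; T?)
open import Data.Empty using (⊥-elim)
open import Data.Fin.Base using (Fin; zero; suc; toℕ; combine; remQuot; fromℕ<)
open import Data.Fin.Patterns using (0F; 1F; 2F; 3F; 4F; 5F)
import Data.Fin.Properties as Fin
open import Data.Integer.Base as ℤ using (ℤ; +_; -[1+_]; 0ℤ; 1ℤ; ∣_∣)
import Data.Integer.Properties as ℤ
open import Data.Integer.Tactic.RingSolver as ℤ-Solver using ()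
open import Data.List.Base using (List; _∷_; length; take; foldr)
open import Data.Maybe.Base using (Maybe; just; nothing; maybe′)
open import Data.Nat.Base as ℕ using (ℕ; zero; suc; _+_; _*_; _^_; _∸_; _⊔_; _≤_; _<_; z≤n; s≤s; NonZero; ⌈_/2⌉)
open import Data.Nat.DivMod using (_/_; _%_; _mod_; m≡m%n+[m/n]*n; m%n<n)
open import Data.Nat.Induction using (<-rec)
open import Data.Nat.Logarithm using (⌈log₂_⌉; ⌈log₂⌉-mono-≤; ⌈log₂2^n⌉≡n; ⌈log₂⌈n/2⌉⌉≡⌈log₂n⌉∸1)
import Data.Nat.Properties as ℕ
open import Data.Nat.Tactic.RingSolver as ℕ-Solver using ()
open import Data.Product.Base using (Σ; ∃; ∃-syntax; _×_; _,_; proj₁; proj₂; uncurry)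
open import Data.Rational.Unnormalised.Base using (mkℚᵘ)
import Data.Rational.Unnormalised.Properties as ℚᵘ
open import Data.Sum.Base using (_⊎_; inj₁; inj₂; [_,_]′)
open import Data.Unit.Base using (tt)
open import Function.Base using (_∘_)
open import Function.Bundles using (Equivalence)
open import Relation.Binary.Construct.Closure.ReflexiveTransitive using (Star; ε; _◅_; _◅◅_)
open import Relation.Binary.Definitions using (tri<; tri≈; tri>)
open import Relation.Binary.PropositionalEquality hiding ([_]; J)
open import Relation.Nullary using (¬_; yes; no; contradiction)
open import Relation.Nullary.Decidable using (⌊_⌋; toWitness; fromWitness)
open import Algebra.Properties.Group (AbelianGroup.group ℤ.+-0-abelianGroup) using (∙-cancelʳ)
open import Algebra.Properties.Semiring.Sum ℤ.+-*-semiring using (sum)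

-- Boolean matrices

-- The given multiplication program is a black box. A program names finitely many arrays, hence
-- fresh cells must be found inside the same arrays: call number c uses the odd multiples of 2 ^ c,
-- and every nonzero integer is an odd multiple of exactly one power of 2. Addresses grow by one bit
-- per call, which is affordable because only O(log² N) calls are made. A second obstacle is that N
-- ^ τ is not a number here: `t ≤ K · N ^ τ` is a family of inequalities, one for each rational
-- above τ. With K fixed it passes to maxima of times, but not to sums. Running times are therefore
-- counted as multiples of the time of an actual multiplication, and the multiplier is moved into K
-- once, at the very end.

BMat : ℕ → Set
BMat N = Fin N → Fin N → Bool

infixl 7 _⊙_
infixl 6 _⊍_
infix 4 _⊆_

_⊙_ _⊍_ : ∀ {N} → BMat N → BMat N → BMat N
(A ⊙ B) i j = ⌊ Fin.any? (λ k → T? (A i k ∧ B k j)) ⌋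
(A ⊍ B) i j = A i j ∨ B i j

_⊆_ : ∀ {N} → BMat N → BMat N → Set
A ⊆ B = ∀ {i j} → T (A i j) → T (B i j)

Reflexive : ∀ {N} → BMat N → Set
Reflexive A = ∀ {i} → T (A i i)

module _ {N : ℕ} {A B : BMat N} where

  ⊙-intro : ∀ {i k j} → T (A i k) → T (B k j) → T ((A ⊙ B) i j)
  ⊙-intro {k = k} a b = fromWitness (k , Equivalence.from T-∧ (a , b))

  ⊙-elim : ∀ {i j} → T ((A ⊙ B) i j) → ∃ λ k → T (A i k) × T (B k j)
  ⊙-elim t with toWitness t
  ... | k , ab = k , Equivalence.to T-∧ ab

  ⊍-introˡ : A ⊆ A ⊍ B
  ⊍-introˡ a = Equivalence.from T-∨ (inj₁ a)

  ⊍-introʳ : B ⊆ A ⊍ B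
  ⊍-introʳ {i} {j} b = Equivalence.from (T-∨ {A i j}) (inj₂ b)

  ⊍-elim : ∀ {i j} → T ((A ⊍ B) i j) → T (A i j) ⊎ T (B i j)
  ⊍-elim = Equivalence.to T-∨

-- Increasing chains of Boolean matrices stabilise

bit : Bool → ℕ
bit b = if b then 1 else 0

bit≤1 : ∀ b → bit b ≤ 1
bit≤1 false = z≤n
bit≤1 true  = ℕ.≤-refl

count : ∀ {K} → (Fin K → Bool) → ℕ
count {zero}  f = 0
count {suc K} f = bit (f zero) + count (f ∘ suc)

count≤ : ∀ {K} (f : Fin K → Bool) → count f ≤ K
count≤ {zero}  f = z≤n
count≤ {suc K} f = ℕ.+-mono-≤ (bit≤1 (f zero)) (count≤ (f ∘ suc))

count-mono : ∀ {K} {f g : Fin K → Bool} → (∀ i → T (f i) → T (g i)) → count f ≤ count g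
count-mono {zero}  le = z≤n
count-mono {suc K} {f} {g} le = ℕ.+-mono-≤ (head (f zero) (g zero) (le zero)) (count-mono (le ∘ suc))
  where
  head : ∀ a b → (T a → T b) → bit a ≤ bit b
  head false _     _ = z≤n
  head true  true  _ = ℕ.≤-refl
  head true  false h = ⊥-elim (h tt)

⊇-or-count< : ∀ {K} {f g : Fin K → Bool} → (∀ i → T (f i) → T (g i)) →
  (∀ i → T (g i) → T (f i)) ⊎ count f < count g
⊇-or-count< {zero} le = inj₁ λ ()
⊇-or-count< {suc K} {f} {g} le with f zero in f₀ | g zero in g₀ | ⊇-or-count< (le ∘ suc)
... | true  | true  | inj₁ ge = inj₁ λ { zero _ → subst T (sym f₀) tt ; (suc i) → ge i }
... | true  | true  | inj₂ lt = inj₂ (s≤s lt)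
... | true  | false | _       = ⊥-elim (subst T g₀ (le zero (subst T (sym f₀) tt)))
... | false | true  | _       = inj₂ (s≤s (count-mono (le ∘ suc)))
... | false | false | inj₁ ge = inj₁ λ { zero t → ⊥-elim (subst T g₀ t) ; (suc i) → ge i }
... | false | false | inj₂ lt = inj₂ lt

-- Until it first repeats, the chain gains an element at every step.
chain-stable : ∀ {K} (S : ℕ → Fin K → Bool) →
  (∀ k i → T (S k i) → T (S (suc k) i)) →
  (∀ k → (∀ i → T (S (suc k) i) → T (S k i)) → ∀ i → T (S (2 + k) i) → T (S (suc k) i)) →
  ∀ i → T (S (suc K) i) → T (S K i)
chain-stable {K} S inc step = [ (λ h → h) , (λ lt → contradiction (count≤ (S (suc K))) (ℕ.<⇒≱ lt)) ]′ (go K)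
  where
  go : ∀ k → (∀ i → T (S (suc k) i) → T (S k i)) ⊎ k < count (S (suc k))
  go zero with ⊇-or-count< (inc 0)
  ... | inj₁ ge = inj₁ ge
  ... | inj₂ lt = inj₂ (ℕ.≤-<-trans z≤n lt)
  go (suc k) with go k
  ... | inj₁ ge = inj₁ (step k ge)
  ... | inj₂ lt with ⊇-or-count< (inc (suc k))
  ...   | inj₁ ge = inj₁ ge
  ...   | inj₂ lt′ = inj₂ (ℕ.≤-<-trans lt lt′)

-- A Boolean matrix is a subset of a set of N * N pairs, coded here as `Fin (N * N)`. This is the
-- source of the threshold N * N in all later bounds on lengths and depths.
matrix-chain-stable : ∀ {N} (S : ℕ → BMat N) →
  (∀ k → S k ⊆ S (suc k)) →
  (∀ k → S (suc k) ⊆ S k → S (2 + k) ⊆ S (suc k)) →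
  S (suc (N * N)) ⊆ S (N * N)
matrix-chain-stable {N} S inc step {i} {j} t =
  subst (λ ij → T (uncurry (S (N * N)) ij)) (Fin.remQuot-combine i j)
    (chain-stable (λ k → uncurry (S k) ∘ remQuot N) (λ k _ → inc k)
      (λ k ge m → step k (λ {i} {j} s →
         subst (λ ij → T (uncurry (S k) ij)) (Fin.remQuot-combine i j)
           (ge (combine i j) (subst (λ ij → T (uncurry (S (suc k)) ij)) (sym (Fin.remQuot-combine i j)) s))))
      (combine i j)
      (subst (λ ij → T (uncurry (S (suc (N * N))) ij)) (sym (Fin.remQuot-combine i j)) t))

-- Reachability by repeated squaring

squarings : ∀ {N} → ℕ → BMat N → BMat N
squarings zero    A = A
squarings (suc l) A = squarings l A ⊍ squarings l A ⊙ squarings l A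

Reachable : ∀ {N} → BMat N → Fin N → Fin N → Set
Reachable A = Star (λ i j → T (A i j))

squarings-inflationary : ∀ {N} l (A : BMat N) → A ⊆ squarings l A
squarings-inflationary zero    A t = t
squarings-inflationary (suc l) A t =
  ⊍-introˡ {A = squarings l A} {squarings l A ⊙ squarings l A} (squarings-inflationary l A t)

squarings-sound : ∀ {N} l (A : BMat N) {i j} → T (squarings l A i j) → Reachable A i j
squarings-sound zero    A t = t ◅ ε
squarings-sound (suc l) A t with ⊍-elim {A = squarings l A} {squarings l A ⊙ squarings l A} t
... | inj₁ s = squarings-sound l A s
... | inj₂ s with ⊙-elim {A = squarings l A} {squarings l A} s
...   | k , a , b = squarings-sound l A a ◅◅ squarings-sound l A b

module Powers {N : ℕ} (A : BMat N) (A-refl : Reflexive A) where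

  -- Walks of length 1 to k + 1. The slow chain serves the proof alone: the counting argument needs
  -- a chain that grows one step at a time, whereas squarings skip most of its terms.
  power : ℕ → BMat N
  power zero    = A
  power (suc k) = power k ⊍ power k ⊙ A

  power-inc : ∀ k → power k ⊆ power (suc k)
  power-inc k = ⊍-introˡ {A = power k} {power k ⊙ A}

  power-snoc : ∀ k {i j m} → T (power k i j) → T (A j m) → T (power (suc k) i m)
  power-snoc k p a = ⊍-introʳ {A = power k} {power k ⊙ A} (⊙-intro {A = power k} {A} p a)

  -- Both parts must have at least one step, so a walk that is too short to be cut is padded by
  -- reflexivity of `A`.
  power-split : ∀ a b {i j} → T (power (suc (a + b)) i j) → ∃ λ m → T (power a i m) × T (power b m j)
  power-split a zero {i} {j} t rewrite ℕ.+-identityʳ a with ⊍-elim {A = power a} {power a ⊙ A} t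
  ... | inj₁ s = j , s , A-refl
  ... | inj₂ s = ⊙-elim {A = power a} {A} s
  power-split a (suc b) t rewrite ℕ.+-suc a b
    with ⊍-elim {A = power (suc (a + b))} {power (suc (a + b)) ⊙ A} t
  ... | inj₁ s = let m , p , q = power-split a b s in m , p , power-inc b q
  ... | inj₂ s with ⊙-elim {A = power (suc (a + b))} {A} s
  ...   | k , r , z = let m , p , q = power-split a b r in m , p , power-snoc b q z

  power⊆squarings : ∀ l k → k < 2 ^ l → power k ⊆ squarings l A
  power⊆squarings zero    zero    _ t = t
  power⊆squarings zero    (suc k) (s≤s ()) t
  power⊆squarings (suc l) k k< t with k ℕ.<? 2 ^ l
  ... | yes lt = ⊍-introˡ {A = squarings l A} {squarings l A ⊙ squarings l A} (power⊆squarings l k lt t)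
  ... | no ¬lt = ⊍-introʳ {A = squarings l A} {squarings l A ⊙ squarings l A}
                   (⊙-intro {A = squarings l A} {squarings l A}
                     (power⊆squarings l a a< (proj₁ (proj₂ halves)))
                     (power⊆squarings l b b< (proj₂ (proj₂ halves))))
    where
    -- Chosen such that suc (a + b) = k, the form that `power-split` expects, with both a and b
    -- below 2 ^ l.
    a = ℕ.pred (2 ^ l)
    b = k ℕ.∸ 2 ^ l
    1+a : suc a ≡ 2 ^ l
    1+a = ℕ.suc-pred (2 ^ l) {{ℕ.m^n≢0 2 l}}
    a< : a < 2 ^ l
    a< = ℕ.≤-reflexive 1+a
    k≡ : suc (a + b) ≡ k
    k≡ = trans (cong (λ x → x + b) 1+a) (ℕ.m+[n∸m]≡n (ℕ.≮⇒≥ ¬lt))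
    b< : b < 2 ^ l
    b< = ℕ.+-cancelˡ-< (2 ^ l) b (2 ^ l)
           (subst₂ _<_ (trans (sym k≡) (cong (λ x → x + b) 1+a)) (cong (λ x → 2 ^ l + x) (ℕ.+-identityʳ (2 ^ l))) k<)
    halves = power-split a b (subst (λ k → T (power k _ _)) (sym k≡) t)

  -- After l squarings all walks of length 1 to 2 ^ l are covered. Waiting for N * N steps rather
  -- than N is crude, but costs only a factor of about 2 in l.
  squarings-complete : ∀ l → N * N < 2 ^ l → ∀ {i j} → Reachable A i j → T (squarings l A i j)
  squarings-complete l big r = power⊆squarings l (N * N) big (go r (base (N * N) A-refl))
    where
    base : ∀ k → A ⊆ power k
    base zero    t = t
    base (suc k) t = power-inc k (base k t)
    closed : power (suc (N * N)) ⊆ power (N * N)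
    closed = matrix-chain-stable power power-inc step
      where
      step : ∀ k → power (suc k) ⊆ power k → power (2 + k) ⊆ power (suc k)
      step k ge t with ⊍-elim {A = power (suc k)} {power (suc k) ⊙ A} t
      ... | inj₁ s = s
      ... | inj₂ s with ⊙-elim {A = power (suc k)} {A} s
      ...   | m , p , a = power-snoc k (ge p) a
    go : ∀ {i j m} → Reachable A j m → T (power (N * N) i j) → T (power (N * N) i m)
    go ε       p = p
    go (a ◅ r) p = go r (closed (power-snoc (N * N) p a))

-- One-counter systems

-- At counter value 0 the matrix flat₀ replaces flat.
record System (N : ℕ) : Set where
  constructor system
  field up down flat flat₀ : BMat N

module _ {N : ℕ} (s : System N) (H : ℕ) where
  open System s

  -- The ceiling `H` on the counter belongs to the step relation because each round halves it. Below
  -- the ceiling 1, a run from counter 0 consists of `₀-step` moves alone.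
  data Step : Fin N × ℕ → Fin N × ℕ → Set where
    ↑-step : ∀ {x y c} → suc c < H → T (up x y) → Step (x , c) (y , suc c)
    ↓-step : ∀ {x y c} → T (down x y) → Step (x , suc c) (y , c)
    →-step : ∀ {x y c} → T (flat x y) → Step (x , suc c) (y , suc c)
    ₀-step : ∀ {x y} → T (flat₀ x y) → Step (x , 0) (y , 0)

  Run : Fin N × ℕ → Fin N × ℕ → Set
  Run = Star Step

double : ∀ {N} → Fin N × ℕ → Fin N × ℕ
double (x , c) = x , c + c

-- One round turns the moves between even counter values into the moves of
-- a system whose counter is half as large.  An excursion below the current
-- value (B followed by up) is impossible at 0, hence missing from flat₀.
round : ∀ {N} → ℕ → System N → System N
round l s = system (A ⊙ up) (B ⊙ down) ((flat* ⊍ A ⊙ down) ⊍ B ⊙ up) (flat₀ ⊍ A ⊙ down)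
  where
  open System s
  flat* = squarings l flat
  A = up ⊙ flat*
  B = down ⊙ flat*

rounds : ∀ {N} → ℕ → ℕ → System N → System N
rounds l zero    s = s
rounds l (suc k) s = round l (rounds l k s)

-- One round halves the counter

module Halving {N : ℕ} (l : ℕ) (s : System N) (refl-flat : Reflexive (System.flat s))
  (big : N * N < 2 ^ l) where
  open System s
  open System (round l s) renaming (up to up′; down to down′; flat to flat′; flat₀ to flat₀′)
  flat* = squarings l flat
  A = up ⊙ flat*
  B = down ⊙ flat*

  flat-run : ∀ {H x y c} → Reachable flat x y → Run s H (x , suc c) (y , suc c)
  flat-run ε       = ε
  flat-run (a ◅ r) = →-step a ◅ flat-run r

  flat*-run : ∀ {H x y c} → T (flat* x y) → Run s H (x , suc c) (y , suc c)
  flat*-run = flat-run ∘ squarings-sound l flat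

  flat⊆flat′ : flat ⊆ flat′
  flat⊆flat′ t = ⊍-introˡ {A = flat* ⊍ A ⊙ down} {B ⊙ up}
    (⊍-introˡ {A = flat*} {A ⊙ down} (squarings-inflationary l flat t))

  module _ {H : ℕ} where

    up-flat* : ∀ {x y} c → suc (c + c) < H → T (A x y) → Run s H (x , c + c) (y , suc (c + c))
    up-flat* c lt t with ⊙-elim {A = up} {flat*} t
    ... | m , u , z = ↑-step lt u ◅ flat*-run z

    down-flat* : ∀ {x y} c → T (B x y) → Run s H (x , suc c + suc c) (y , suc (c + c))
    down-flat* {x} {y} c t with ⊙-elim {A = down} {flat*} t
    ... | m , d , z = subst (λ k → Run s H (x , k) (y , suc (c + c))) (cong suc (sym (ℕ.+-suc c c)))
                        (↓-step d ◅ flat*-run z)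

  double-< : ∀ {c H} → c < H → suc (c + c) < H + H
  double-< {c} lt = ℕ.≤-trans (ℕ.≤-reflexive (cong suc (sym (ℕ.+-suc c c)))) (ℕ.+-mono-≤ lt lt)

  up-to-double : ∀ {H x y} c → suc c < H → T (up x y) →
    Run s (H + H) (x , suc (c + c)) (y , suc c + suc c)
  up-to-double {H} {x} {y} c lt t = subst (λ k → Run s (H + H) (x , suc (c + c)) (y , suc k)) (sym (ℕ.+-suc c c))
    (↑-step (subst (_< H + H) (cong suc (ℕ.+-suc c c)) (ℕ.+-mono-< lt lt)) t ◅ ε)

  -- A move at counter c is replayed at 2 c. An excursion upwards reaches 2 c + 1, still below the
  -- doubled ceiling because c < H.
  step-sound : ∀ {H a b} → proj₂ a < H → Step (round l s) H a b → Run s (H + H) (double a) (double b)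
  step-sound a< (↑-step {c = c} lt t) with ⊙-elim {A = A} {up} t
  ... | m , p , u = up-flat* c (double-< a<) p ◅◅ up-to-double c lt u
  step-sound _ (↓-step {c = c} t) with ⊙-elim {A = B} {down} t
  ... | m , p , d = down-flat* c p ◅◅ (↓-step d ◅ ε)
  step-sound a< (₀-step t) with ⊍-elim {A = flat₀} {A ⊙ down} t
  ... | inj₁ z = ₀-step z ◅ ε
  ... | inj₂ z with ⊙-elim {A = A} {down} z
  ...   | m , p , d = up-flat* 0 (double-< a<) p ◅◅ (↓-step d ◅ ε)
  step-sound a< (→-step {c = c} t) with ⊍-elim {A = flat* ⊍ A ⊙ down} {B ⊙ up} t
  ... | inj₂ z = let m , p , u = ⊙-elim {A = B} {up} z in down-flat* c p ◅◅ up-to-double c a< u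
  ... | inj₁ z with ⊍-elim {A = flat*} {A ⊙ down} z
  ...   | inj₁ f = flat*-run f
  ...   | inj₂ f = let m , p , d = ⊙-elim {A = A} {down} f in
    up-flat* (suc c) (double-< a<) p ◅◅ (↓-step d ◅ ε)

  target-< : ∀ {H a b} → proj₂ a < H → Step (round l s) H a b → proj₂ b < H
  target-< _  (↑-step lt _) = lt
  target-< a< (↓-step _)    = ℕ.<⇒≤ a<
  target-< a< (→-step _)    = a<
  target-< a< (₀-step _)    = a<

  run-sound : ∀ {H a b} → proj₂ a < H → Run (round l s) H a b → Run s (H + H) (double a) (double b)
  run-sound a< ε       = ε
  run-sound a< (t ◅ r) = step-sound a< t ◅◅ run-sound (target-< a< t) r

  -- The new system has no configuration for an odd counter 2 d + 1. A run found there is recorded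
  -- as pending: the flat moves at this value, the move that restores an even value, and a run of
  -- the new system from there on. The bound suc d < H is kept because an up move of the new system
  -- must check it.
  Even Odd : ℕ → ℕ → Fin N → Fin N → Set
  Even H d x y = Run (round l s) H (x , d) (y , 0)
  Odd  H d x y =
    (∃ λ x₁ → ∃ λ x₂ → T (flat* x x₁) × T (down x₁ x₂) × Even H d x₂ y) ⊎
    (∃ λ x₁ → ∃ λ x₂ → T (flat* x x₁) × T (up x₁ x₂) × suc d < H × Even H (suc d) x₂ y)

  flat*-refl : Reflexive flat*
  flat*-refl = squarings-inflationary l flat refl-flat

  -- Here `big` enters: with that many squarings `flat*` is transitively closed.
  flat*-cons : ∀ {x y z} → T (flat x y) → T (flat* y z) → T (flat* x z)
  flat*-cons a b = Powers.squarings-complete flat refl-flat l big (a ◅ squarings-sound l flat b)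

  halve-< : ∀ c H → c + c < H + H → c < H
  halve-< c H lt = ℕ.≰⇒> λ le → ℕ.<⇒≱ lt (ℕ.+-mono-≤ le le)

  even-injective : ∀ d {c} → suc c ≡ d + d → ∃ λ d′ → d ≡ suc d′ × c ≡ suc (d′ + d′)
  even-injective (suc d) refl = d , refl , ℕ.+-suc d d

  up-down-step : ∀ {H x m z} d → T (A x m) → T (down m z) → Step (round l s) H (x , d) (z , d)
  up-down-step zero a t = ₀-step (⊍-introʳ {A = flat₀} {A ⊙ down} (⊙-intro {A = A} {down} a t))
  up-down-step (suc d) a t = →-step (⊍-introˡ {A = flat* ⊍ A ⊙ down} {B ⊙ up}
    (⊍-introʳ {A = flat*} {A ⊙ down} (⊙-intro {A = A} {down} a t)))

  -- The parities are treated together, since up and down moves exchange them. At an even counter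
  -- such a move and the pending part of the rest form one move of the new system; at an odd
  -- counter, the first move starts or extends the pending part.
  halve : ∀ {H x c y} → Run s (H + H) (x , c) (y , 0) →
    (∀ d → c ≡ d + d → Even H d x y) × (∀ d → c ≡ suc (d + d) → Odd H d x y)
  halve {H} ε = (λ { zero refl → ε ; (suc d) () }) , λ d ()
  halve {H} {x} {c} {y} (↑-step {y = z} lt u ◅ r) = ev , od
    where
    IH = halve {H} r
    ev : ∀ d → c ≡ d + d → Even H d x y
    ev d refl with proj₂ IH d refl
    ... | inj₁ (x₁ , x₂ , f , t , e) = up-down-step d (⊙-intro {A = up} {flat*} u f) t ◅ e
    ... | inj₂ (x₁ , x₂ , f , t , d< , e) =
      ↑-step d< (⊙-intro {A = A} {up} (⊙-intro {A = up} {flat*} u f) t) ◅ e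
    od : ∀ d → c ≡ suc (d + d) → Odd H d x y
    od d refl = inj₂ (x , z , flat*-refl , u ,
      halve-< (suc d) H (subst (_< H + H) (cong suc (sym (ℕ.+-suc d d))) lt) ,
      proj₁ IH (suc d) (cong suc (sym (ℕ.+-suc d d))))
  halve {H} {x} {suc c} {y} (↓-step {y = z} t ◅ r) = ev , od
    where
    IH = halve {H} r
    ev : ∀ d → suc c ≡ d + d → Even H d x y
    ev d eq with even-injective d eq
    ... | d′ , refl , c≡ with proj₂ IH d′ c≡
    ...   | inj₁ (x₁ , x₂ , f , t₂ , e) = ↓-step (⊙-intro {A = B} {down} (⊙-intro {A = down} {flat*} t f) t₂) ◅ e
    ...   | inj₂ (x₁ , x₂ , f , u , _ , e) = →-step (⊍-introʳ {A = flat* ⊍ A ⊙ down} {B ⊙ up}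
              (⊙-intro {A = B} {up} (⊙-intro {A = down} {flat*} t f) u)) ◅ e
    od : ∀ d → suc c ≡ suc (d + d) → Odd H d x y
    od d refl = inj₁ (x , z , flat*-refl , t , proj₁ IH d refl)
  halve {H} {x} {suc c} {y} (→-step t ◅ r) = ev , od
    where
    IH = halve {H} r
    ev : ∀ d → suc c ≡ d + d → Even H d x y
    ev d eq with even-injective d eq
    ... | d′ , refl , _ = →-step (flat⊆flat′ t) ◅ proj₁ IH (suc d′) eq
    od : ∀ d → suc c ≡ suc (d + d) → Odd H d x y
    od d eq with proj₂ IH d eq
    ... | inj₁ (x₁ , x₂ , f , rest) = inj₁ (x₁ , x₂ , flat*-cons t f , rest)
    ... | inj₂ (x₁ , x₂ , f , rest) = inj₂ (x₁ , x₂ , flat*-cons t f , rest)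
  halve {H} (₀-step t ◅ r) =
    (λ { zero refl → ₀-step (⊍-introˡ {A = flat₀} {A ⊙ down} t) ◅ proj₁ (halve {H} r) 0 refl ; (suc d) () }) , λ d ()

round-reflexive : ∀ {N} l (s : System N) → Reflexive (System.flat s) → Reflexive (System.flat (round l s))
round-reflexive {N} l s rf = ⊍-introˡ {A = squarings l flat ⊍ up ⊙ squarings l flat ⊙ down}
  {down ⊙ squarings l flat ⊙ up}
  (⊍-introˡ {A = squarings l flat} {up ⊙ squarings l flat ⊙ down} (squarings-inflationary l flat rf))
  where open System s

flat₀-round : ∀ {N} l (s : System N) → System.flat₀ s ⊆ System.flat₀ (round l s)
flat₀-round l s = ⊍-introˡ {A = flat₀} {up ⊙ squarings l flat ⊙ down}
  where open System s

module Rounds {N : ℕ} (l : ℕ) (s : System N) (refl-flat : Reflexive (System.flat s))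
  (refl-flat₀ : Reflexive (System.flat₀ s)) (big : N * N < 2 ^ l) where

  rounds-reflexive : ∀ k → Reflexive (System.flat (rounds l k s))
  rounds-reflexive zero    = refl-flat
  rounds-reflexive (suc k) = round-reflexive l (rounds l k s) (rounds-reflexive k)

  rounds-reflexive₀ : ∀ k → Reflexive (System.flat₀ (rounds l k s))
  rounds-reflexive₀ zero    = refl-flat₀
  rounds-reflexive₀ (suc k) = flat₀-round l (rounds l k s) (rounds-reflexive₀ k)

  -- The factor j is general because peeling off the last round doubles it.
  rounds-complete : ∀ k j {x y} → Run s (2 ^ k * j) (x , 0) (y , 0) →
                    Run (rounds l k s) j (x , 0) (y , 0)
  rounds-complete zero j {x} {y} r = subst (λ h → Run s h (x , 0) (y , 0)) (ℕ.+-identityʳ j) r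
  rounds-complete (suc k) j {x} {y} r =
    proj₁ (Halving.halve l (rounds l k s) (rounds-reflexive k) big
      (rounds-complete k (j + j) (subst (λ h → Run s h (x , 0) (y , 0)) (eq (2 ^ k)) r))) 0 refl
    where
    eq : ∀ a → (a + (a + 0)) * j ≡ a * (j + j)
    eq a = trans (cong (λ b → (a + b) * j) (ℕ.+-identityʳ a))
             (trans (ℕ.*-distribʳ-+ j a a) (sym (ℕ.*-distribˡ-+ a j j)))

  rounds-sound : ∀ k j {x y} → 0 < j → Run (rounds l k s) j (x , 0) (y , 0) →
                 ∃ λ H → Run s H (x , 0) (y , 0)
  rounds-sound zero j _ r = j , r
  rounds-sound (suc k) j 0<j r =
    rounds-sound k (j + j) (ℕ.<-≤-trans 0<j (ℕ.m≤m+n j j))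
      (Halving.run-sound l (rounds l k s) (rounds-reflexive k) big 0<j r)

  -- The number l does three jobs: squarings per round, rounds, and squarings in the final closure.
  -- It can, because N * N < 2 ^ l bounds the lengths of the chains and the counter alike.
  result : BMat N
  result = squarings l (System.flat₀ (rounds l l s))

  result-sound : ∀ {x y} → T (result x y) → ∃ λ H → Run s H (x , 0) (y , 0)
  result-sound t = rounds-sound l 1 (s≤s z≤n) (lift (squarings-sound l _ t))
    where
    lift : ∀ {x y} → Reachable (System.flat₀ (rounds l l s)) x y → Run (rounds l l s) 1 (x , 0) (y , 0)
    lift ε       = ε
    lift (a ◅ r) = ₀-step a ◅ lift r

  result-complete : ∀ {x y} → Run s (2 ^ l) (x , 0) (y , 0) → T (result x y)
  result-complete {x} {y} r = Powers.squarings-complete _ (rounds-reflexive₀ l) l big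
    (ground (rounds-complete l 1 (subst (λ h → Run s h (x , 0) (y , 0)) (sym (ℕ.*-identityʳ (2 ^ l))) r)))
    where
    ground : ∀ {x y} → Run (rounds l l s) 1 (x , 0) (y , 0) → Reachable (System.flat₀ (rounds l l s)) x y
    ground ε                       = ε
    ground (₀-step t ◅ r)          = t ◅ ground r
    ground (↑-step (s≤s ()) _ ◅ r)

-- Runs from counter value 0 to counter value 0, by depth of derivation.  The
-- depth bounds the counter, and the chain of depths is constant from N * N on.
module Balance {N : ℕ} (s : System N) (refl-flat : Reflexive (System.flat s))
  (flat⊆flat₀ : System.flat s ⊆ System.flat₀ s) where
  open System s

  depth : ℕ → BMat N
  depth zero    = flat
  depth (suc k) = (depth k ⊍ depth k ⊙ depth k) ⊍ up ⊙ depth k ⊙ down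

  depth-inc : ∀ k → depth k ⊆ depth (suc k)
  depth-inc k t = ⊍-introˡ {A = depth k ⊍ depth k ⊙ depth k} {up ⊙ depth k ⊙ down}
    (⊍-introˡ {A = depth k} {depth k ⊙ depth k} t)

  depth-comp : ∀ k {x y z} → T (depth k x y) → T (depth k y z) → T (depth (suc k) x z)
  depth-comp k a b = ⊍-introˡ {A = depth k ⊍ depth k ⊙ depth k} {up ⊙ depth k ⊙ down}
    (⊍-introʳ {A = depth k} {depth k ⊙ depth k} (⊙-intro {A = depth k} {depth k} a b))

  depth-nest : ∀ k {x y z w} → T (up x y) → T (depth k y z) → T (down z w) → T (depth (suc k) x w)
  depth-nest k u a d = ⊍-introʳ {A = depth k ⊍ depth k ⊙ depth k} {up ⊙ depth k ⊙ down}
    (⊙-intro {A = up ⊙ depth k} {down} (⊙-intro {A = up} {depth k} u a) d)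

  Balanced : BMat N
  Balanced = depth (N * N)

  Balanced-closed : depth (suc (N * N)) ⊆ Balanced
  Balanced-closed = matrix-chain-stable depth depth-inc step
    where
    step : ∀ k → depth (suc k) ⊆ depth k → depth (2 + k) ⊆ depth (suc k)
    step k ge t with ⊍-elim {A = depth (suc k) ⊍ depth (suc k) ⊙ depth (suc k)} {up ⊙ depth (suc k) ⊙ down} t
    ... | inj₂ u with ⊙-elim {A = up ⊙ depth (suc k)} {down} u
    ...   | m , v , d with ⊙-elim {A = up} {depth (suc k)} v
    ...     | n , u′ , a = depth-nest k u′ (ge a) d
    step k ge t | inj₁ u with ⊍-elim {A = depth (suc k)} {depth (suc k) ⊙ depth (suc k)} u
    ... | inj₁ v = v
    ... | inj₂ v with ⊙-elim {A = depth (suc k)} {depth (suc k)} v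
    ...   | m , a , b = depth-comp k (ge a) (ge b)

  Balanced-flat : flat ⊆ Balanced
  Balanced-flat {x} {y} t = go (N * N)
    where
    go : ∀ k → T (depth k x y)
    go zero    = t
    go (suc k) = depth-inc k (go k)

  -- Derivations do not know the counter value at which they are run, so `flat` moves must also be
  -- possible at 0: hence the hypothesis `flat⊆flat₀`.
  depth-run : ∀ k {H} c {x y} → c + k < H → T (depth k x y) → Run s H (x , c) (y , c)
  depth-run zero zero lt t = ₀-step (flat⊆flat₀ t) ◅ ε
  depth-run zero (suc c) lt t = →-step t ◅ ε
  depth-run (suc k) {H} c lt t with ⊍-elim {A = depth k ⊍ depth k ⊙ depth k} {up ⊙ depth k ⊙ down} t
  ... | inj₂ u with ⊙-elim {A = up ⊙ depth k} {down} u
  ...   | m , v , d with ⊙-elim {A = up} {depth k} v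
  ...     | n , u′ , a =
    ↑-step (ℕ.≤-<-trans (ℕ.m≤m+n (suc c) k) lt′) u′ ◅ (depth-run k (suc c) lt′ a ◅◅ (↓-step d ◅ ε))
    where
    lt′ : suc c + k < H
    lt′ = subst (_< H) (ℕ.+-suc c k) lt
  depth-run (suc k) {H} c lt t | inj₁ u with ⊍-elim {A = depth k} {depth k ⊙ depth k} u
  ... | inj₁ v = depth-run k c (ℕ.≤-<-trans (ℕ.+-monoʳ-≤ c (ℕ.n≤1+n k)) lt) v
  ... | inj₂ v with ⊙-elim {A = depth k} {depth k} v
  ...   | m , a , b = depth-run k c lt′ a ◅◅ depth-run k c lt′ b
    where
    lt′ : c + k < H
    lt′ = ℕ.≤-<-trans (ℕ.+-monoʳ-≤ c (ℕ.n≤1+n k)) lt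

  -- Runs from (x , c) to (y , 0), split at the last visit of each counter value.
  Descent : ℕ → Fin N → Fin N → Set
  Descent zero    x y = T (Balanced x y)
  Descent (suc c) x y = ∃ λ x₁ → ∃ λ x₂ → T (Balanced x x₁) × T (down x₁ x₂) × Descent c x₂ y

  Descent-comp : ∀ c {x y z} → T (Balanced x y) → Descent c y z → Descent c x z
  Descent-comp zero    a b = Balanced-closed (depth-comp (N * N) a b)
  Descent-comp (suc c) a (x₁ , x₂ , b , d) = x₁ , x₂ , Balanced-closed (depth-comp (N * N) a b) , d

  Descent-flat : ∀ c {x y z} → T (flat x y) → Descent c y z → Descent c x z
  Descent-flat c t = Descent-comp c (Balanced-flat t)

  Descent-down : ∀ c {x y z} → T (down x y) → Descent c y z → Descent (suc c) x z
  Descent-down c d r = _ , _ , Balanced-flat refl-flat , d , r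

  -- The up move is paired with the first down move of the descent. The balanced stretch between
  -- them is nested one level deeper, and stability of the depths puts the result back into
  -- `Balanced`.
  Descent-up : ∀ c {x y z} → T (up x y) → Descent (suc c) y z → Descent c x z
  Descent-up c u (x₁ , x₂ , b , d , r) = Descent-comp c (Balanced-closed (depth-nest (N * N) u b d)) r

  Descent-run : ∀ {H x y} → N * N < H → Descent 0 x y → Run s H (x , 0) (y , 0)
  Descent-run lt = depth-run (N * N) 0 lt

-- Integer comparisons and affordable weight sequences

≤⇒0<1+diff : ∀ {a b} → b ℤ.≤ a → 0ℤ ℤ.< (a ℤ.- b) ℤ.+ 1ℤ
≤⇒0<1+diff {a} {b} le = ℤ.<-≤-trans (ℤ.+<+ (s≤s z≤n)) (ℤ.+-monoˡ-≤ 1ℤ (ℤ.i≤j⇒0≤j-i le))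

0<1+⇒0≤ : ∀ {a} → 0ℤ ℤ.< a ℤ.+ 1ℤ → 0ℤ ℤ.≤ a
0<1+⇒0≤ {+ _}          _        = ℤ.+≤+ z≤n
0<1+⇒0≤ { -[1+ zero ]} (ℤ.+<+ ())
0<1+⇒0≤ { -[1+ suc _ ]} ()

0<1+diff⇒≤ : ∀ {a b} → 0ℤ ℤ.< (a ℤ.- b) ℤ.+ 1ℤ → b ℤ.≤ a
0<1+diff⇒≤ lt = ℤ.0≤i-j⇒j≤i (0<1+⇒0≤ lt)

-- The only test of the machine is positivity, so b ≤ a becomes 0 < a - b + 1. These identities
-- rewrite the comparison of two energies into the expression that the machine evaluates: the
-- leading 1 is the adjacency entry of an edge, and the change of level is absorbed into the last
-- constant.
slack-flat : ∀ x j w j′ → ((x ℤ.+ j ℤ.+ w) ℤ.- (x ℤ.+ j′)) ℤ.+ 1ℤ ≡ 1ℤ ℤ.* (((j ℤ.+ w) ℤ.- j′) ℤ.+ 1ℤ)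
slack-flat = ℤ-Solver.solve-∀

slack-up : ∀ x V j w j′ → ((x ℤ.+ j ℤ.+ w) ℤ.- ((V ℤ.+ x) ℤ.+ j′)) ℤ.+ 1ℤ ≡
  1ℤ ℤ.* (((j ℤ.+ w) ℤ.- j′) ℤ.+ (1ℤ ℤ.- V))
slack-up = ℤ-Solver.solve-∀

slack-down : ∀ x V j w j′ → (((V ℤ.+ x) ℤ.+ j ℤ.+ w) ℤ.- (x ℤ.+ j′)) ℤ.+ 1ℤ ≡
  1ℤ ℤ.* (((j ℤ.+ w) ℤ.- j′) ℤ.+ (1ℤ ℤ.+ V))
slack-down = ℤ-Solver.solve-∀

-- The starting energy `c` generalises `NonnegativePrefixes`, the case of energy 0, so that a path
-- can be cut after its first edge.
Affordable : ℤ → List ℤ → Set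
Affordable c ws = ∀ i → 1 ≤ i → i ≤ length ws → 0ℤ ℤ.≤ c ℤ.+ foldr ℤ._+_ 0ℤ (take i ws)

Affordable-cons : ∀ {c w ws} → 0ℤ ℤ.≤ c ℤ.+ w → Affordable (c ℤ.+ w) ws → Affordable c (w ∷ ws)
Affordable-cons {c} {w} {ws} h t (suc zero) _ _ = subst (λ x → 0ℤ ℤ.≤ c ℤ.+ x) (sym (ℤ.+-identityʳ w)) h
Affordable-cons {c} {w} {ws} h t (suc (suc i)) _ (s≤s le) =
  subst (0ℤ ℤ.≤_) (ℤ.+-assoc c w _) (t (suc i) (s≤s z≤n) le)

Affordable-head : ∀ {c w ws} → Affordable c (w ∷ ws) → 0ℤ ℤ.≤ c ℤ.+ w
Affordable-head {c} {w} a = subst (λ x → 0ℤ ℤ.≤ c ℤ.+ x) (ℤ.+-identityʳ w) (a 1 (s≤s z≤n) (s≤s z≤n))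

Affordable-tail : ∀ {c w ws} → Affordable c (w ∷ ws) → Affordable (c ℤ.+ w) ws
Affordable-tail {c} {w} a (suc i) _ le =
  subst (0ℤ ℤ.≤_) (sym (ℤ.+-assoc c w _)) (a (suc (suc i)) (s≤s z≤n) (s≤s le))

-- Energy as a counter

-- The configuration (combine v j , l) stands for the vertex v with energy
-- l * W + j.  Along an edge, energy may also be lost.
module Encoding {n : ℕ} (G : Graph n) (W₋ : ℕ) (bounded : WeightsBoundedBy G (suc W₋)) where

  W = suc W₋
  N = n * W

  vertex : Fin N → Fin n
  vertex s = proj₁ (remQuot W s)

  offset : Fin N → ℕ
  offset s = toℕ (proj₂ (remQuot {n} W s))

  -- The weight matrix holds 0 both for a missing edge and for an edge of weight 0. The adjacency
  -- factor separates them: without an edge the value is 0 and the positivity test fails.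
  slack : ℤ → Fin N → Fin N → ℤ
  slack θ s t = adjacency G (vertex s) (vertex t) ℤ.*
    (((+ offset s ℤ.+ weightMatrix G (vertex s) (vertex t)) ℤ.- + offset t) ℤ.+ θ)

  edges : ℤ → BMat N
  edges θ s t = ⌊ 0ℤ ℤ.<? slack θ s t ⌋

  -- One minus a square, hence positive exactly on the diagonal: equality expressed by a positivity
  -- test.
  diagonal : Fin N → Fin N → ℤ
  diagonal s t = 1ℤ ℤ.- (+ toℕ s ℤ.- + toℕ t) ℤ.* (+ toℕ s ℤ.- + toℕ t)

  identity : BMat N
  identity s t = ⌊ 0ℤ ℤ.<? diagonal s t ⌋

  -- An up move requires j + w ≥ W + j′, which as a positivity test has θ = 1 - W; for a down move θ
  -- = 1 + W. Adding `identity` makes the flat matrices reflexive, on which the closures and the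
  -- halving rely.
  energySystem : System N
  energySystem = system (edges (1ℤ ℤ.- + W)) (edges (1ℤ ℤ.+ + W)) (edges 1ℤ ⊍ identity) (edges 1ℤ ⊍ identity)

  slack-cong : ∀ θ {s t w} → G (vertex s) (vertex t) ≡ just w →
    slack θ s t ≡ 1ℤ ℤ.* (((+ offset s ℤ.+ w) ℤ.- + offset t) ℤ.+ θ)
  slack-cong θ eq rewrite eq = refl

  edges-elim : ∀ θ {s t} → T (edges θ s t) → ∃ λ w → G (vertex s) (vertex t) ≡ just w ×
    0ℤ ℤ.< 1ℤ ℤ.* (((+ offset s ℤ.+ w) ℤ.- + offset t) ℤ.+ θ)
  edges-elim θ {s} {t} e with G (vertex s) (vertex t) in eq | toWitness e
  ... | just w  | lt = w , refl , lt
  ... | nothing | lt = ⊥-elim (ℤ.<-irrefl refl lt)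

  edges-intro : ∀ θ {s t w} → G (vertex s) (vertex t) ≡ just w →
    0ℤ ℤ.< 1ℤ ℤ.* (((+ offset s ℤ.+ w) ℤ.- + offset t) ℤ.+ θ) → T (edges θ s t)
  edges-intro θ {s} {t} eq lt = fromWitness {a? = 0ℤ ℤ.<? slack θ s t} (subst (0ℤ ℤ.<_) (sym (slack-cong θ {s} {t} eq)) lt)

  identity-elim : ∀ {s t} → T (identity s t) → s ≡ t
  identity-elim {s} {t} e = Fin.toℕ-injective (ℤ.+-injective (ℤ.i-j≡0⇒i≡j (+ toℕ s) (+ toℕ t)
    (square<1 (+ toℕ s ℤ.- + toℕ t) (toWitness {a? = 0ℤ ℤ.<? diagonal s t} e))))
    where
    square<1 : ∀ x → 0ℤ ℤ.< 1ℤ ℤ.- x ℤ.* x → x ≡ 0ℤ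
    square<1 (+ zero)       _ = refl
    square<1 (+ suc zero)   (ℤ.+<+ ())
    square<1 (+ suc (suc m)) ()
    square<1 -[1+ zero ]    (ℤ.+<+ ())
    square<1 -[1+ suc m ]   ()

  identity-refl : ∀ {s} → T (identity s s)
  identity-refl {s} = fromWitness {a? = 0ℤ ℤ.<? diagonal s s}
    (subst (λ x → 0ℤ ℤ.< 1ℤ ℤ.- x ℤ.* x) (sym (ℤ.i≡j⇒i-j≡0 {+ toℕ s} refl)) (ℤ.+<+ (s≤s z≤n)))

  energy : Fin N × ℕ → ℕ
  energy (s , l) = l * W + offset s

  Affords : Fin N × ℕ → Fin N × ℕ → Set
  Affords a b = ∃ λ w → G (vertex (proj₁ a)) (vertex (proj₁ b)) ≡ just w × + energy b ℤ.≤ + energy a ℤ.+ w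

  open System energySystem

  flat-elim : ∀ {s t} l → T (flat s t) → (s ≡ t) ⊎ Affords (s , l) (t , l)
  flat-elim {s} {t} l e with ⊍-elim {A = edges 1ℤ} {identity} e
  ... | inj₂ i = inj₁ (identity-elim i)
  ... | inj₁ a with edges-elim 1ℤ {s} {t} a
  ...   | w , eq , lt = inj₂ (w , eq , 0<1+diff⇒≤ (subst (0ℤ ℤ.<_)
            (sym (slack-flat (+ (l * W)) (+ offset s) w (+ offset t))) lt))

  step-affords : ∀ {H a b} → Step energySystem H a b → (a ≡ b) ⊎ Affords a b
  step-affords (↑-step {x} {y} {l} _ e) with edges-elim _ {x} {y} e
  ... | w , eq , lt = inj₂ (w , eq , 0<1+diff⇒≤ (subst (0ℤ ℤ.<_)
            (sym (slack-up (+ (l * W)) (+ W) (+ offset x) w (+ offset y))) lt))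
  step-affords (↓-step {x} {y} {l} e) with edges-elim _ {x} {y} e
  ... | w , eq , lt = inj₂ (w , eq , 0<1+diff⇒≤ (subst (0ℤ ℤ.<_)
            (sym (slack-down (+ (l * W)) (+ W) (+ offset x) w (+ offset y))) lt))
  step-affords (→-step {c = c} e) = [ inj₁ ∘ cong (_, suc c) , inj₂ ]′ (flat-elim (suc c) e)
  step-affords (₀-step e)         = [ inj₁ ∘ cong (_, 0) , inj₂ ]′ (flat-elim 0 e)

  -- Configurations may lose energy where the path does not, so the true energy `c` is only kept at
  -- or above that of the configuration.
  run-path : ∀ {H a b c} → Run energySystem H a b → + energy a ℤ.≤ c →
    Σ (Path G (vertex (proj₁ a)) (vertex (proj₁ b))) λ p → Affordable c (weights G p)
  run-path ε le = ε , λ { (suc i) _ () }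
  run-path {c = c} (t ◅ r) le with step-affords t
  ... | inj₁ refl = run-path r le
  ... | inj₂ (w , eq , le′) with run-path r (ℤ.≤-trans le′ (ℤ.+-monoˡ-≤ w le))
  ...   | p , a = (w , eq) ◅ p ,
                  Affordable-cons {c} {w} {weights G p} (ℤ.≤-trans (ℤ.+≤+ z≤n) (ℤ.≤-trans le′ (ℤ.+-monoˡ-≤ w le))) a

  -- b = max 0 (b′ - w).
  required : ∀ b′ w c → + b′ ℤ.≤ + c ℤ.+ w → ℤ.- (+ W) ℤ.≤ w → w ℤ.≤ + W →
    ∃ λ b → + b′ ℤ.≤ + b ℤ.+ w × b ≤ c × b ≤ b′ + W × b′ ≤ b + W
  required b′ w c le lo hi with + b′ ℤ.- w in eq
  ... | + b = b , ℤ.≤-reflexive b′≡ , ℤ.drop‿+≤+ b≤c , ℤ.drop‿+≤+ b≤ , ℤ.drop‿+≤+ b′≤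
    where
    b′≡ : + b′ ≡ + b ℤ.+ w
    b′≡ = trans (add-back (+ b′) w) (cong (ℤ._+ w) eq)
      where
      add-back : ∀ x y → x ≡ x ℤ.- y ℤ.+ y
      add-back = ℤ-Solver.solve-∀
    cancel : ∀ x y → x ℤ.+ y ℤ.- y ≡ x
    cancel = ℤ-Solver.solve-∀
    b≤c : + b ℤ.≤ + c
    b≤c = subst₂ ℤ._≤_ eq (cancel (+ c) w) (ℤ.+-monoˡ-≤ (ℤ.- w) le)
    b≤ : + b ℤ.≤ + (b′ + W)
    b≤ = subst₂ ℤ._≤_ eq (cong (λ x → + b′ ℤ.+ x) (ℤ.neg-involutive (+ W))) (ℤ.+-monoʳ-≤ (+ b′) (ℤ.neg-mono-≤ lo))
    b′≤ : + b′ ℤ.≤ + (b + W)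
    b′≤ = subst (ℤ._≤ + (b + W)) (sym b′≡) (ℤ.+-monoʳ-≤ (+ b) hi)
  ... | -[1+ b ] = 0 , b′≤w , z≤n , z≤n , ℤ.drop‿+≤+ (ℤ.≤-trans b′≤w (subst (ℤ._≤ + W) (sym (ℤ.+-identityˡ w)) hi))
    where
    b′≤w : + b′ ℤ.≤ 0ℤ ℤ.+ w
    b′≤w = subst (+ b′ ℤ.≤_) (sym (ℤ.+-identityˡ w)) (ℤ.i-j≤0⇒i≤j (subst (ℤ._≤ 0ℤ) (sym eq) ℤ.-≤+))

  -- Two levels amount to 2 W, more than W plus an offset below W. So the energies required at
  -- neighbouring vertices, which differ by at most W, lie on equal or adjacent levels.
  level-≤ : ∀ {l l′ j j′} → j < W → l′ * W + j′ ≤ (l * W + j) + W → l < l′ → l′ ≡ suc l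
  level-≤ {l} {l′} {j} {j′} j< le lt with ℕ.m≤n⇒m<n∨m≡n lt
  ... | inj₂ eq = sym eq
  ... | inj₁ gt = contradiction (begin-strict
        l′ * W + j′       ≤⟨ le ⟩
        l * W + j + W     <⟨ ℕ.+-monoˡ-< W (ℕ.+-monoʳ-< (l * W) j<) ⟩
        l * W + W + W     ≡⟨ cong (_+ W) (ℕ.+-comm (l * W) W) ⟩
        W + l * W + W     ≡⟨ ℕ.+-comm (W + l * W) W ⟩
        suc (suc l) * W   ≤⟨ ℕ.*-monoˡ-≤ W gt ⟩
        l′ * W            ≤⟨ ℕ.m≤m+n (l′ * W) j′ ⟩
        l′ * W + j′       ∎) (ℕ.<-irrefl refl)
    where open ℕ.≤-Reasoning

  configuration : ∀ u b → ∃ λ s → ∃ λ l → vertex s ≡ u × energy (s , l) ≡ b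
  configuration u b = combine u (b mod W) , b / W ,
    cong proj₁ (Fin.remQuot-combine u (b mod W)) ,
    trans (cong (λ j → b / W * W + toℕ j) (cong proj₂ (Fin.remQuot-combine u (b mod W))))
      (trans (cong (λ r → b / W * W + r) (Fin.toℕ-fromℕ< (m%n<n b W)))
        (trans (ℕ.+-comm (b / W * W) (b % W)) (sym (m≡m%n+[m/n]*n b W))))

  flat-refl : Reflexive flat
  flat-refl {s} = ⊍-introʳ {A = edges 1ℤ} {identity} {s} {s} (identity-refl {s})

  open Balance energySystem (λ {s} → flat-refl {s}) (λ t → t)

  descent-cons : ∀ {w x} s l s′ l′ → G (vertex s) (vertex s′) ≡ just w →
    + energy (s′ , l′) ℤ.≤ + energy (s , l) ℤ.+ w →
    energy (s , l) ≤ energy (s′ , l′) + W → energy (s′ , l′) ≤ energy (s , l) + W →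
    Descent l′ s′ x → Descent l s x
  descent-cons {w} s l s′ l′ eq le le₁ le₂ d with ℕ.<-cmp l l′
  ... | tri≈ _ refl _ = Descent-flat l (⊍-introˡ {A = edges 1ℤ} {identity} {s} {s′}
          (edges-intro 1ℤ eq (subst (0ℤ ℤ.<_) (slack-flat (+ (l * W)) (+ offset s) w (+ offset s′)) (≤⇒0<1+diff le)))) d
  ... | tri< lt _ _ with level-≤ {j′ = offset s′} (Fin.toℕ<n (proj₂ (remQuot {n} W s))) le₂ lt
  ...   | refl = Descent-up l (edges-intro _ eq (subst (0ℤ ℤ.<_)
            (slack-up (+ (l * W)) (+ W) (+ offset s) w (+ offset s′)) (≤⇒0<1+diff le))) d
  descent-cons {w} s l s′ l′ eq le le₁ le₂ d | tri> _ _ gt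
    with level-≤ {j′ = offset s} (Fin.toℕ<n (proj₂ (remQuot {n} W s′))) le₁ gt
  ... | refl = Descent-down l′ (edges-intro _ eq (subst (0ℤ ℤ.<_)
            (slack-down (+ (l′ * W)) (+ W) (+ offset s) w (+ offset s′)) (≤⇒0<1+diff le))) d

  base : Fin n → Fin N
  base v = combine v zero

  vertex-base : ∀ v → vertex (base v) ≡ v
  vertex-base v = cong proj₁ (Fin.remQuot-combine v (zero {W₋}))

  energy-base : ∀ v → energy (base v , 0) ≡ 0
  energy-base v = cong (toℕ ∘ proj₂) (Fin.remQuot-combine v (zero {W₋}))

  -- Required energies are computed backwards from the end of the path, where 0 is enough. Energy is
  -- lost only along edges, so working backwards is what lets the descent end exactly at `base v`
  -- with counter 0.
  path-descent : ∀ {u v} c (p : Path G u v) → Affordable (+ c) (weights G p) →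
    ∃ λ s → ∃ λ l → vertex s ≡ u × energy (s , l) ≤ c × Descent l s (base v)
  path-descent {u} c ε a = base u , 0 , vertex-base u ,
    ℕ.≤-trans (ℕ.≤-reflexive (energy-base u)) z≤n , Balanced-flat (flat-refl {base u})
  path-descent {u} c ((w , eq) ◅ p) a
    with + c ℤ.+ w in c+w | Affordable-head {+ c} {w} {weights G p} a | Affordable-tail {+ c} {w} {weights G p} a
  ... | + c′ | _ | tail with path-descent c′ p tail
  ...   | s′ , l′ , refl , le′ , d
    with required (energy (s′ , l′)) w c (subst (+ energy (s′ , l′) ℤ.≤_) (sym c+w) (ℤ.+≤+ le′))
           (proj₁ (bounded u _ w eq)) (proj₂ (bounded u _ w eq))
  ...     | b , r₁ , r₂ , r₃ , r₄ with configuration u b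
  ...       | s , l , refl , refl = s , l , refl , r₂ , descent-cons {w} s l s′ l′ eq r₁ r₃ r₄ d

  base-configuration : ∀ {u s} l → vertex s ≡ u → energy (s , l) ≤ 0 → s ≡ base u × l ≡ 0
  base-configuration {u} {s} (suc l) _ ()
  base-configuration {u} {s} zero refl le =
    trans (sym (Fin.combine-remQuot {n} W s)) (cong (combine (vertex s)) (Fin.toℕ-injective (ℕ.n≤0⇒n≡0 le))) , refl

  module _ (L : ℕ) (big : N * N < 2 ^ L) where
    open Rounds L energySystem (λ {s} → flat-refl {s}) (λ {s} → flat-refl {s}) big

    reachable-base : BMat N
    reachable-base = result

    result⇒path : ∀ {u v} → T (result (base u) (base v)) → NonnegativePrefixPath G u v
    result⇒path {u} {v} t with result-sound t
    ... | H , r with run-path r (ℤ.+≤+ (ℕ.≤-reflexive (energy-base u)))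
    ...   | p , a = subst₂ (NonnegativePrefixPath G) (vertex-base u) (vertex-base v)
                      (p , λ i 1≤i i≤ → subst (0ℤ ℤ.≤_) (ℤ.+-identityˡ _) (a i 1≤i i≤))

    path⇒result : ∀ {u v} → NonnegativePrefixPath G u v → T (result (base u) (base v))
    path⇒result {u} {v} (p , nonneg)
      with path-descent 0 p (λ i 1≤i i≤ → subst (0ℤ ℤ.≤_) (sym (ℤ.+-identityˡ _)) (nonneg i 1≤i i≤))
    ... | s , l , vs , le , d with base-configuration {u} {s} l vs le
    ...   | refl , refl = result-complete (Descent-run big d)

-- Costs

n≤2^⌈log₂n⌉ : ∀ n → n ≤ 2 ^ ⌈log₂ n ⌉
n≤2^⌈log₂n⌉ = <-rec _ go
  where
  go : ∀ n → (∀ {m} → m < n → m ≤ 2 ^ ⌈log₂ m ⌉) → n ≤ 2 ^ ⌈log₂ n ⌉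
  go zero          _  = z≤n
  go (suc zero)    _  = s≤s z≤n
  go n@(suc (suc m)) ih = begin
    n                                  ≤⟨ halves n ⟩
    ⌈ n /2⌉ + ⌈ n /2⌉                  ≤⟨ ℕ.+-mono-≤ half half ⟩
    2 ^ (⌈log₂ n ⌉ ∸ 1) + 2 ^ (⌈log₂ n ⌉ ∸ 1)
      ≡⟨ cong (λ a → 2 ^ (⌈log₂ n ⌉ ∸ 1) + a) (sym (ℕ.+-identityʳ _)) ⟩
    2 ^ suc (⌈log₂ n ⌉ ∸ 1)            ≡⟨ cong (2 ^_) (ℕ.m+[n∸m]≡n (⌈log₂⌉-mono-≤ {2} {n} (s≤s (s≤s z≤n)))) ⟩
    2 ^ ⌈log₂ n ⌉                      ∎
    where
    open ℕ.≤-Reasoning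
    halves : ∀ k → k ≤ ⌈ k /2⌉ + ⌈ k /2⌉
    halves k = ℕ.≤-trans (ℕ.≤-reflexive (sym (ℕ.⌊n/2⌋+⌈n/2⌉≡n k))) (ℕ.+-monoˡ-≤ ⌈ k /2⌉ (ℕ.⌊n/2⌋≤⌈n/2⌉ k))
    half : ⌈ n /2⌉ ≤ 2 ^ (⌈log₂ n ⌉ ∸ 1)
    half = subst (λ l → ⌈ n /2⌉ ≤ 2 ^ l) (⌈log₂⌈n/2⌉⌉≡⌈log₂n⌉∸1 n) (ih (ℕ.⌈n/2⌉<n m))

n<2^n : ∀ n → n < 2 ^ n
n<2^n zero    = s≤s z≤n
n<2^n (suc n) = ℕ.≤-trans (ℕ.+-mono-≤ (ℕ.m^n>0 2 n) (n<2^n n))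
  (ℕ.≤-reflexive (cong (λ a → 2 ^ n + a) (sym (ℕ.+-identityʳ (2 ^ n)))))

bits : ℤ → ℕ
bits z = ⌈log₂ suc ∣ z ∣ ⌉

∣z∣<2^bits : ∀ z → ∣ z ∣ < 2 ^ bits z
∣z∣<2^bits z = n≤2^⌈log₂n⌉ (suc ∣ z ∣)

size-bound : ∀ {z k} → ∣ z ∣ < 2 ^ k → size z ≤ suc k
size-bound {z} {k} lt = s≤s (ℕ.≤-trans (⌈log₂⌉-mono-≤ lt) (ℕ.≤-reflexive (⌈log₂2^n⌉≡n k)))

∣*∣<2^ : ∀ x y j k → ∣ x ∣ < 2 ^ j → ∣ y ∣ < 2 ^ k → ∣ x ℤ.* y ∣ < 2 ^ (j + k)
∣*∣<2^ x y j k p q = subst₂ _<_ (sym (ℤ.∣i*j∣≡∣i∣*∣j∣ x y)) (sym (ℕ.^-distribˡ-+-* 2 j k)) (ℕ.*-mono-< p q)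

2^-+ : ∀ j k → 2 ^ j + 2 ^ k ≤ 2 ^ suc (j + k)
2^-+ j k = begin
  2 ^ j + 2 ^ k               ≤⟨ ℕ.+-mono-≤ (ℕ.^-monoʳ-≤ 2 (ℕ.m≤m+n j k)) (ℕ.^-monoʳ-≤ 2 (ℕ.m≤n+m k j)) ⟩
  2 ^ (j + k) + 2 ^ (j + k)   ≡⟨ cong (λ a → 2 ^ (j + k) + a) (sym (ℕ.+-identityʳ _)) ⟩
  2 ^ suc (j + k)             ∎
  where open ℕ.≤-Reasoning

∣+∣<2^ : ∀ x y j k → ∣ x ∣ < 2 ^ j → ∣ y ∣ < 2 ^ k → ∣ x ℤ.+ y ∣ < 2 ^ suc (j + k)
∣+∣<2^ x y j k p q = ℕ.≤-<-trans (ℤ.∣i+j∣≤∣i∣+∣j∣ x y) (ℕ.<-≤-trans (ℕ.+-mono-< p q) (2^-+ j k))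

∣-∣<2^ : ∀ x y j k → ∣ x ∣ < 2 ^ j → ∣ y ∣ < 2 ^ k → ∣ x ℤ.- y ∣ < 2 ^ suc (j + k)
∣-∣<2^ x y j k p q = ∣+∣<2^ x (ℤ.- y) j k p (subst (_< 2 ^ k) (sym (ℤ.∣-i∣≡∣i∣ y)) q)

size-* : ∀ x y → size (x ℤ.* y) ≤ size x + size y
size-* x y = ℕ.≤-trans (size-bound {x ℤ.* y} {bits x + bits y} (∣*∣<2^ x y (bits x) (bits y) (∣z∣<2^bits x) (∣z∣<2^bits y)))
  (s≤s (ℕ.+-monoʳ-≤ _ (ℕ.n≤1+n _)))

size-+ : ∀ x y → size (x ℤ.+ y) ≤ size x + size y
size-+ x y = ℕ.≤-trans (size-bound {x ℤ.+ y} {suc (bits x + bits y)} (∣+∣<2^ x y (bits x) (bits y) (∣z∣<2^bits x) (∣z∣<2^bits y)))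
  (ℕ.≤-reflexive (cong suc (sym (ℕ.+-suc _ _))))

-- Updates of the store

update-same : ∀ σ x i v → (σ [ x , i ↦ v ]) x i ≡ v
update-same σ x i v with x ℕ.≟ x | i ℤ.≟ i
... | yes _ | yes _ = refl
... | no x≢ | _     = contradiction refl x≢
... | yes _ | no i≢ = contradiction refl i≢

update-array : ∀ σ {x y} i v j → x ≢ y → (σ [ x , i ↦ v ]) y j ≡ σ y j
update-array σ {x} {y} i v j x≢y with x ℕ.≟ y | i ℤ.≟ j
... | no _    | _ = refl
... | yes x≡y | _ = contradiction x≡y x≢y

update-index : ∀ σ x {i} v {j} → i ≢ j → (σ [ x , i ↦ v ]) x j ≡ σ x j
update-index σ x {i} v {j} i≢j with x ℕ.≟ x | i ℤ.≟ j
... | no _  | _       = refl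
... | yes _ | no _    = refl
... | yes _ | yes i≡j = contradiction i≡j i≢j

-- Evaluation of expressions over values of at most b bits.  The evaluated
-- number has degree d: it has at most b * d bits; the cost is at most
-- weight * suc b.
module Evaluation (b : ℕ) (1≤b : 1 ≤ b) where

  record Eval (σ : Store) (e : Expr) (v : ℤ) (d w : ℕ) : Set where
    constructor eval
    field
      value  : ⟦ e ⟧ σ ≡ v
      small  : ∣ v ∣ < 2 ^ (b * d)
      cheap  : cost e σ ≤ w * suc b

  degree-size : ∀ {v} d → ∣ v ∣ < 2 ^ (b * d) → size v ≤ suc d * suc b
  degree-size {v} d lt = ℕ.≤-trans (size-bound {v} {b * d} lt) (s≤s (ℕ.≤-trans
    (ℕ.≤-reflexive (ℕ.*-comm b d)) (ℕ.≤-trans (ℕ.*-monoʳ-≤ d (ℕ.n≤1+n b)) (ℕ.m≤n+m (d * suc b) b))))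

  -- The degree ∣ z ∣, from ∣ z ∣ < 2 ^ ∣ z ∣, is generous, but the literals evaluated this way are
  -- at most 2.
  eval-lit : ∀ {σ} z → Eval σ (lit z) z ∣ z ∣ (suc ∣ z ∣)
  eval-lit z = eval refl small (degree-size {z} ∣ z ∣ small)
    where
    small : ∣ z ∣ < 2 ^ (b * ∣ z ∣)
    small = ℕ.<-≤-trans (n<2^n ∣ z ∣) (ℕ.^-monoʳ-≤ 2 (ℕ.≤-trans (ℕ.≤-reflexive (sym (ℕ.*-identityˡ ∣ z ∣)))
              (ℕ.*-monoˡ-≤ ∣ z ∣ 1≤b)))

  -- A stored value is known to have at most b bits, so reading resets the degree to 1 whatever the
  -- degree of the index.
  eval-read : ∀ {σ x e i v d w} → Eval σ e i d w → σ x i ≡ v → ∣ v ∣ < 2 ^ b →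
              Eval σ (x [ e ]) v 1 (2 + w)
  eval-read {σ} {x} {e} {i} {v} {w = w} (eval ev _ c) eq lt =
    eval ⟦⟧≡ small (ℕ.≤-trans (ℕ.+-mono-≤ (subst (λ u → size u ≤ 2 * suc b) (sym ⟦⟧≡) (degree-size {v} 1 small)) c)
      (ℕ.≤-reflexive (sym (ℕ.*-distribʳ-+ (suc b) 2 w))))
    where
    ⟦⟧≡ : ⟦ x [ e ] ⟧ σ ≡ v
    ⟦⟧≡ = trans (cong (σ x) ev) eq
    small : ∣ v ∣ < 2 ^ (b * 1)
    small = subst (λ k → ∣ v ∣ < 2 ^ k) (sym (ℕ.*-identityʳ b)) lt

  private
    sum-degree : ∀ d₁ d₂ → suc (b * d₁ + b * d₂) ≤ b * suc (d₁ + d₂)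
    sum-degree d₁ d₂ = begin
      1 + (b * d₁ + b * d₂)   ≤⟨ ℕ.+-mono-≤ 1≤b (ℕ.≤-reflexive (sym (ℕ.*-distribˡ-+ b d₁ d₂))) ⟩
      b + b * (d₁ + d₂)       ≡⟨ sym (ℕ.*-suc b (d₁ + d₂)) ⟩
      b * suc (d₁ + d₂)       ∎
      where open ℕ.≤-Reasoning

    total : ∀ {s c₁ c₂} d w₁ w₂ → s ≤ suc d * suc b → c₁ ≤ w₁ * suc b → c₂ ≤ w₂ * suc b →
            s + (c₁ + c₂) ≤ (suc d + (w₁ + w₂)) * suc b
    total d w₁ w₂ p q r = ℕ.≤-trans (ℕ.+-mono-≤ p (ℕ.≤-trans (ℕ.+-mono-≤ q r)
      (ℕ.≤-reflexive (sym (ℕ.*-distribʳ-+ (suc b) w₁ w₂)))))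
      (ℕ.≤-reflexive (sym (ℕ.*-distribʳ-+ (suc b) (suc d) (w₁ + w₂))))

  eval-⊕ : ∀ {σ e₁ e₂ v₁ v₂ d₁ d₂ w₁ w₂} → Eval σ e₁ v₁ d₁ w₁ → Eval σ e₂ v₂ d₂ w₂ →
           Eval σ (e₁ ⊕ e₂) (v₁ ℤ.+ v₂) (suc (d₁ + d₂)) (suc (suc (d₁ + d₂)) + (w₁ + w₂))
  eval-⊕ {v₁ = v₁} {v₂} {d₁} {d₂} {w₁} {w₂} (eval refl s₁ c₁) (eval refl s₂ c₂) =
    eval refl small (total (suc (d₁ + d₂)) w₁ w₂ (degree-size {v₁ ℤ.+ v₂} (suc (d₁ + d₂)) small) c₁ c₂)
    where
    small = ℕ.<-≤-trans (∣+∣<2^ v₁ v₂ (b * d₁) (b * d₂) s₁ s₂) (ℕ.^-monoʳ-≤ 2 (sum-degree d₁ d₂))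

  eval-⊖ : ∀ {σ e₁ e₂ v₁ v₂ d₁ d₂ w₁ w₂} → Eval σ e₁ v₁ d₁ w₁ → Eval σ e₂ v₂ d₂ w₂ →
           Eval σ (e₁ ⊖ e₂) (v₁ ℤ.- v₂) (suc (d₁ + d₂)) (suc (suc (d₁ + d₂)) + (w₁ + w₂))
  eval-⊖ {v₁ = v₁} {v₂} {d₁} {d₂} {w₁} {w₂} (eval refl s₁ c₁) (eval refl s₂ c₂) =
    eval refl small (total (suc (d₁ + d₂)) w₁ w₂ (degree-size {v₁ ℤ.- v₂} (suc (d₁ + d₂)) small) c₁ c₂)
    where
    small = ℕ.<-≤-trans (∣-∣<2^ v₁ v₂ (b * d₁) (b * d₂) s₁ s₂) (ℕ.^-monoʳ-≤ 2 (sum-degree d₁ d₂))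

  eval-⊗ : ∀ {σ e₁ e₂ v₁ v₂ d₁ d₂ w₁ w₂} → Eval σ e₁ v₁ d₁ w₁ → Eval σ e₂ v₂ d₂ w₂ →
           Eval σ (e₁ ⊗ e₂) (v₁ ℤ.* v₂) (d₁ + d₂) (suc (d₁ + d₂) + (w₁ + w₂))
  eval-⊗ {v₁ = v₁} {v₂} {d₁} {d₂} {w₁} {w₂} (eval refl s₁ c₁) (eval refl s₂ c₂) =
    eval refl small (total (d₁ + d₂) w₁ w₂ (degree-size {v₁ ℤ.* v₂} (d₁ + d₂) small) c₁ c₂)
    where
    small = ℕ.<-≤-trans (∣*∣<2^ v₁ v₂ (b * d₁) (b * d₂) s₁ s₂)
      (ℕ.≤-reflexive (cong (2 ^_) (sym (ℕ.*-distribˡ-+ b d₁ d₂))))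

scalar : ℕ → Expr
scalar x = x [ lit 0ℤ ]

infix 4 for_below_loop_
for_below_loop_ : ℕ → Expr → Program → Program
for i below E loop p =
  (i [ lit 0ℤ ]≔ lit 0ℤ) ⨾
  (while0< E ⊖ scalar i loop (p ⨾ i [ lit 0ℤ ]≔ scalar i ⊕ lit 1ℤ))

-- Arrays 4 to 9 hold quotients and remainders by n, W and N; 10 to 12 are loop
-- counters; 13 to 16 hold the stride T, W, N and L; 17 a power of 2; 20 to 25
-- the matrices up, down, flat, flat₀ and two products; 30 + x belongs to array x
-- of the given multiplication program.
fill : ℕ → Expr → Expr → Expr → Expr → Expr → Program
fill A ι c e₁ e₂ E = for 10 below E loop (if0< c then A [ ι ]≔ e₁ else A [ ι ]≔ e₂)

-- Running times are multiples of a unit that may differ from step to step; the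
-- unit of a composition is the maximum.
module Triples (b : ℕ) (1≤b : 1 ≤ b) (Unit : ℕ → Set) (unit₀ : ℕ) (unit₀-ok : Unit unit₀)
  (Unit-⊔ : ∀ {m n} → Unit m → Unit n → Unit (m ⊔ n)) (Unit-≥ : ∀ {m} → Unit m → suc b ≤ m) where

  open Evaluation b 1≤b

  record Runs (p : Program) (σ : Store) (q : ℕ) (Post : Store → Set) : Set where
    constructor runs
    field
      {final}       : Store
      {time unit}   : ℕ
      exec          : ⟨ p , σ ⟩⇓⟨ final , time ⟩
      unit-ok       : Unit unit
      time≤         : time ≤ q * unit
      post          : Post final

  weaken : ∀ {p σ q q′ P} → q ≤ q′ → Runs p σ q P → Runs p σ q′ P
  weaken le (runs e u t h) = runs e u (ℕ.≤-trans t (ℕ.*-monoˡ-≤ _ le)) h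

  map-post : ∀ {p σ q} {P Q : Store → Set} → (∀ {σ′} → P σ′ → Q σ′) → Runs p σ q P → Runs p σ q Q
  map-post f (runs e u t h) = runs e u t (f h)

  private
    add : ∀ {s t m n} q r → s ≤ q * m → t ≤ r * n → s + t ≤ (q + r) * (m ⊔ n)
    add {m = m} {n} q r p p′ = ℕ.≤-trans (ℕ.+-mono-≤ (ℕ.≤-trans p (ℕ.*-monoʳ-≤ q (ℕ.m≤m⊔n m n)))
      (ℕ.≤-trans p′ (ℕ.*-monoʳ-≤ r (ℕ.m≤n⊔m m n)))) (ℕ.≤-reflexive (sym (ℕ.*-distribʳ-+ (m ⊔ n) q r)))

    cheap-unit : ∀ {c w m} → Unit m → c ≤ w * suc b → c ≤ w * m
    cheap-unit {w = w} u le = ℕ.≤-trans le (ℕ.*-monoʳ-≤ w (Unit-≥ u))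

  infixr 3 _then_
  _then_ : ∀ {p p′ σ q r} {P Q : Store → Set} → Runs p σ q P → (∀ {σ′} → P σ′ → Runs p′ σ′ r Q) →
           Runs (p ⨾ p′) σ (q + r) Q
  _then_ {q = q} {r} (runs e u t h) k with k h
  ... | runs e′ u′ t′ h′ = runs (seq e e′) (Unit-⊔ u u′) (add q r t t′) h′

  run-assign : ∀ {x σ e₁ e₂ v₁ v₂ d₁ d₂ w₁ w₂} {P : Store → Set} →
    Eval σ e₁ v₁ d₁ w₁ → Eval σ e₂ v₂ d₂ w₂ → P (σ [ x , v₁ ↦ v₂ ]) → Runs (x [ e₁ ]≔ e₂) σ (w₁ + w₂) P
  run-assign {w₁ = w₁} {w₂} (eval refl _ c₁) (eval refl _ c₂) h =
    runs assign unit₀-ok (cheap-unit {w = w₁ + w₂} unit₀-ok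
      (ℕ.≤-trans (ℕ.+-mono-≤ c₁ c₂) (ℕ.≤-reflexive (sym (ℕ.*-distribʳ-+ (suc b) w₁ w₂))))) h

  run-if : ∀ {e v d w p p′ σ q} {P : Store → Set} → Eval σ e v d w →
    (0ℤ ℤ.< v → Runs p σ q P) → (¬ 0ℤ ℤ.< v → Runs p′ σ q P) → Runs (if0< e then p else p′) σ (w + q) P
  run-if {v = v} {w = w} {q = q} (eval refl _ c) yes-case no-case with 0ℤ ℤ.<? v
  ... | yes lt with yes-case lt
  ...   | runs e u t h = runs (if-true lt e) (Unit-⊔ u u) (add w q (cheap-unit {w = w} u c) t) h
  run-if {v = v} {w = w} {q = q} (eval refl _ c) yes-case no-case | no ¬lt with no-case ¬lt
  ... | runs e u t h = runs (if-false ¬lt e) (Unit-⊔ u u) (add w q (cheap-unit {w = w} u c) t) h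

  -- The invariant is indexed by the number of iterations still to come, which makes termination
  -- structural and the cost a closed expression.
  run-while : ∀ {e p c w} (I : ℕ → Store → Set) →
    (∀ k {σ} → I (suc k) σ → 0ℤ ℤ.< ⟦ e ⟧ σ × cost e σ ≤ w * suc b × Runs p σ c (I k)) →
    (∀ {σ} → I 0 σ → ¬ 0ℤ ℤ.< ⟦ e ⟧ σ × cost e σ ≤ w * suc b) →
    ∀ k {σ} → I k σ → Runs (while0< e loop p) σ (k * (w + c) + w) (I 0)
  run-while {w = w} I step stop zero h with stop h
  ... | ¬lt , le = runs (while-false ¬lt) unit₀-ok (cheap-unit {w = w} unit₀-ok le) h
  run-while {c = c} {w} I step stop (suc k) h with step k h
  ... | lt , le , runs {unit = m} e u t h′ with run-while I step stop k h′
  ...   | runs {unit = m′} e′ u′ t′ h″ = runs (while-true lt e e′) (Unit-⊔ u (Unit-⊔ u u′))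
    (ℕ.≤-trans (add w (c + (k * (w + c) + w)) (cheap-unit {w = w} u le) (add c (k * (w + c) + w) t t′))
      (ℕ.≤-reflexive (cong (_* (m ⊔ (m ⊔ m′))) (trans (sym (ℕ.+-assoc w c _)) (sym (ℕ.+-assoc (w + c) _ w)))))) h″

  test-weight : ℕ → ℕ → ℕ
  test-weight d w = suc (suc (d + 1)) + (w + 3)

  -- 2 pays for resetting the loop counter and 10 for incrementing it; the test is paid once more
  -- often than the body.
  for-cost : ℕ → ℕ → ℕ → ℕ → ℕ
  for-cost d w c k = 2 + (k * (test-weight d w + (c + 10)) + test-weight d w)

  -- The descending index of `run-while` becomes an ascending one. The invariant must survive any
  -- change of the counter cell, because the loop itself writes there between two runs of the body.
  run-for : ∀ i {E K p c d w} (I : ℕ → Store → Set) → K < 2 ^ b →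
    (∀ {k σ} → σ i 0ℤ ≡ + k → I k σ → Eval σ E (+ K) d w) →
    (∀ {k σ v} → I k σ → I k (σ [ i , 0ℤ ↦ v ])) →
    (∀ k {σ} → k < K → σ i 0ℤ ≡ + k → I k σ → Runs p σ c (λ σ′ → σ′ i 0ℤ ≡ + k × I (suc k) σ′)) →
    ∀ {σ} → I 0 σ → Runs (for i below E loop p) σ (for-cost d w c K) (I K)
  run-for i {E} {K} {p} {c} {d} {w} I K< bound irrelevant body {σ₀} h =
    run-assign {P = λ σ′ → σ′ i 0ℤ ≡ + 0 × I 0 σ′} (eval-lit 0ℤ) (eval-lit 0ℤ)
      (update-same σ₀ i 0ℤ 0ℤ , irrelevant h)
    then λ { {σ′} (ctr , h′) → map-post finish (run-while {w = test-weight d w} J step stop K {σ′} (0 , refl , ctr , h′)) }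
    where
    J : ℕ → Store → Set
    J r σ = ∃ λ k → k + r ≡ K × σ i 0ℤ ≡ + k × I k σ

    finish : ∀ {σ′} → J 0 σ′ → I K σ′
    finish (k , eq , _ , h) = subst (λ k → I k _) (trans (sym (ℕ.+-identityʳ k)) eq) h

    k≤K : ∀ {k r} → k + r ≡ K → k ≤ K
    k≤K {k} {r} eq = ℕ.≤-trans (ℕ.m≤m+n k r) (ℕ.≤-reflexive eq)

    test : ∀ {k r σ} → k + r ≡ K → σ i 0ℤ ≡ + k → I k σ →
           Eval σ (E ⊖ scalar i) (+ K ℤ.- + k) (suc (d + 1)) (test-weight d w)
    test eq ctr h = eval-⊖ (bound ctr h) (eval-read (eval-lit 0ℤ) ctr (ℕ.≤-<-trans (k≤K eq) K<))

    step : ∀ r {σ} → J (suc r) σ → 0ℤ ℤ.< ⟦ E ⊖ scalar i ⟧ σ × cost (E ⊖ scalar i) σ ≤ test-weight d w * suc b ×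
           Runs (p ⨾ i [ lit 0ℤ ]≔ scalar i ⊕ lit 1ℤ) σ (c + 10) (J r)
    step r {σ} (k , eq , ctr , h) =
      subst (0ℤ ℤ.<_) (sym (trans (Eval.value ev) K-k)) (ℤ.+<+ (ℕ.m<n⇒0<n∸m k<ℕK)) , Eval.cheap ev ,
      (body k k<ℕK ctr h then λ { {σ′} (ctr′ , h′) →
        run-assign {P = J r} (eval-lit 0ℤ)
          (eval-⊕ (eval-read (eval-lit 0ℤ) ctr′ (ℕ.<-trans k<ℕK K<)) (eval-lit 1ℤ))
          (suc k , trans (sym (ℕ.+-suc k r)) eq ,
           trans (update-same σ′ i 0ℤ _) (cong +_ (ℕ.+-comm k 1)) , irrelevant h′) })
      where
      ev = test eq ctr h
      k<ℕK : k < K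
      k<ℕK = ℕ.≤-trans (s≤s (ℕ.m≤m+n k r)) (ℕ.≤-reflexive (trans (sym (ℕ.+-suc k r)) eq))
      K-k : + K ℤ.- + k ≡ + (K ∸ k)
      K-k = trans (ℤ.m-n≡m⊖n K k) (ℤ.⊖-≥ (ℕ.<⇒≤ k<ℕK))

    stop : ∀ {σ} → J 0 σ → ¬ 0ℤ ℤ.< ⟦ E ⊖ scalar i ⟧ σ × cost (E ⊖ scalar i) σ ≤ test-weight d w * suc b
    stop {σ} (k , eq , ctr , h) = (λ lt → ℤ.<-irrefl (sym zero-test) (subst (0ℤ ℤ.<_) (Eval.value ev) lt)) , Eval.cheap ev
      where
      ev = test eq ctr h
      zero-test : + K ℤ.- + k ≡ 0ℤ
      zero-test = ℤ.i≡j⇒i-j≡0 (cong +_ (trans (sym eq) (ℕ.+-identityʳ k)))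

  -- With K read as the number of entries written so far, this is the loop invariant; at the full K
  -- it is the postcondition.
  record Filled (A K : ℕ) (ix val : ℕ → ℤ) (σ₀ σ : Store) : Set where
    constructor filled
    field
      frame     : ∀ y j → y ≢ A → y ≢ 10 → σ y j ≡ σ₀ y j
      written   : ∀ k → k < K → σ A (ix k) ≡ val k
      untouched : ∀ j → (∀ k → k < K → j ≢ ix k) → σ A j ≡ σ₀ A j

  -- Injectivity of `ix` keeps earlier writes away from the current cell, so an entry may be
  -- computed from its own old value. Accumulation into a matrix depends on this.
  run-fill : ∀ {A ι c e₁ e₂ E K d w dc wc dι wι d₁ w₁ d₂ w₂ σ₀} (ix val : ℕ → ℤ) →
    A ≢ 10 → K < 2 ^ b → (∀ j k → ix j ≡ ix k → j ≡ k) →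
    (∀ {σ} → (∀ y j → y ≢ A → y ≢ 10 → σ y j ≡ σ₀ y j) → Eval σ E (+ K) d w) →
    (∀ k {σ} → k < K → σ 10 0ℤ ≡ + k → (∀ y j → y ≢ A → y ≢ 10 → σ y j ≡ σ₀ y j) → σ A (ix k) ≡ σ₀ A (ix k) →
      ∃ λ v → Eval σ c v dc wc × Eval σ ι (ix k) dι wι ×
              (0ℤ ℤ.< v → Eval σ e₁ (val k) d₁ w₁) × (¬ 0ℤ ℤ.< v → Eval σ e₂ (val k) d₂ w₂)) →
    Runs (fill A ι c e₁ e₂ E) σ₀ (for-cost d w (wc + ((wι + w₁) + (wι + w₂))) K) (Filled A K ix val σ₀)
  run-fill {A} {K = K} {wι = wι} {w₁ = w₁} {w₂ = w₂} {σ₀ = σ₀} ix val A≢10 K< inj bound entry =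
    run-for 10 (λ k → Filled A k ix val σ₀) K< (λ _ f → bound (Filled.frame f))
      (λ { {σ = σ} {v} (filled fr wr un) → filled
        (λ y j y≢A y≢10 → trans (update-array σ 0ℤ v j (y≢10 ∘ sym)) (fr y j y≢A y≢10))
        (λ k k< → trans (update-array σ 0ℤ v _ (A≢10 ∘ sym)) (wr k k<))
        (λ j h → trans (update-array σ 0ℤ v j (A≢10 ∘ sym)) (un j h)) })
      body
      (filled (λ _ _ _ _ → refl) (λ _ ()) (λ _ _ → refl))
    where
    after : ∀ k {σ} → k < K → σ 10 0ℤ ≡ + k → Filled A k ix val σ₀ σ →
            (σ [ A , ix k ↦ val k ]) 10 0ℤ ≡ + k × Filled A (suc k) ix val σ₀ (σ [ A , ix k ↦ val k ])
    after k {σ} k< ctr (filled fr wr un) = trans (update-array σ _ _ _ A≢10) ctr , filled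
      (λ y j y≢A y≢10 → trans (update-array σ _ _ j (y≢A ∘ sym)) (fr y j y≢A y≢10))
      writes
      (λ j h → trans (update-index σ A _ (h k ℕ.≤-refl ∘ sym)) (un j (λ i i<k → h i (ℕ.m<n⇒m<1+n i<k))))
      where
      writes : ∀ i → i < suc k → (σ [ A , ix k ↦ val k ]) A (ix i) ≡ val i
      writes i (s≤s i≤k) with i ℕ.≟ k
      ... | yes refl = update-same σ A (ix k) (val k)
      ... | no i≢k   = trans (update-index σ A _ (i≢k ∘ sym ∘ inj k i)) (wr i (ℕ.≤∧≢⇒< i≤k i≢k))

    body : ∀ k {σ} → k < K → σ 10 0ℤ ≡ + k → Filled A k ix val σ₀ σ → Runs _ σ _
             (λ σ′ → σ′ 10 0ℤ ≡ + k × Filled A (suc k) ix val σ₀ σ′)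
    body k {σ} k< ctr f@(filled fr wr un)
      with entry k k< ctr fr (un (ix k) (λ i i<k eq → ℕ.<-irrefl (sym (inj k i eq)) i<k))
    ... | v , ec , eι , e₁ , e₂ = run-if ec
      (λ lt → weaken (ℕ.m≤m+n (wι + w₁) (wι + w₂)) (run-assign eι (e₁ lt) (after k k< ctr f)))
      (λ ¬lt → weaken (ℕ.m≤n+m (wι + w₂) (wι + w₁)) (run-assign eι (e₂ ¬lt) (after k k< ctr f)))

-- Relocation

-- A copy of a program acting on the cells T * (2 i + 1) of the arrays 30 + x,
-- where the number T is kept in array 13.  With T doubled from one use to
-- the next, every use finds its cells untouched.
address : Expr → Expr
address e = scalar 13 ⊗ (lit (+ 2) ⊗ e ⊕ lit 1ℤ)

relocateᵉ : Expr → Expr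
relocateᵉ (lit z)   = lit z
relocateᵉ (x [ e ]) = (30 + x) [ address (relocateᵉ e) ]
relocateᵉ (d ⊕ e)   = relocateᵉ d ⊕ relocateᵉ e
relocateᵉ (d ⊖ e)   = relocateᵉ d ⊖ relocateᵉ e
relocateᵉ (d ⊗ e)   = relocateᵉ d ⊗ relocateᵉ e

relocate : Program → Program
relocate skip                       = skip
relocate (x [ d ]≔ e)               = (30 + x) [ address (relocateᵉ d) ]≔ relocateᵉ e
relocate (p ⨾ q)                    = relocate p ⨾ relocate q
relocate (if0< e then p else q)     = if0< relocateᵉ e then relocate p else relocate q
relocate (while0< e loop p)         = while0< relocateᵉ e loop relocate p

module Relocation (T : ℤ) .{{_ : ℤ.NonZero T}} where

  location : ℤ → ℤ
  location i = T ℤ.* (+ 2 ℤ.* i ℤ.+ 1ℤ)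

  location-injective : ∀ {i j} → location i ≡ location j → i ≡ j
  location-injective {i} {j} eq =
    ℤ.*-cancelˡ-≡ (+ 2) i j (∙-cancelʳ 1ℤ (+ 2 ℤ.* i) (+ 2 ℤ.* j) (ℤ.*-cancelˡ-≡ T _ _ eq))

  record Simulates (σ τ : Store) : Set where
    constructor simulates
    field
      base  : τ 13 0ℤ ≡ T
      cells : ∀ x i → τ (30 + x) (location i) ≡ σ x i

  abstract
    overhead : ℕ
    overhead = 22 + 2 * size T

    overhead≡ : overhead ≡ 22 + 2 * size T
    overhead≡ = refl

  address-value : ∀ {τ} e {i} → τ 13 0ℤ ≡ T → ⟦ e ⟧ τ ≡ i → ⟦ address e ⟧ τ ≡ location i
  address-value e base refl rewrite base = refl

  -- For an index of size s and cost c, the sizes add up to at most c + 2 size T + 3 s + 19. As s ≥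
  -- 1, this is within c + (22 + 2 size T) s, the origin of `overhead`.
  address-cost : ∀ {τ} e {i} → τ 13 0ℤ ≡ T → ⟦ e ⟧ τ ≡ i → cost (address e) τ ≤ cost e τ + overhead * size i
  address-cost {τ} e base refl rewrite base | overhead≡ = ℕ.≤-trans
    (ℕ.+-mono-≤ (ℕ.≤-trans (size-* T (+ 2 ℤ.* i ℤ.+ 1ℤ)) (ℕ.+-monoʳ-≤ (size T) s2i+1))
      (ℕ.+-monoʳ-≤ (size T + 1) (ℕ.+-mono-≤ s2i+1 (ℕ.+-monoˡ-≤ 2 (ℕ.+-monoˡ-≤ (3 + cost e τ) s2i)))))
    (ℕ.≤-trans (ℕ.m≤m+n _ (2 * size T * bits i + 19 * bits i)) (ℕ.≤-reflexive (arith (size T) (cost e τ) (bits i))))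
    where
    i = ⟦ e ⟧ τ
    arith : ∀ t c s′ → (t + (5 + suc s′)) + ((t + 1) + ((5 + suc s′) + (((3 + suc s′) + (3 + c)) + 2))) + (2 * t * s′ + 19 * s′)
              ≡ c + (22 + 2 * t) * suc s′
    arith = ℕ-Solver.solve-∀
    s2i : size (+ 2 ℤ.* i) ≤ 3 + size i
    s2i = size-* (+ 2) i
    s2i+1 : size (+ 2 ℤ.* i ℤ.+ 1ℤ) ≤ 5 + size i
    s2i+1 = ℕ.≤-trans (size-+ (+ 2 ℤ.* i) 1ℤ) (ℕ.≤-trans (ℕ.+-monoˡ-≤ 2 s2i) (ℕ.≤-reflexive (ℕ.+-comm (3 + size i) 2)))

  private
    step : ∀ a s c → s + c + a * s ≡ s + a * s + c
    step = ℕ-Solver.solve-∀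

    combine-cost : ∀ a s s₁ s₂ c₁ c₂ c₁′ c₂′ → c₁′ + a * s₁ ≤ suc a * c₁ → c₂′ + a * s₂ ≤ suc a * c₂ →
      (s + (c₁′ + c₂′)) + a * s ≤ suc a * (s + (c₁ + c₂))
    combine-cost a s s₁ s₂ c₁ c₂ c₁′ c₂′ h₁ h₂ = begin
      (s + (c₁′ + c₂′)) + a * s               ≡⟨ step a s (c₁′ + c₂′) ⟩
      suc a * s + (c₁′ + c₂′)                 ≤⟨ ℕ.+-monoʳ-≤ (suc a * s) (ℕ.+-mono-≤ (ℕ.m+n≤o⇒m≤o c₁′ h₁) (ℕ.m+n≤o⇒m≤o c₂′ h₂)) ⟩
      suc a * s + (suc a * c₁ + suc a * c₂)   ≡⟨ distr (suc a) s c₁ c₂ ⟩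
      suc a * (s + (c₁ + c₂))                 ∎
      where
      open ℕ.≤-Reasoning
      distr : ∀ k s c₁ c₂ → k * s + (k * c₁ + k * c₂) ≡ k * (s + (c₁ + c₂))
      distr = ℕ-Solver.solve-∀

  module _ {σ τ : Store} (sim : Simulates σ τ) where
    open Simulates sim

    relocateᵉ-value : ∀ e → ⟦ relocateᵉ e ⟧ τ ≡ ⟦ e ⟧ σ
    relocateᵉ-value (lit z)   = refl
    relocateᵉ-value (x [ e ]) = trans (cong (τ (30 + x)) (address-value (relocateᵉ e) base (relocateᵉ-value e))) (cells x _)
    relocateᵉ-value (d ⊕ e)   = cong₂ ℤ._+_ (relocateᵉ-value d) (relocateᵉ-value e)
    relocateᵉ-value (d ⊖ e)   = cong₂ ℤ._-_ (relocateᵉ-value d) (relocateᵉ-value e)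
    relocateᵉ-value (d ⊗ e)   = cong₂ ℤ._*_ (relocateᵉ-value d) (relocateᵉ-value e)

    -- The second summand pays for turning the value into an address.
    relocateᵉ-cost : ∀ e → cost (relocateᵉ e) τ + overhead * size (⟦ e ⟧ σ) ≤ suc overhead * cost e σ
    address-relocateᵉ-cost : ∀ e → cost (address (relocateᵉ e)) τ ≤ suc overhead * cost e σ

    address-relocateᵉ-cost e = ℕ.≤-trans (address-cost (relocateᵉ e) base (relocateᵉ-value e)) (relocateᵉ-cost e)

    relocateᵉ-cost (lit z)   = ℕ.≤-refl
    relocateᵉ-cost (x [ e ]) rewrite relocateᵉ-value (x [ e ]) = begin
      (s + cost (address (relocateᵉ e)) τ) + overhead * s   ≡⟨ step overhead s _ ⟩
      suc overhead * s + cost (address (relocateᵉ e)) τ     ≤⟨ ℕ.+-monoʳ-≤ (suc overhead * s) (address-relocateᵉ-cost e) ⟩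
      suc overhead * s + suc overhead * cost e σ            ≡⟨ sym (ℕ.*-distribˡ-+ (suc overhead) s (cost e σ)) ⟩
      suc overhead * (s + cost e σ)                         ∎
      where
      open ℕ.≤-Reasoning
      s = size (σ x (⟦ e ⟧ σ))
    relocateᵉ-cost (d ⊕ e) rewrite relocateᵉ-value (d ⊕ e) =
      combine-cost overhead (size (⟦ d ⊕ e ⟧ σ)) (size (⟦ d ⟧ σ)) (size (⟦ e ⟧ σ)) (cost d σ) (cost e σ)
        (cost (relocateᵉ d) τ) (cost (relocateᵉ e) τ) (relocateᵉ-cost d) (relocateᵉ-cost e)
    relocateᵉ-cost (d ⊖ e) rewrite relocateᵉ-value (d ⊖ e) =
      combine-cost overhead (size (⟦ d ⊖ e ⟧ σ)) (size (⟦ d ⟧ σ)) (size (⟦ e ⟧ σ)) (cost d σ) (cost e σ)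
        (cost (relocateᵉ d) τ) (cost (relocateᵉ e) τ) (relocateᵉ-cost d) (relocateᵉ-cost e)
    relocateᵉ-cost (d ⊗ e) rewrite relocateᵉ-value (d ⊗ e) =
      combine-cost overhead (size (⟦ d ⊗ e ⟧ σ)) (size (⟦ d ⟧ σ)) (size (⟦ e ⟧ σ)) (cost d σ) (cost e σ)
        (cost (relocateᵉ d) τ) (cost (relocateᵉ e) τ) (relocateᵉ-cost d) (relocateᵉ-cost e)

    test-cost : ∀ e → cost (relocateᵉ e) τ ≤ suc overhead * cost e σ
    test-cost e = ℕ.m+n≤o⇒m≤o (cost (relocateᵉ e) τ) (relocateᵉ-cost e)

  Frame : Store → Store → Set
  Frame τ τ′ = ∀ y j → (∀ x i → y ≡ 30 + x → j ≢ location i) → τ′ y j ≡ τ y j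

  record Simulation (p : Program) (σ′ τ : Store) (t : ℕ) : Set where
    constructor simulation
    field
      {final} : Store
      {time}  : ℕ
      exec    : ⟨ relocate p , τ ⟩⇓⟨ final , time ⟩
      sim     : Simulates σ′ final
      frame   : Frame τ final
      time≤   : time ≤ suc overhead * t

  simulates-update : ∀ {σ τ} x i v → Simulates σ τ →
    Simulates (σ [ x , i ↦ v ]) (τ [ 30 + x , location i ↦ v ])
  simulates-update {σ} {τ} x i v (simulates base cells) =
    simulates (trans (update-array τ {30 + x} (location i) v 0ℤ λ ()) base) go
    where
    go : ∀ y j → (τ [ 30 + x , location i ↦ v ]) (30 + y) (location j) ≡ (σ [ x , i ↦ v ]) y j
    go y j with x ℕ.≟ y | i ℤ.≟ j
    ... | no x≢y   | _        = trans (update-array τ (location i) v (location j) (x≢y ∘ ℕ.+-cancelˡ-≡ 30 x y)) (cells y j)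
    ... | yes refl | no i≢j   = trans (update-index τ (30 + x) v (i≢j ∘ location-injective)) (cells x j)
    ... | yes refl | yes refl = update-same τ (30 + x) (location i) v

  private
    add-cost : ∀ {a b} k a′ b′ → a ≤ k * a′ → b ≤ k * b′ → a + b ≤ k * (a′ + b′)
    add-cost k a′ b′ p q = ℕ.≤-trans (ℕ.+-mono-≤ p q) (ℕ.≤-reflexive (sym (ℕ.*-distribˡ-+ k a′ b′)))

  simulate : ∀ {p σ σ′ τ t} → ⟨ p , σ ⟩⇓⟨ σ′ , t ⟩ → Simulates σ τ → Simulation p σ′ τ t
  simulate skip s = simulation skip s (λ _ _ _ → refl) (s≤s z≤n)
  simulate {τ = τ} (assign {x} {d} {e} {σ}) s = simulation assign
    (subst₂ (λ i v → Simulates _ (τ [ 30 + x , i ↦ v ]))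
      (sym (address-value (relocateᵉ d) (Simulates.base s) (relocateᵉ-value s d))) (sym (relocateᵉ-value s e))
      (simulates-update x (⟦ d ⟧ σ) (⟦ e ⟧ σ) s))
    frame
    (add-cost (suc overhead) (cost d σ) (cost e σ) (address-relocateᵉ-cost s d) (test-cost s e))
    where
    frame : Frame τ (τ [ 30 + x , ⟦ address (relocateᵉ d) ⟧ τ ↦ ⟦ relocateᵉ e ⟧ τ ])
    frame y j out with (30 + x) ℕ.≟ y
    ... | no x≢y   = refl
    ... | yes refl with ⟦ address (relocateᵉ d) ⟧ τ ℤ.≟ j
    ...   | no _ = refl
    ...   | yes eq = contradiction (trans (sym eq) (address-value (relocateᵉ d) (Simulates.base s) (relocateᵉ-value s d)))
                       (out x (⟦ d ⟧ σ) refl)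
  simulate (seq {s = t₁} {t₂} e f) s with simulate e s
  ... | simulation e′ s′ fr t with simulate f s′
  ...   | simulation f′ s″ fr′ t′ = simulation (seq e′ f′) s″
          (λ y j out → trans (fr′ y j out) (fr y j out)) (add-cost (suc overhead) t₁ t₂ t t′)
  simulate (if-true {e} {σ = σ} {t = t₁} lt f) s with simulate f s
  ... | simulation f′ s′ fr t = simulation (if-true (subst (0ℤ ℤ.<_) (sym (relocateᵉ-value s e)) lt) f′) s′ fr
          (add-cost (suc overhead) (cost e σ) t₁ (test-cost s e) t)
  simulate (if-false {e} {σ = σ} {t = t₁} ¬lt f) s with simulate f s
  ... | simulation f′ s′ fr t = simulation (if-false (¬lt ∘ subst (0ℤ ℤ.<_) (relocateᵉ-value s e)) f′) s′ fr
          (add-cost (suc overhead) (cost e σ) t₁ (test-cost s e) t)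
  simulate (while-false {e} ¬lt) s =
    simulation (while-false (¬lt ∘ subst (0ℤ ℤ.<_) (relocateᵉ-value s e))) s (λ _ _ _ → refl) (test-cost s e)
  simulate (while-true {e} {σ = σ} {s = t₁} {t₂} lt f g) s with simulate f s
  ... | simulation f′ s′ fr t with simulate g s′
  ...   | simulation g′ s″ fr′ t′ = simulation
          (while-true (subst (0ℤ ℤ.<_) (sym (relocateᵉ-value s e)) lt) f′ g′) s″
          (λ y j out → trans (fr′ y j out) (fr y j out))
          (add-cost (suc overhead) (cost e σ) (t₁ + t₂) (test-cost s e) (add-cost (suc overhead) t₁ t₂ t t′))

-- Every assignment fills at most one cell of the output array, so the number of
-- nonzero outputs bounds the running time from below.
nonzero : ℤ → ℕ
nonzero (+ zero)  = 0
nonzero (+ suc _) = 1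
nonzero -[1+ _ ]  = 1

nonzeros : ℕ → Store → ℕ
nonzeros zero    σ = 0
nonzeros (suc k) σ = nonzero (σ 3 (+ k)) + nonzeros k σ

nonzero≤1 : ∀ z → nonzero z ≤ 1
nonzero≤1 (+ zero)  = z≤n
nonzero≤1 (+ suc _) = ℕ.≤-refl
nonzero≤1 -[1+ _ ]  = ℕ.≤-refl

nonzeros-cong : ∀ K {σ τ : Store} → (∀ k → k < K → σ 3 (+ k) ≡ τ 3 (+ k)) → nonzeros K σ ≡ nonzeros K τ
nonzeros-cong zero    h = refl
nonzeros-cong (suc K) h = cong₂ _+_ (cong nonzero (h K ℕ.≤-refl)) (nonzeros-cong K λ k k< → h k (ℕ.m<n⇒m<1+n k<))

nonzeros-update : ∀ K σ x i v → nonzeros K (σ [ x , i ↦ v ]) ≤ 1 + nonzeros K σ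
nonzeros-update zero    σ x i v = z≤n
nonzeros-update (suc K) σ x i v with x ℕ.≟ 3 | i ℤ.≟ + K
... | no x≢3 | _ = ℕ.≤-trans (ℕ.+-monoʳ-≤ (nonzero (σ 3 (+ K))) (ℕ.≤-reflexive
        (nonzeros-cong K λ k _ → update-array σ i v (+ k) x≢3))) (ℕ.n≤1+n _)
... | yes refl | yes refl = ℕ.+-mono-≤ (nonzero≤1 v) (ℕ.≤-trans (ℕ.≤-reflexive
        (nonzeros-cong K λ k k< → update-index σ 3 v λ eq → ℕ.<-irrefl (sym (ℤ.+-injective eq)) k<)) (ℕ.m≤n+m _ (nonzero (σ 3 (+ K)))))
... | yes refl | no _ = ℕ.≤-trans (ℕ.+-monoʳ-≤ (nonzero (σ 3 (+ K))) (nonzeros-update K σ 3 i v))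
        (ℕ.≤-reflexive (ℕ.+-suc (nonzero (σ 3 (+ K))) (nonzeros K σ)))

cost-positive : ∀ e σ → 1 ≤ cost e σ
cost-positive (lit z)   σ = s≤s z≤n
cost-positive (x [ e ]) σ = s≤s z≤n
cost-positive (d ⊕ e)   σ = s≤s z≤n
cost-positive (d ⊖ e)   σ = s≤s z≤n
cost-positive (d ⊗ e)   σ = s≤s z≤n

nonzeros≤time : ∀ K {p σ σ′ t} → ⟨ p , σ ⟩⇓⟨ σ′ , t ⟩ → nonzeros K σ′ ≤ t + nonzeros K σ
nonzeros≤time K skip = ℕ.n≤1+n _
nonzeros≤time K (assign {x} {d} {e} {σ}) = ℕ.≤-trans (nonzeros-update K σ x _ _)
  (ℕ.+-monoˡ-≤ (nonzeros K σ) (ℕ.≤-trans (cost-positive d σ) (ℕ.m≤m+n _ _)))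
nonzeros≤time K (seq {σ = σ} {s = s} {t} f g) = ℕ.≤-trans (nonzeros≤time K g) (ℕ.≤-trans (ℕ.+-monoʳ-≤ t (nonzeros≤time K f))
  (ℕ.≤-reflexive (trans (sym (ℕ.+-assoc t s (nonzeros K σ))) (cong (_+ nonzeros K σ) (ℕ.+-comm t s)))))
nonzeros≤time K (if-true {e} {σ = σ} _ f)  = ℕ.≤-trans (nonzeros≤time K f) (ℕ.+-monoˡ-≤ (nonzeros K σ) (ℕ.m≤n+m _ (cost e σ)))
nonzeros≤time K (if-false {e} {σ = σ} _ f) = ℕ.≤-trans (nonzeros≤time K f) (ℕ.+-monoˡ-≤ (nonzeros K σ) (ℕ.m≤n+m _ (cost e σ)))
nonzeros≤time K (while-false {e} {σ = σ} _) = ℕ.m≤n+m _ (cost e σ)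
nonzeros≤time K (while-true {e} {σ = σ} {s = s} {t} _ f g) = ℕ.≤-trans (nonzeros≤time K g)
  (ℕ.≤-trans (ℕ.+-monoʳ-≤ t (nonzeros≤time K f))
  (ℕ.≤-trans (ℕ.≤-reflexive (trans (sym (ℕ.+-assoc t s (nonzeros K σ))) (cong (_+ nonzeros K σ) (ℕ.+-comm t s))))
    (ℕ.+-monoˡ-≤ (nonzeros K σ) (ℕ.m≤n+m (s + t) (cost e σ)))))

-- 0-1 matrices and their integer products

ints : ∀ {n} → BMat n → Matrix n
ints A i j = + bit (A i j)

rowMajor-< : ∀ {n} (A : Matrix n) {k} (k< : k < n * n) → rowMajor A (+ k) ≡ uncurry A (remQuot n (fromℕ< k<))
rowMajor-< {n} A {k} k< with k ℕ.<? n * n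
... | yes _ = refl
... | no k≮ = contradiction k< k≮

rowMajor-combine : ∀ {n} (A : Matrix n) i j → rowMajor A (+ toℕ (combine i j)) ≡ A i j
rowMajor-combine {n} A i j = trans (rowMajor-< A (Fin.toℕ<n (combine i j)))
  (trans (cong (uncurry A ∘ remQuot n) (Fin.fromℕ<-toℕ (combine i j) (Fin.toℕ<n (combine i j))))
         (cong (uncurry A) (Fin.remQuot-combine i j)))

row-column : ∀ {n k} → k < n * n → ∃ λ (i : Fin n) → ∃ λ (j : Fin n) → toℕ (combine i j) ≡ k
row-column {n} {k} k< = let i , j = remQuot n (fromℕ< k<) in
  i , j , trans (cong toℕ (Fin.combine-remQuot {n} n (fromℕ< k<))) (Fin.toℕ-fromℕ< k<)

count-∧ : ∀ {n} (f g : Fin n → Bool) → sum (λ k → + bit (f k) ℤ.* + bit (g k)) ≡ + count (λ k → f k ∧ g k)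
count-∧ {zero}  f g = refl
count-∧ {suc n} f g = cong₂ ℤ._+_ (head (f zero) (g zero)) (count-∧ (f ∘ suc) (g ∘ suc))
  where
  head : ∀ a b → + bit a ℤ.* + bit b ≡ + bit (a ∧ b)
  head false b     = refl
  head true  false = refl
  head true  true  = refl

count-positive : ∀ {n} (f : Fin n → Bool) → 0 < count f → ∃ λ k → T (f k)
count-positive {suc n} f lt with f zero in f₀
... | true  = zero , subst T (sym f₀) tt
... | false with count-positive (f ∘ suc) lt
...   | k , t = suc k , t

count-at : ∀ {n} (f : Fin n → Bool) k → T (f k) → 0 < count f
count-at f zero    t with f zero
... | true = s≤s z≤n
count-at f (suc k) t = ℕ.≤-trans (count-at (f ∘ suc) k t) (ℕ.m≤n+m _ _)

-- The integer product counts intermediate indices. Its positivity is therefore the Boolean product,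
-- and its entries are at most n.
product-entry : ∀ {n} (A B : BMat n) {C : Matrix n} → IsProduct (ints A) (ints B) C →
  ∀ i j → C i j ≡ + count (λ k → A i k ∧ B k j)
product-entry A B prod i j = trans (prod i j) (count-∧ (A i) (λ k → B k j))

nonzeros-full : ∀ K σ → (∀ k → k < K → nonzero (σ 3 (+ k)) ≡ 1) → nonzeros K σ ≡ K
nonzeros-full zero    σ h = refl
nonzeros-full (suc K) σ h = cong₂ _+_ (h K ℕ.≤-refl) (nonzeros-full K σ (λ k k< → h k (ℕ.m<n⇒m<1+n k<)))

nonzeros-empty : ∀ K {n} (A B : Matrix n) → nonzeros K (input A B) ≡ 0
nonzeros-empty zero    A B = refl
nonzeros-empty (suc K) A B = nonzeros-empty K A B

all-ones : ∀ {n} → BMat n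
all-ones _ _ = true

-- In the product of two all-ones matrices every entry is n, hence nonzero, while array 3 of the
-- input is empty.
product-time : ∀ {n p σ t} .{{_ : NonZero n}} → let J = ints (all-ones {n}) in
  ⟨ p , input J J ⟩⇓⟨ σ , t ⟩ → IsProduct J J (output σ) → n * n ≤ t
product-time {n} {σ = σ} {t} e prod = begin
  n * n                            ≡⟨ nonzeros-full (n * n) σ full ⟨
  nonzeros (n * n) σ               ≤⟨ nonzeros≤time (n * n) e ⟩
  t + nonzeros (n * n) (input (ints (all-ones {n})) (ints all-ones))  ≡⟨ cong (λ z → t + z) (nonzeros-empty (n * n) (ints (all-ones {n})) (ints all-ones)) ⟩
  t + 0                            ≡⟨ ℕ.+-identityʳ t ⟩
  t                                ∎
  where
  open ℕ.≤-Reasoning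
  full : ∀ k → k < n * n → nonzero (σ 3 (+ k)) ≡ 1
  full k k< with row-column {n} k<
  ... | i , j , refl rewrite product-entry (all-ones {n}) all-ones prod i j with count (λ (_ : Fin n) → true) | count-at (λ (_ : Fin n) → true) i tt
  ...   | suc _ | _ = refl

-- Boolean products by the relocated program

kept : ℕ → Bool
kept y = (y ℕ.<ᵇ 20) ∧ (not (y ℕ.≡ᵇ 10) ∧ not (y ℕ.≡ᵇ 13))

Keeps : Store → Store → Set
Keeps σ τ = ∀ y {_ : T (kept y)} j → τ y j ≡ σ y j

kept⇒< : ∀ {y} → T (kept y) → y < 20
kept⇒< {y} t = ℕ.<ᵇ⇒< y 20 (proj₁ (Equivalence.to T-∧ t))

kept⇒≢10 : ∀ {y} → T (kept y) → y ≢ 10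
kept⇒≢10 () refl

kept⇒≢13 : ∀ {y} → T (kept y) → y ≢ 13
kept⇒≢13 () refl

matrix : Fin 6 → ℕ
matrix m = 20 + toℕ m

p≢matrix : ∀ m x → matrix m ≢ 30 + x
p≢matrix m x eq = ℕ.<⇒≱ (Fin.toℕ<n m) (ℕ.≤-trans (ℕ.≤-trans (ℕ.≤ᵇ⇒≤ 6 10 tt) (ℕ.m≤m+n 10 x))
  (ℕ.≤-reflexive (sym (ℕ.+-cancelˡ-≡ 20 _ _ eq))))

_[_≔_] : ∀ {n} → (Fin 6 → BMat n) → Fin 6 → BMat n → Fin 6 → BMat n
(μ [ d ≔ A ]) m = if ⌊ m Fin.≟ d ⌋ then A else μ m

entries : Expr
entries = scalar 15 ⊗ scalar 15

-- The test is the literal 0, so that `fill` always takes its second branch and becomes a copying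
-- loop into relocated cells.
copy : ℕ → ℕ → Program
copy x y = fill y (address (scalar 10)) (lit 0ℤ) (lit 0ℤ) (x [ scalar 10 ]) entries

-- Array 33 is the output array 3 of the relocated program. Where the product is 0, the factor
-- `bit acc` keeps the old entry or erases it.
collect : Fin 6 → Bool → Program
collect d acc = fill (matrix d) (scalar 10) (33 [ address (scalar 10) ]) (lit 1ℤ)
  (lit (+ bit acc) ⊗ matrix d [ scalar 10 ]) entries

-- The first three statements lay out the store `input A B` in relocated cells; the last doubles the
-- stride for the next call.
multiply : Program → Bool → Fin 6 → Fin 6 → Fin 6 → Program
multiply p acc x y d =
  (30 [ address (lit 0ℤ) ]≔ scalar 15) ⨾ copy (matrix x) 31 ⨾ copy (matrix y) 32 ⨾
  relocate p ⨾ collect d acc ⨾ (13 [ lit 0ℤ ]≔ scalar 13 ⊕ scalar 13)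

module Multiplication
  (p : Program) (N : ℕ) .{{N≢0 : NonZero N}} (b : ℕ) (NN<2^b : N * N < 2 ^ b)
  (Fine : ℕ → Set) (Fine-⊔ : ∀ {s t} → Fine s → Fine t → Fine (s ⊔ t))
  (multiplies : ∀ (A B : Matrix N) → (∀ i j → ∣ A i j ∣ ≤ 1) → (∀ i j → ∣ B i j ∣ ≤ 1) →
    ∃[ σ ] ∃[ t ] ⟨ p , input A B ⟩⇓⟨ σ , t ⟩ × IsProduct A B (output σ) × Fine t)
  where

  1≤NN : 1 ≤ N * N
  1≤NN = ℕ.*-mono-≤ (ℕ.>-nonZero⁻¹ N) (ℕ.>-nonZero⁻¹ N)

  1≤b : 1 ≤ b
  1≤b = go b (ℕ.≤-<-trans 1≤NN NN<2^b)
    where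
    go : ∀ b → 1 < 2 ^ b → 1 ≤ b
    go zero    (s≤s ())
    go (suc b) _ = s≤s z≤n

  multiplies-bits : ∀ (A B : BMat N) → ∃[ σ ] ∃[ t ]
    ⟨ p , input (ints A) (ints B) ⟩⇓⟨ σ , t ⟩ × IsProduct (ints A) (ints B) (output σ) × Fine t
  multiplies-bits A B = multiplies (ints A) (ints B) (λ i j → bit≤1 (A i j)) (λ i j → bit≤1 (B i j))

  -- The product of other matrices may take less time than N * N. The maximum with this time
  -- restores the lower bound and stays `Fine`.
  sample : ∃ λ t → N * N ≤ t × Fine t
  sample = let σ , t , e , prod , fine = multiplies-bits all-ones all-ones in t , product-time e prod , fine

  -- The factor suc b covers the sizes of values and the slowdown by relocation. The bound N * N ≤ t
  -- lets a loop over a whole matrix take a constant number of units.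
  Unit : ℕ → Set
  Unit m = ∃ λ t → m ≡ suc b * t × N * N ≤ t × Fine t

  Unit-⊔ : ∀ {m n} → Unit m → Unit n → Unit (m ⊔ n)
  Unit-⊔ (s , refl , le , f) (t , refl , _ , g) =
    s ⊔ t , sym (ℕ.*-distribˡ-⊔ (suc b) s t) , ℕ.≤-trans le (ℕ.m≤m⊔n s t) , Fine-⊔ f g

  Unit-≥ : ∀ {m} → Unit m → suc b ≤ m
  Unit-≥ (t , refl , le , _) = ℕ.≤-trans (ℕ.≤-reflexive (sym (ℕ.*-identityʳ (suc b)))) (ℕ.*-monoʳ-≤ (suc b) (ℕ.≤-trans 1≤NN le))

  open Evaluation b 1≤b public

  Unit₁ : ℕ → Set
  Unit₁ m = m ≡ suc b

  Unit₁-⊔ : ∀ {m n} → Unit₁ m → Unit₁ n → Unit₁ (m ⊔ n)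
  Unit₁-⊔ {m} refl refl = ℕ.⊔-idem m

  Unit₁-≥ : ∀ {m} → Unit₁ m → suc b ≤ m
  Unit₁-≥ refl = ℕ.≤-refl

  unit₀ : ℕ
  unit₀ = suc b * proj₁ sample

  unit₀-ok : Unit unit₀
  unit₀-ok = proj₁ sample , refl , proj₂ sample

  module Plain = Triples b 1≤b Unit₁ (suc b) refl Unit₁-⊔ Unit₁-≥
  module Fast = Triples b 1≤b Unit unit₀ unit₀-ok Unit-⊔ Unit-≥

  -- Charging each iteration a unit of `Fast`, which already exceeds N * N, would be far too much.
  -- Loops over entries are counted in units suc b and converted as a whole.
  speed : ∀ {p σ q P} c → q ≤ c * (N * N) → Plain.Runs p σ q P → Fast.Runs p σ c P
  speed {q = q} c le (Plain.runs e refl t h) = Fast.runs e (proj₁ sample , refl , proj₂ sample) (begin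
    _                        ≤⟨ t ⟩
    q * suc b                ≤⟨ ℕ.*-monoˡ-≤ (suc b) le ⟩
    c * (N * N) * suc b      ≤⟨ ℕ.*-monoˡ-≤ (suc b) (ℕ.*-monoʳ-≤ c (proj₁ (proj₂ sample))) ⟩
    c * s * suc b            ≡⟨ ℕ.*-assoc c s (suc b) ⟩
    c * (s * suc b)          ≡⟨ cong (c *_) (ℕ.*-comm s (suc b)) ⟩
    c * (suc b * s)          ∎) h
    where
    open ℕ.≤-Reasoning
    s = proj₁ sample

  fast-time : ∀ {p σ q P} → Fast.Runs p σ q P →
    ∃[ σ′ ] ∃[ t ] ∃[ s ] ⟨ p , σ ⟩⇓⟨ σ′ , t ⟩ × P σ′ × t ≤ q * suc b * s × Fine s
  fast-time {q = q} (Fast.runs e (s , refl , _ , fine) t≤ h) =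
    _ , _ , s , e , h , ℕ.≤-trans t≤ (ℕ.≤-reflexive (sym (ℕ.*-assoc q (suc b) s))) , fine

  loop-weight : ℕ → ℕ → ℕ → ℕ
  loop-weight d w c = 2 + ((Plain.test-weight d w + (c + 10)) + Plain.test-weight d w)

  for-cost≤ : ∀ d w c {K} → K ≤ N * N → Plain.for-cost d w c K ≤ loop-weight d w c * (N * N)
  for-cost≤ d w c {K} K≤ = begin
    2 + (K * (t + c′) + t)                   ≤⟨ ℕ.+-monoʳ-≤ 2 (ℕ.+-monoˡ-≤ t (ℕ.*-monoˡ-≤ (t + c′) K≤)) ⟩
    2 + (N * N * (t + c′) + t)               ≤⟨ ℕ.+-mono-≤ {2} {2 * (N * N)} (ℕ.*-monoʳ-≤ 2 1≤NN)
                                                  (ℕ.+-monoʳ-≤ (N * N * (t + c′)) (ℕ.≤-trans (ℕ.≤-reflexive (sym (ℕ.*-identityʳ t))) (ℕ.*-monoʳ-≤ t 1≤NN))) ⟩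
    2 * (N * N) + (N * N * (t + c′) + t * (N * N)) ≡⟨ arith (N * N) t c′ ⟩
    loop-weight d w c * (N * N)              ∎
    where
    open ℕ.≤-Reasoning
    t = Plain.test-weight d w
    c′ = c + 10
    arith : ∀ K t c → 2 * K + (K * (t + c) + t * K) ≡ (2 + ((t + c) + t)) * K
    arith = ℕ-Solver.solve-∀

  run-fill : ∀ {A ι c e₁ e₂ E K d w dc wc dι wι d₁ w₁ d₂ w₂ σ₀} (ix val : ℕ → ℤ) →
    A ≢ 10 → K ≤ N * N → (∀ j k → ix j ≡ ix k → j ≡ k) →
    (∀ {σ} → (∀ y j → y ≢ A → y ≢ 10 → σ y j ≡ σ₀ y j) → Eval σ E (+ K) d w) →
    (∀ k {σ} → k < K → σ 10 0ℤ ≡ + k → (∀ y j → y ≢ A → y ≢ 10 → σ y j ≡ σ₀ y j) → σ A (ix k) ≡ σ₀ A (ix k) →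
      ∃ λ v → Eval σ c v dc wc × Eval σ ι (ix k) dι wι ×
              (0ℤ ℤ.< v → Eval σ e₁ (val k) d₁ w₁) × (¬ 0ℤ ℤ.< v → Eval σ e₂ (val k) d₂ w₂)) →
    Fast.Runs (fill A ι c e₁ e₂ E) σ₀ (loop-weight d w (wc + ((wι + w₁) + (wι + w₂)))) (Plain.Filled A K ix val σ₀)
  run-fill {d = d} {w} {wc = wc} {wι = wι} {w₁ = w₁} {w₂ = w₂} ix val A≢10 K≤ inj bound entry =
    speed (loop-weight d w (wc + ((wι + w₁) + (wι + w₂)))) (for-cost≤ d w (wc + ((wι + w₁) + (wι + w₂))) K≤)
      (Plain.run-fill {wc = wc} {wι = wι} {w₁ = w₁} {w₂ = w₂} ix val A≢10 (ℕ.≤-<-trans K≤ NN<2^b) inj bound entry)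

  bits<2^b : ∀ x → ∣ + bit x ∣ < 2 ^ b
  bits<2^b x = ℕ.≤-<-trans (bit≤1 x) (ℕ.≤-<-trans 1≤NN NN<2^b)

  k<2^b : ∀ {k} → k < N * N → ∣ + k ∣ < 2 ^ b
  k<2^b k< = ℕ.<-trans k< NN<2^b

  N<2^b : ∣ + N ∣ < 2 ^ b
  N<2^b = ℕ.≤-<-trans (ℕ.≤-trans (ℕ.≤-reflexive (sym (ℕ.*-identityʳ N))) (ℕ.*-monoʳ-≤ N (ℕ.>-nonZero⁻¹ N))) NN<2^b

  eval-entries : ∀ {σ} → σ 15 0ℤ ≡ + N → Eval σ entries (+ (N * N)) 2 9
  eval-entries {σ} eq = subst (λ v → Eval σ entries v 2 9) (sym (ℤ.pos-* N N))
    (eval-⊗ (eval-read (eval-lit 0ℤ) eq N<2^b) (eval-read (eval-lit 0ℤ) eq N<2^b))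

  eval-index : ∀ {σ k} → k < N * N → σ 10 0ℤ ≡ + k → Eval σ (scalar 10) (+ k) 1 3
  eval-index k< ctr = eval-read (eval-lit 0ℤ) ctr (k<2^b k<)

  -- A call with stride 2 ^ c writes to odd multiples of 2 ^ c, so the multiples of 2 ^ suc c remain
  -- zero. They contain all cells of later calls; this is what `fresh` carries along.
  record State (μ : Fin 6 → BMat N) (c : ℕ) (σ : Store) : Set where
    field
      dimension : σ 15 0ℤ ≡ + N
      stride    : σ 13 0ℤ ≡ + (2 ^ c)
      fresh     : ∀ x i → σ (30 + x) (+ (2 ^ c) ℤ.* i) ≡ 0ℤ
      matrices  : ∀ m k → k < N * N → σ (matrix m) (+ k) ≡ rowMajor (ints (μ m)) (+ k)

  updated : Bool → BMat N → BMat N → BMat N → BMat N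
  updated true  A B D = D ⊍ A ⊙ B
  updated false A B D = A ⊙ B

  updated-true : ∀ acc A B D {i j} → T ((A ⊙ B) i j) → updated acc A B D i j ≡ true
  updated-true true  A B D {i} {j} t = Equivalence.to T-≡ (⊍-introʳ {A = D} {A ⊙ B} {i} {j} t)
  updated-true false A B D         t = Equivalence.to T-≡ t

  updated-false : ∀ acc A B D {i j} → ¬ T ((A ⊙ B) i j) → + bit acc ℤ.* + bit (D i j) ≡ + bit (updated acc A B D i j)
  updated-false true A B D {i} {j} ¬t with D i j | (A ⊙ B) i j
  ... | true  | _     = refl
  ... | false | false = refl
  ... | false | true  = ⊥-elim (¬t tt)
  updated-false false A B D {i} {j} ¬t with (A ⊙ B) i j
  ... | false = refl
  ... | true  = ⊥-elim (¬t tt)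

  module _ {μ : Fin 6 → BMat N} {c : ℕ} {σ₀ : Store} (S : State μ c σ₀) (c<b : c < b) where
    open State S
    instance
      nonzero-stride : ℤ.NonZero (+ (2 ^ c))
      nonzero-stride = ℕ.m^n≢0 2 c
    open Relocation (+ (2 ^ c))

    stride<2^b : ∣ + (2 ^ c) ∣ < 2 ^ b
    stride<2^b = ℕ.^-monoʳ-< 2 (s≤s (s≤s z≤n)) c<b

    eval-address : ∀ {σ e i d w} → σ 13 0ℤ ≡ + (2 ^ c) → Eval σ e i d w →
      Eval σ (address e) (location i) (1 + suc (2 + d + 1))
        (suc (1 + suc (2 + d + 1)) + (3 + (suc (suc (2 + d + 1)) + ((suc (2 + d) + (3 + w)) + 2))))
    eval-address st ev = eval-⊗ (eval-read (eval-lit 0ℤ) st stride<2^b) (eval-⊕ (eval-⊗ (eval-lit (+ 2)) ev) (eval-lit 1ℤ))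

    -- 108 is `loop-weight 2 9 62`, where 62 is the weight of one iteration. The other numerals for
    -- loops arise in the same way.
    run-copy : ∀ {σ} x y (A : BMat N) → y ≢ 10 → y ≢ 13 → y ≢ 15 → x ≢ 10 → x ≢ y →
      σ 15 0ℤ ≡ + N → σ 13 0ℤ ≡ + (2 ^ c) → (∀ k → k < N * N → σ x (+ k) ≡ rowMajor (ints A) (+ k)) →
      Fast.Runs (copy x y) σ 108 (Plain.Filled y (N * N) (λ k → location (+ k)) (λ k → rowMajor (ints A) (+ k)) σ)
    run-copy {σ} x y A y≢10 y≢13 y≢15 x≢10 x≢y dim st src = run-fill {d₁ = 0} {w₁ = 0} {d₂ = 1} {w₂ = 5}
      (λ k → location (+ k)) (λ k → rowMajor (ints A) (+ k)) y≢10 ℕ.≤-refl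
      (λ j k eq → ℤ.+-injective (location-injective eq))
      (λ fr → eval-entries (trans (fr 15 0ℤ (y≢15 ∘ sym) λ ()) dim))
      (λ k k< ctr fr _ → 0ℤ , eval-lit 0ℤ ,
        eval-address (trans (fr 13 0ℤ (y≢13 ∘ sym) λ ()) st) (eval-index k< ctr) ,
        (λ lt → contradiction lt (ℤ.<-irrefl refl)) ,
        λ _ → eval-read (eval-index k< ctr) (trans (fr x (+ k) x≢y x≢10) (src k k<)) (entry-small k<))
      where
      entry-small : ∀ {k} → k < N * N → ∣ rowMajor (ints A) (+ k) ∣ < 2 ^ b
      entry-small {k} k< with row-column {N} k<
      ... | i , j , refl rewrite rowMajor-combine (ints A) i j = bits<2^b (A i j)

    -- The slowdown 23 + 2 size T is at most 25 suc b, since the stride T is below 2 ^ b; the factor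
    -- suc b is the one built into `Unit`.
    run-relocated : ∀ {σ} (A B : BMat N) → Simulates (input (ints A) (ints B)) σ →
      Fast.Runs (relocate p) σ 25 λ τ → ∃ λ σₚ → Simulates σₚ τ × Frame σ τ × IsProduct (ints A) (ints B) (output σₚ)
    run-relocated A B sim with multiplies-bits A B
    ... | σₚ , t , e , prod , fine with simulate e sim
    ...   | simulation e′ sim′ frame t≤ =
      Fast.runs e′ (t ⊔ proj₁ sample , refl , ℕ.≤-trans (proj₁ (proj₂ sample)) (ℕ.m≤n⊔m t _) ,
                    Fine-⊔ fine (proj₂ (proj₂ sample)))
        time-bound (σₚ , sim′ , frame , prod)
      where
      open ℕ.≤-Reasoning
      size≤ : size (+ (2 ^ c)) ≤ suc b
      size≤ = size-bound {+ (2 ^ c)} {b} stride<2^b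
      arith : ∀ s → 23 * suc s + 2 * suc s ≡ 25 * suc s
      arith = ℕ-Solver.solve-∀
      overhead≤ : suc overhead ≤ 25 * suc b
      overhead≤ = begin
        suc overhead               ≡⟨ cong suc overhead≡ ⟩
        23 + 2 * size (+ (2 ^ c))  ≤⟨ ℕ.+-mono-≤ (ℕ.m≤m*n 23 (suc b)) (ℕ.*-monoʳ-≤ 2 size≤) ⟩
        23 * suc b + 2 * suc b     ≡⟨ arith b ⟩
        25 * suc b                 ∎
      time-bound = begin
        _                                     ≤⟨ t≤ ⟩
        suc overhead * t                      ≤⟨ ℕ.*-mono-≤ overhead≤ (ℕ.m≤m⊔n t (proj₁ sample)) ⟩
        25 * suc b * (t ⊔ proj₁ sample)       ≡⟨ ℕ.*-assoc 25 (suc b) _ ⟩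
        25 * (suc b * (t ⊔ proj₁ sample))     ∎

    product-entry-< : ∀ {A B : BMat N} {C : Matrix N} → IsProduct (ints A) (ints B) C → ∀ i j →
      ∣ C i j ∣ < 2 ^ b × (0ℤ ℤ.< C i j → T ((A ⊙ B) i j)) × (¬ 0ℤ ℤ.< C i j → ¬ T ((A ⊙ B) i j))
    product-entry-< {A} {B} {C} prod i j rewrite product-entry A B {C} prod i j =
      ℕ.≤-<-trans (count≤ (λ k → A i k ∧ B k j)) N<2^b ,
      (λ { (ℤ.+<+ lt) → let k , t = count-positive (λ k → A i k ∧ B k j) lt in
             fromWitness {a? = Fin.any? (λ k → T? (A i k ∧ B k j))} (k , t) }) ,
      λ ¬lt t → let k , h = toWitness {a? = Fin.any? (λ k → T? (A i k ∧ B k j))} t in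
        ¬lt (ℤ.+<+ (count-at (λ k → A i k ∧ B k j) k h))

    module _ (acc : Bool) (x y d : Fin 6) where

      private
        A B D : BMat N
        A = μ x
        B = μ y
        D = μ d
        new : BMat N
        new = updated acc A B D

      run-collect : ∀ {σ σₚ} → σ 15 0ℤ ≡ + N → Simulates σₚ σ → IsProduct (ints A) (ints B) (output σₚ) →
        (∀ k → k < N * N → σ (matrix d) (+ k) ≡ rowMajor (ints D) (+ k)) →
        Fast.Runs (collect d acc) σ 94 (Plain.Filled (matrix d) (N * N) +_ (λ k → rowMajor (ints new) (+ k)) σ)
      run-collect {σ} {σₚ} dim sim prod old = Fast.weaken (weight acc)
        (run-fill {w₁ = 2} {w₂ = collect-weight acc} +_ (λ k → rowMajor (ints new) (+ k)) (λ ()) ℕ.≤-refl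
          (λ j k → ℤ.+-injective) (λ fr → eval-entries (trans (fr 15 0ℤ (λ ()) λ ()) dim)) entry)
        where
        collect-weight : Bool → ℕ
        collect-weight a = suc (bit a + 1) + (suc (bit a) + 5)
        weight : ∀ a → loop-weight 2 9 (30 + ((3 + 2) + (3 + collect-weight a))) ≤ 94
        weight true  = ℕ.≤-refl
        weight false = ℕ.≤ᵇ⇒≤ 92 94 tt
        entry : ∀ k {τ} → k < N * N → τ 10 0ℤ ≡ + k → (∀ y j → y ≢ matrix d → y ≢ 10 → τ y j ≡ σ y j) →
          τ (matrix d) (+ k) ≡ σ (matrix d) (+ k) →
          ∃ λ v → Eval τ (33 [ address (scalar 10) ]) v 1 30 × Eval τ (scalar 10) (+ k) 1 3 ×
            (0ℤ ℤ.< v → Eval τ (lit 1ℤ) (rowMajor (ints new) (+ k)) 1 2) ×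
            (¬ 0ℤ ℤ.< v → Eval τ (lit (+ bit acc) ⊗ matrix d [ scalar 10 ]) (rowMajor (ints new) (+ k)) (bit acc + 1) (collect-weight acc))
        entry k {τ} k< ctr fr same with row-column {N} k<
        ... | i , j , refl rewrite rowMajor-combine (ints new) i j
          with product-entry-< {A} {B} {output σₚ} prod i j
        ...   | small , pos , nonpos = output σₚ i j ,
          eval-read (eval-address (trans (fr 13 0ℤ (λ ()) λ ()) (Simulates.base sim)) (eval-index k< ctr))
            (trans (fr 33 _ (p≢matrix d 3 ∘ sym) (λ ())) (Simulates.cells sim 3 (+ toℕ (combine i j)))) small ,
          eval-index k< ctr ,
          (λ lt → subst (λ v → Eval τ (lit 1ℤ) v 1 2) (cong (+_ ∘ bit) (sym (updated-true acc A B D (pos lt)))) (eval-lit 1ℤ)) ,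
          λ ¬lt → subst (λ v → Eval τ (lit (+ bit acc) ⊗ matrix d [ scalar 10 ]) v (bit acc + 1) (collect-weight acc)) (updated-false acc A B D (nonpos ¬lt))
            (eval-⊗ (eval-lit (+ bit acc)) (eval-read (eval-index k< ctr)
              (trans same (trans (old _ k<) (rowMajor-combine (ints D) i j))) (bits<2^b (D i j))))

      loaded : ∀ {σ₂ σ₃} → let σ₁ = σ₀ [ 30 , location 0ℤ ↦ + N ] in
        Plain.Filled 31 (N * N) (λ k → location (+ k)) (λ k → rowMajor (ints A) (+ k)) σ₁ σ₂ →
        Plain.Filled 32 (N * N) (λ k → location (+ k)) (λ k → rowMajor (ints B) (+ k)) σ₂ σ₃ →
        Simulates (input (ints A) (ints B)) σ₃
      loaded {σ₂} {σ₃} (Plain.filled fr₂ wr₂ un₂) (Plain.filled fr₃ wr₃ un₃) =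
        simulates (trans (fr₃ 13 0ℤ (λ ()) λ ()) (trans (fr₂ 13 0ℤ (λ ()) λ ()) stride)) go
        where
        σ₁ = σ₀ [ 30 , location 0ℤ ↦ + N ]
        back : ∀ x i → x ≢ 1 → x ≢ 2 → σ₃ (30 + x) (location i) ≡ σ₁ (30 + x) (location i)
        back x i x≢1 x≢2 = trans (fr₃ (30 + x) _ (x≢2 ∘ ℕ.+-cancelˡ-≡ 30 x 2) (λ ()))
                                 (fr₂ (30 + x) _ (x≢1 ∘ ℕ.+-cancelˡ-≡ 30 x 1) (λ ()))
        first : ∀ i → i ≢ 0ℤ → σ₃ 30 (location i) ≡ 0ℤ
        first i i≢0 = trans (back 0 i (λ ()) (λ ())) (trans
          (update-index σ₀ 30 (+ N) (λ eq → i≢0 (sym (location-injective eq)))) (fresh 0 _))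
        apart : ∀ i → (∀ k → k < N * N → i ≢ + k) → ∀ k → k < N * N → location i ≢ location (+ k)
        apart i h k k< eq = h k k< (location-injective eq)
        beyond : ∀ {k} → ¬ k < N * N → ∀ i → i < N * N → + k ≢ + i
        beyond k≮ i i< refl = k≮ i<
        go : ∀ x i → σ₃ (30 + x) (location i) ≡ input (ints A) (ints B) x i
        go 0 (+ zero)  = trans (back 0 0ℤ (λ ()) (λ ())) (update-same σ₀ 30 (location 0ℤ) (+ N))
        go 0 (+ suc k) = first (+ suc k) λ ()
        go 0 -[1+ k ]  = first -[1+ k ] λ ()
        go 1 (+ k) with k ℕ.<? N * N
        ... | yes k< = trans (fr₃ 31 _ (λ ()) (λ ())) (trans (wr₂ k k<) (rowMajor-< (ints A) k<))
        ... | no k≮  = trans (fr₃ 31 _ (λ ()) (λ ())) (trans (un₂ _ (apart (+ k) (beyond k≮))) (fresh 1 _))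
        go 1 -[1+ k ] = trans (fr₃ 31 _ (λ ()) (λ ())) (trans (un₂ _ (apart -[1+ k ] λ _ _ ())) (fresh 1 _))
        go 2 (+ k) with k ℕ.<? N * N
        ... | yes k< = trans (wr₃ k k<) (rowMajor-< (ints B) k<)
        ... | no k≮  = trans (un₃ _ (apart (+ k) (beyond k≮))) (trans (fr₂ 32 _ (λ ()) (λ ())) (fresh 2 _))
        go 2 -[1+ k ] = trans (un₃ _ (apart -[1+ k ] λ _ _ ())) (trans (fr₂ 32 _ (λ ()) (λ ())) (fresh 2 _))
        go (suc (suc (suc x))) i = trans (back (3 + x) i (λ ()) (λ ())) (fresh (3 + x) _)

      after-multiply : ∀ {σ₂ σ₃ σ₄ σ₅} → let σ₁ = σ₀ [ 30 , location 0ℤ ↦ + N ] in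
        Plain.Filled 31 (N * N) (λ k → location (+ k)) (λ k → rowMajor (ints A) (+ k)) σ₁ σ₂ →
        Plain.Filled 32 (N * N) (λ k → location (+ k)) (λ k → rowMajor (ints B) (+ k)) σ₂ σ₃ →
        Frame σ₃ σ₄ → Plain.Filled (matrix d) (N * N) +_ (λ k → rowMajor (ints new) (+ k)) σ₄ σ₅ →
        let σ₆ = σ₅ [ 13 , 0ℤ ↦ + (2 ^ c) ℤ.+ + (2 ^ c) ] in
        State (μ [ d ≔ new ]) (suc c) σ₆ × Keeps σ₀ σ₆
      after-multiply {σ₂} {σ₃} {σ₄} {σ₅} (Plain.filled fr₂ _ un₂) (Plain.filled fr₃ _ un₃) fr₄ (Plain.filled fr₅ wr₅ _) =
        record { dimension = trans (keep 15 0ℤ) dimension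
               ; stride    = trans (update-same σ₅ 13 0ℤ _) (cong (λ a → + (2 ^ c + a)) (sym (ℕ.+-identityʳ (2 ^ c))))
               ; fresh     = fresh′
               ; matrices  = matrices′ } , keep
        where
        σ₁ = σ₀ [ 30 , location 0ℤ ↦ + N ]
        σ₆ = σ₅ [ 13 , 0ℤ ↦ + (2 ^ c) ℤ.+ + (2 ^ c) ]

        unloaded : ∀ y j → y ≢ 10 → (∀ x i → y ≡ 30 + x → j ≢ location i) → σ₄ y j ≡ σ₀ y j
        unloaded y j y≢10 out = trans (fr₄ y j out) (trans (at₃ (y ℕ.≟ 32)) (trans (at₂ (y ℕ.≟ 31)) (at₁ (30 ℕ.≟ y))))
          where
          at₃ : _ → σ₃ y j ≡ σ₂ y j
          at₃ (yes refl) = un₃ j (λ k _ → out 2 (+ k) refl)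
          at₃ (no y≢)    = fr₃ y j y≢ y≢10
          at₂ : _ → σ₂ y j ≡ σ₁ y j
          at₂ (yes refl) = un₂ j (λ k _ → out 1 (+ k) refl)
          at₂ (no y≢)    = fr₂ y j y≢ y≢10
          at₁ : _ → σ₁ y j ≡ σ₀ y j
          at₁ (yes refl) = update-index σ₀ 30 (+ N) (λ eq → out 0 0ℤ refl (sym eq))
          at₁ (no 30≢)   = update-array σ₀ (location 0ℤ) (+ N) j 30≢

        keep : Keeps σ₀ σ₆
        keep y {t} j = trans (update-array σ₅ 0ℤ _ j (kept⇒≢13 t ∘ sym))
          (trans (fr₅ y j (λ { refl → small (kept⇒< t) (ℕ.m≤m+n 20 (toℕ d)) }) (kept⇒≢10 t))
            (unloaded y j (kept⇒≢10 t) (λ { x i refl _ → small (kept⇒< t) (ℕ.≤-trans (ℕ.≤ᵇ⇒≤ 20 30 tt) (ℕ.m≤m+n 30 x)) })))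
          where
          small : ∀ {y} → y < 20 → 20 ≤ y → _
          small lt ge = ℕ.<⇒≱ lt ge

        parity : ∀ i j → + (2 ^ suc c) ℤ.* i ≢ location j
        parity i j eq = odd i j (ℤ.*-cancelˡ-≡ (+ (2 ^ c)) (+ 2 ℤ.* i) (+ 2 ℤ.* j ℤ.+ 1ℤ) (trans (double-stride i) eq))
          where
          odd : ∀ i j → + 2 ℤ.* i ≢ + 2 ℤ.* j ℤ.+ 1ℤ
          odd i j h = 2m≢1 (i ℤ.- j) (trans (ℤ.*-distribˡ-+ (+ 2) i (ℤ.- j))
            (trans (cong₂ ℤ._+_ h (sym (ℤ.neg-distribʳ-* (+ 2) j))) (trans (cong (ℤ._- (+ 2 ℤ.* j)) (ℤ.+-comm (+ 2 ℤ.* j) 1ℤ))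
              (trans (ℤ.+-assoc 1ℤ (+ 2 ℤ.* j) (ℤ.- (+ 2 ℤ.* j))) (cong (λ z → 1ℤ ℤ.+ z) (ℤ.+-inverseʳ (+ 2 ℤ.* j)))))))
            where
            2m≢1 : ∀ m → + 2 ℤ.* m ≢ 1ℤ
            2m≢1 m e = ℕ.even≢odd ∣ m ∣ 0 (trans (sym (ℤ.∣i*j∣≡∣i∣*∣j∣ (+ 2) m)) (cong ∣_∣ e))
          double-stride : ∀ i → + (2 ^ c) ℤ.* (+ 2 ℤ.* i) ≡ + (2 ^ suc c) ℤ.* i
          double-stride i = trans (sym (ℤ.*-assoc (+ (2 ^ c)) (+ 2) i))
            (cong (ℤ._* i) (trans (ℤ.*-comm (+ (2 ^ c)) (+ 2)) (sym (ℤ.pos-* 2 (2 ^ c)))))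

        fresh′ : ∀ x i → σ₆ (30 + x) (+ (2 ^ suc c) ℤ.* i) ≡ 0ℤ
        fresh′ x i = trans (update-array σ₅ {13} {30 + x} 0ℤ (+ (2 ^ c) ℤ.+ + (2 ^ c)) (+ (2 ^ suc c) ℤ.* i) λ ()) (trans (fr₅ (30 + x) _ (p≢matrix d x ∘ sym) (λ ()))
          (trans (unloaded (30 + x) _ (λ ()) (λ _ j _ → parity i j))
            (trans (cong (σ₀ (30 + x)) (even i)) (fresh x (+ 2 ℤ.* i)))))
          where
          even : ∀ i → + (2 ^ suc c) ℤ.* i ≡ + (2 ^ c) ℤ.* (+ 2 ℤ.* i)
          even i = trans (cong (ℤ._* i) (trans (ℤ.pos-* 2 (2 ^ c)) (ℤ.*-comm (+ 2) (+ (2 ^ c))))) (ℤ.*-assoc (+ (2 ^ c)) (+ 2) i)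

        matrices′ : ∀ m k → k < N * N → σ₆ (matrix m) (+ k) ≡ rowMajor (ints ((μ [ d ≔ new ]) m)) (+ k)
        matrices′ m k k< = trans (update-array σ₅ {13} {matrix m} 0ℤ (+ (2 ^ c) ℤ.+ + (2 ^ c)) (+ k) λ ()) go
          where
          go : σ₅ (matrix m) (+ k) ≡ rowMajor (ints ((μ [ d ≔ new ]) m)) (+ k)
          go with m Fin.≟ d
          ... | yes refl = wr₅ k k<
          ... | no m≢d   = trans (fr₅ (matrix m) (+ k) (m≢d ∘ Fin.toℕ-injective ∘ ℕ.+-cancelˡ-≡ 20 _ _) (λ ()))
            (trans (unloaded (matrix m) (+ k) (λ ()) (λ x _ eq → contradiction eq (p≢matrix m x))) (matrices m k k<))

      -- 372 = 26 + 108 + 108 + 25 + 94 + 11, the costs of the six statements.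
      run-multiply : Fast.Runs (multiply p acc x y d) σ₀ 372 λ σ → State (μ [ d ≔ new ]) (suc c) σ × Keeps σ₀ σ
      run-multiply =
        Fast.run-assign {P = λ σ → σ ≡ σ₀ [ 30 , location 0ℤ ↦ + N ]} (eval-address stride (eval-lit 0ℤ))
          (eval-read (eval-lit 0ℤ) dimension N<2^b) refl Fast.then λ { refl →
        run-copy (matrix x) 31 A (λ ()) (λ ()) (λ ()) (λ ()) (p≢matrix x 1) dimension stride (σ₁-matrices x) Fast.then λ f₂@(Plain.filled fr₂ _ _) →
        run-copy (matrix y) 32 B (λ ()) (λ ()) (λ ()) (λ ()) (p≢matrix y 2) (trans (fr₂ 15 0ℤ (λ ()) (λ ())) dimension)
          (trans (fr₂ 13 0ℤ (λ ()) (λ ())) stride) (λ k k< → trans (fr₂ (matrix y) (+ k) (p≢matrix y 1) (λ ())) (σ₁-matrices y k k<))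
          Fast.then λ f₃@(Plain.filled fr₃ _ _) →
        run-relocated A B (loaded f₂ f₃) Fast.then λ { {σ₄} (σₚ , sim , fr₄ , prod) →
        let back : ∀ y j → y ≢ 10 → y ≢ 31 → y ≢ 32 → (∀ x → y ≢ 30 + x) → σ₄ y j ≡ (σ₀ [ 30 , location 0ℤ ↦ + N ]) y j
            back y j y≢10 y≢31 y≢32 out = trans (fr₄ y j (λ x _ eq → contradiction eq (out x)))
              (trans (fr₃ y j y≢32 y≢10) (fr₂ y j y≢31 y≢10)) in
        run-collect (trans (back 15 0ℤ (λ ()) (λ ()) (λ ()) (λ _ ())) dimension) sim prod
          (λ k k< → trans (back (matrix d) (+ k) (λ ()) (p≢matrix d 1) (p≢matrix d 2) (p≢matrix d)) (σ₁-matrices d k k<))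
          Fast.then λ f₅@(Plain.filled fr₅ _ _) →
        let base = trans (fr₅ 13 0ℤ (λ ()) (λ ())) (Simulates.base sim) in
        Fast.run-assign {P = λ σ → State (μ [ d ≔ new ]) (suc c) σ × Keeps σ₀ σ} (eval-lit 0ℤ)
          (eval-⊕ (eval-read (eval-lit 0ℤ) base stride<2^b) (eval-read (eval-lit 0ℤ) base stride<2^b))
          (after-multiply f₂ f₃ fr₄ f₅) } }
        where
        σ₁-matrices : ∀ m k → k < N * N → (σ₀ [ 30 , location 0ℤ ↦ + N ]) (matrix m) (+ k) ≡ rowMajor (ints (μ m)) (+ k)
        σ₁-matrices m k k< = trans (update-array σ₀ {30} {matrix m} (location 0ℤ) (+ N) (+ k) (p≢matrix m 0 ∘ sym)) (matrices m k k<)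

-- Closures and rounds as programs

module _ {n : ℕ} (μ : Fin 6 → BMat n) (d : Fin 6) where

  replace-hit : ∀ A → (μ [ d ≔ A ]) d ≡ A
  replace-hit A with d Fin.≟ d
  ... | yes _  = refl
  ... | no d≢d = contradiction refl d≢d

  replace-twice : ∀ A B m → ((μ [ d ≔ A ]) [ d ≔ B ]) m ≡ (μ [ d ≔ B ]) m
  replace-twice A B m with m Fin.≟ d
  ... | yes _ = refl
  ... | no _  = refl

  replace-self : ∀ m → (μ [ d ≔ μ d ]) m ≡ μ m
  replace-self m with m Fin.≟ d
  ... | yes refl = refl
  ... | no _     = refl

closure : Program → Fin 6 → Program
closure p d = for 11 below scalar 16 loop multiply p true d d d

-- The matrices are updated in place, so the order matters: `up` and `down` are overwritten last,
-- when the products with their old values have entered both flat matrices.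
round-program : Program → Program
round-program p =
  closure p 2F ⨾ multiply p false 0F 2F 4F ⨾ multiply p false 1F 2F 5F ⨾
  multiply p true 4F 1F 3F ⨾ multiply p true 4F 1F 2F ⨾ multiply p true 5F 0F 2F ⨾
  multiply p false 4F 0F 0F ⨾ multiply p false 5F 1F 1F

saturate : Program → Program
saturate p = (for 12 below scalar 16 loop round-program p) ⨾ closure p 3F

module Saturation
  (p : Program) (N : ℕ) .{{N≢0 : NonZero N}} (b : ℕ) (NN<2^b : N * N < 2 ^ b)
  (Fine : ℕ → Set) (Fine-⊔ : ∀ {s t} → Fine s → Fine t → Fine (s ⊔ t))
  (multiplies : ∀ (A B : Matrix N) → (∀ i j → ∣ A i j ∣ ≤ 1) → (∀ i j → ∣ B i j ∣ ≤ 1) →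
    ∃[ σ ] ∃[ t ] ⟨ p , input A B ⟩⇓⟨ σ , t ⟩ × IsProduct A B (output σ) × Fine t)
  (L : ℕ) (enough : L + L * (7 + L) ≤ b)
  where

  open Multiplication p N b NN<2^b Fine Fine-⊔ multiplies public

  State-cong : ∀ {μ ν c σ} → (∀ m → μ m ≡ ν m) → State μ c σ → State ν c σ
  State-cong {σ = σ} eq S = record { State S hiding (matrices)
    ; matrices = λ m k k< → subst (λ A → σ (matrix m) (+ k) ≡ rowMajor (ints A) (+ k)) (eq m) (State.matrices S m k k<) }

  State-counter : ∀ {μ c σ} i v → i < 13 → State μ c σ → State μ c (σ [ i , 0ℤ ↦ v ])
  State-counter {σ = σ} i v i< S = record
    { dimension = trans (update-array σ 0ℤ v 0ℤ (λ { refl → ℕ.<⇒≱ i< (ℕ.≤ᵇ⇒≤ 13 15 _) })) dimension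
    ; stride    = trans (update-array σ 0ℤ v 0ℤ (λ { refl → ℕ.<-irrefl refl i< })) stride
    ; fresh     = λ x j → trans (update-array σ 0ℤ v _ (λ { refl → ℕ.<⇒≱ i< (ℕ.m≤m+n 13 (17 + x)) })) (fresh x j)
    ; matrices  = λ m k k< → trans (update-array σ 0ℤ v _ (λ { refl → ℕ.<⇒≱ i< (ℕ.m≤m+n 13 (7 + toℕ m)) })) (matrices m k k<) }
    where open State S

  L≤b : L ≤ b
  L≤b = ℕ.≤-trans (ℕ.m≤m+n L _) enough

  L<2^b : L < 2 ^ b
  L<2^b = ℕ.≤-<-trans L≤b (n<2^n b)

  eval-L : ∀ {σ} → σ 16 0ℤ ≡ + L → Eval σ (scalar 16) (+ L) 1 3
  eval-L eq = eval-read (eval-lit 0ℤ) eq L<2^b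

  closure-cost : ℕ
  closure-cost = Fast.for-cost 1 3 372 L

  run-closure : ∀ {μ c σ₀} d → State μ c σ₀ → L + c ≤ b → σ₀ 16 0ℤ ≡ + L →
    Fast.Runs (closure p d) σ₀ closure-cost λ σ → State (μ [ d ≔ squarings L (μ d) ]) (L + c) σ ×
      (∀ y {_ : T (kept y)} → y ≢ 11 → ∀ j → σ y j ≡ σ₀ y j)
  run-closure {μ} {c} {σ₀} d S room len = Fast.run-for 11 I L<2^b
    (λ _ h → eval-L (trans (proj₂ h 16 (λ ()) 0ℤ) len))
    (λ { {σ = σ} {v} (S , keep) → State-counter 11 v (ℕ.≤ᵇ⇒≤ 12 13 _) S ,
         λ y {t} y≢11 j → trans (update-array σ 0ℤ v j (y≢11 ∘ sym)) (keep y {t} y≢11 j) })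
    body
    (State-cong (sym ∘ replace-self μ d) S , λ _ _ _ → refl)
    where
    I : ℕ → Store → Set
    I k σ = State (μ [ d ≔ squarings k (μ d) ]) (k + c) σ × (∀ y {_ : T (kept y)} → y ≢ 11 → ∀ j → σ y j ≡ σ₀ y j)
    body : ∀ k {σ} → k < L → σ 11 0ℤ ≡ + k → I k σ →
      Fast.Runs (multiply p true d d d) σ 372 (λ σ′ → σ′ 11 0ℤ ≡ + k × I (suc k) σ′)
    body k {σ} k< ctr (S , keep) = Fast.map-post
      (λ { (S′ , keep′) → trans (keep′ 11 0ℤ) ctr ,
           State-cong (λ m → trans (replace-twice μ d _ _ m)
             (cong (λ A → (μ [ d ≔ A ⊍ A ⊙ A ]) m) (replace-hit μ d (squarings k (μ d))))) S′ ,
           λ y {t} y≢11 j → trans (keep′ y {t} j) (keep y {t} y≢11 j) })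
      (run-multiply S (ℕ.≤-trans (ℕ.+-monoˡ-≤ c k<) room) true d d d)

  systemOf : (Fin 6 → BMat N) → System N
  systemOf μ = system (μ 0F) (μ 1F) (μ 2F) (μ 3F)

  Keeps₁₁ Keeps₁₂ : Store → Store → Set
  Keeps₁₁ σ τ = ∀ y {_ : T (kept y)} → y ≢ 11 → ∀ j → τ y j ≡ σ y j
  Keeps₁₂ σ τ = ∀ y {_ : T (kept y)} → y ≢ 11 → y ≢ 12 → ∀ j → τ y j ≡ σ y j

  round-cost : ℕ
  round-cost = closure-cost + 7 * 372

  run-round : ∀ {μ c σ₀} → State μ c σ₀ → 7 + (L + c) ≤ b → σ₀ 16 0ℤ ≡ + L →
    Fast.Runs (round-program p) σ₀ round-cost λ σ →
      (∃ λ ν → systemOf ν ≡ round L (systemOf μ) × State ν (7 + (L + c)) σ) × Keeps₁₁ σ₀ σ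
  run-round {μ} {c} {σ₀} S room len =
    run-closure 2F S (below 7) len Fast.then λ { (S₁ , k₁) →
    run-multiply S₁ (below 6) false 0F 2F 4F Fast.then λ { (S₂ , k₂) →
    run-multiply S₂ (below 5) false 1F 2F 5F Fast.then λ { (S₃ , k₃) →
    run-multiply S₃ (below 4) true 4F 1F 3F Fast.then λ { (S₄ , k₄) →
    run-multiply S₄ (below 3) true 4F 1F 2F Fast.then λ { (S₅ , k₅) →
    run-multiply S₅ (below 2) true 5F 0F 2F Fast.then λ { (S₆ , k₆) →
    run-multiply S₆ (below 1) false 4F 0F 0F Fast.then λ { (S₇ , k₇) →
    -- The eight statements accumulate in exactly the bracketing of `round`, so the equation holds
    -- by computation.
    Fast.map-post (λ { (S₈ , k₈) → (_ , refl , S₈) , λ y {t} y≢11 j →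
      trans (k₈ y {t} j) (trans (k₇ y {t} j) (trans (k₆ y {t} j) (trans (k₅ y {t} j) (trans (k₄ y {t} j)
      (trans (k₃ y {t} j) (trans (k₂ y {t} j) (k₁ y {t} y≢11 j))))))) })
      (run-multiply S₇ (below 0) false 5F 1F 1F) } } } } } } }
    where
    below : ∀ i {k} → {{i + k ≡ 7 + (L + c)}} → k ≤ b
    below i {k} {{eq}} = ℕ.≤-trans (ℕ.m≤n+m k i) (ℕ.≤-trans (ℕ.≤-reflexive eq) room)
    instance
      refl′ : ∀ {k : ℕ} → k ≡ k
      refl′ = refl

  saturate-cost : ℕ
  saturate-cost = Fast.for-cost 1 3 round-cost L + closure-cost

  run-saturate : ∀ {μ σ₀} → State μ 0 σ₀ → σ₀ 16 0ℤ ≡ + L →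
    Fast.Runs (saturate p) σ₀ saturate-cost λ σ →
      (∀ k → k < N * N → σ (matrix 3F) (+ k) ≡ rowMajor (ints (squarings L (System.flat₀ (rounds L L (systemOf μ))))) (+ k)) ×
      σ 15 0ℤ ≡ + N × Keeps₁₂ σ₀ σ
  run-saturate {μ} {σ₀} S len =
    Fast.run-for 12 I L<2^b
      (λ _ h → eval-L (trans (proj₂ h 16 (λ ()) (λ ()) 0ℤ) len))
      (λ { {σ = σ} {v} ((ν , eq , S) , keep) → (ν , eq , State-counter 12 v ℕ.≤-refl S) ,
         λ y {t} y≢11 y≢12 j → trans (update-array σ 0ℤ v j (y≢12 ∘ sym)) (keep y {t} y≢11 y≢12 j) })
      body
      ((μ , refl , S) , λ _ _ _ _ → refl)
    Fast.then λ { ((ν , eq , S′) , keep) → Fast.map-post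
      (λ { {σ} (S″ , keep′) → (λ k k< → subst (λ s → σ (matrix 3F) (+ k) ≡ rowMajor (ints (squarings L (System.flat₀ s))) (+ k)) eq
             (State.matrices S″ 3F k k<)) , State.dimension S″ ,
           λ y {t} y≢11 y≢12 j → trans (keep′ y {t} y≢11 j) (keep y {t} y≢11 y≢12 j) })
      (run-closure 3F S′ enough (trans (keep 16 (λ ()) (λ ()) 0ℤ) len)) }
    where
    I : ℕ → Store → Set
    I k σ = (∃ λ ν → systemOf ν ≡ rounds L k (systemOf μ) × State ν (k * (7 + L)) σ) × Keeps₁₂ σ₀ σ
    body : ∀ k {σ} → k < L → σ 12 0ℤ ≡ + k → I k σ →
      Fast.Runs (round-program p) σ round-cost (λ σ′ → σ′ 12 0ℤ ≡ + k × I (suc k) σ′)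
    body k {σ} k< ctr ((ν , eq , S) , keep) = Fast.map-post
      (λ { ((ν′ , eq′ , S′) , keep′) → trans (keep′ 12 (λ ()) 0ℤ) ctr ,
           (ν′ , trans eq′ (cong (round L) eq) , S′) ,
           λ y {t} y≢11 y≢12 j → trans (keep′ y {t} y≢11 j) (keep y {t} y≢11 y≢12 j) })
      (run-round S (ℕ.≤-trans (ℕ.*-monoˡ-≤ (7 + L) k<) (ℕ.≤-trans (ℕ.m≤n+m _ L) enough)) (trans (keep 16 (λ ()) (λ ()) 0ℤ) len))

-- The program

positivePart : ℤ → ℕ
positivePart (+ a)    = a
positivePart -[1+ _ ] = 0

-- This is m ⊔ ∣ z ∣, as at most one of the positive parts is nonzero. The form with two maxima
-- follows the two `raise` statements, the machine having no absolute value.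
raised : ℕ → ℤ → ℕ
raised m z = (m ⊔ positivePart z) ⊔ positivePart (0ℤ ℤ.- z)

-- The start value 1 keeps the width W positive even if every weight is 0 or there is no edge.
maximum : (ℕ → ℤ) → ℕ → ℕ
maximum f zero    = 1
maximum f (suc k) = raised (maximum f k) (f k)

∣z∣≤raised : ∀ m z → ∣ z ∣ ≤ raised m z
∣z∣≤raised m (+ a)    = ℕ.≤-trans (ℕ.m≤n⊔m m a) (ℕ.m≤m⊔n _ _)
∣z∣≤raised m -[1+ a ] = ℕ.m≤n⊔m (m ⊔ 0) (suc a)

≤raised : ∀ m z → m ≤ raised m z
≤raised m z = ℕ.≤-trans (ℕ.m≤m⊔n m _) (ℕ.m≤m⊔n _ _)

raised≤ : ∀ {m z B} → m ≤ B → ∣ z ∣ ≤ B → raised m z ≤ B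
raised≤ {z = + zero}   p q = ℕ.⊔-lub (ℕ.⊔-lub p z≤n) z≤n
raised≤ {z = + suc a}  p q = ℕ.⊔-lub (ℕ.⊔-lub p q) z≤n
raised≤ {z = -[1+ a ]} p q = ℕ.⊔-lub (ℕ.⊔-lub p z≤n) q

maximum-mono : ∀ f {j k} → j ≤ k → maximum f j ≤ maximum f k
maximum-mono f {j} {k} j≤k = go (ℕ.≤⇒≤′ j≤k)
  where
  go : ∀ {k} → j ℕ.≤′ k → maximum f j ≤ maximum f k
  go ℕ.≤′-refl       = ℕ.≤-refl
  go (ℕ.≤′-step {k} j≤k) = ℕ.≤-trans (go j≤k) (≤raised (maximum f k) (f k))

∣f∣≤maximum : ∀ f {j k} → j < k → ∣ f j ∣ ≤ maximum f k
∣f∣≤maximum f {j} j<k = ℕ.≤-trans (∣z∣≤raised (maximum f j) (f j)) (maximum-mono f j<k)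

maximum≤ : ∀ f {B} → 1 ≤ B → ∀ k → (∀ j → j < k → ∣ f j ∣ ≤ B) → maximum f k ≤ B
maximum≤ f 1≤B zero    h = 1≤B
maximum≤ f 1≤B (suc k) h = raised≤ {z = f k} (maximum≤ f 1≤B k (λ j j< → h j (ℕ.m<n⇒m<1+n j<))) (h k ℕ.≤-refl)

maxWeight : ∀ {n} → Graph n → ℕ
maxWeight {n} G = maximum (λ k → rowMajor (weightMatrix G) (+ k)) (n * n)

quotient-< : ∀ {m q q′ r r′} → q < q′ → r < m → m * q + r < m * q′ + r′
quotient-< {m} {q} {q′} {r} {r′} lt r< = ℕ.<-≤-trans (ℕ.+-monoʳ-< (m * q) r<) (ℕ.≤-trans
  (ℕ.≤-reflexive (trans (ℕ.+-comm (m * q) m) (sym (ℕ.*-suc m q)))) (ℕ.≤-trans (ℕ.*-monoʳ-≤ m lt) (ℕ.m≤m+n _ r′)))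

division-unique : ∀ {m q r q′ r′} → r < m → r′ < m → m * q + r ≡ m * q′ + r′ → q ≡ q′ × r ≡ r′
division-unique {m} {q} {r} {q′} {r′} r< r′< eq with ℕ.<-cmp q q′
... | tri≈ _ refl _ = refl , ℕ.+-cancelˡ-≡ (m * q) r r′ eq
... | tri< q<q′ _ _  = ⊥-elim (ℕ.<-irrefl eq (quotient-< q<q′ r<))
... | tri> _ _ q′<q = ⊥-elim (ℕ.<-irrefl (sym eq) (quotient-< q′<q r′<))

raise : Expr → Program
raise e = if0< e ⊖ scalar 14 then 14 [ lit 0ℤ ]≔ e else 14 [ lit 0ℤ ]≔ scalar 14

find-max : Program
find-max = (14 [ lit 0ℤ ]≔ lit 1ℤ) ⨾
  (for 10 below scalar 0 ⊗ scalar 0 loop (raise (2 [ scalar 10 ]) ⨾ raise (lit 0ℤ ⊖ 2 [ scalar 10 ])))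

find-log : Program
find-log = while0< (entries ⊕ lit 1ℤ) ⊖ scalar 17 loop
  ((17 [ lit 0ℤ ]≔ scalar 17 ⊕ scalar 17) ⨾ (16 [ lit 0ℤ ]≔ scalar 16 ⊕ lit 1ℤ))

divide : ℕ → ℕ → Expr → Program
divide Q R m = for 10 below entries loop
  (if0< (m ⊖ lit 1ℤ) ⊖ R [ scalar 10 ]
   then ((R [ scalar 10 ⊕ lit 1ℤ ]≔ R [ scalar 10 ] ⊕ lit 1ℤ) ⨾ (Q [ scalar 10 ⊕ lit 1ℤ ]≔ Q [ scalar 10 ]))
   else ((R [ scalar 10 ⊕ lit 1ℤ ]≔ lit 0ℤ) ⨾ (Q [ scalar 10 ⊕ lit 1ℤ ]≔ Q [ scalar 10 ] ⊕ lit 1ℤ)))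

pair : ℕ → Expr → Expr → Expr
pair x u v = x [ scalar 0 ⊗ u ⊕ v ]

slack-weight : ℕ → ℕ → ℕ
slack-weight d w = suc (1 + suc (5 + d)) + (27 + (suc (suc (5 + d)) + (51 + w)))

slackᵉ : Expr → Expr
slackᵉ θ = pair 1 (6 [ s ]) (6 [ t ]) ⊗ (((7 [ s ] ⊕ pair 2 (6 [ s ]) (6 [ t ])) ⊖ 7 [ t ]) ⊕ θ)
  where
  s = 8 [ scalar 10 ]
  t = 9 [ scalar 10 ]

diagonalᵉ : Expr
diagonalᵉ = lit 1ℤ ⊖ (s ⊖ t) ⊗ (s ⊖ t)
  where
  s = 8 [ scalar 10 ]
  t = 9 [ scalar 10 ]

fill-edges : Fin 6 → Expr → Program
fill-edges m θ = fill (matrix m) (scalar 10) (slackᵉ θ) (lit 1ℤ) (lit 0ℤ) entries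

fill-identity : Fin 6 → Program
fill-identity m = fill (matrix m) (scalar 10) diagonalᵉ (lit 1ℤ) (matrix m [ scalar 10 ]) entries

-- The states `base u` and `base v` have the numbers W u and W v, so the answer stands at N (W u) +
-- W v of array 23, the closed `flat₀`.
write-output : Program
write-output = fill 3 (scalar 10) (lit 0ℤ) (lit 0ℤ)
  (23 [ scalar 15 ⊗ (scalar 14 ⊗ 4 [ scalar 10 ]) ⊕ scalar 14 ⊗ 5 [ scalar 10 ] ]) (scalar 0 ⊗ scalar 0)

solve : Program → Program
solve p =
  find-max ⨾ (15 [ lit 0ℤ ]≔ scalar 0 ⊗ scalar 14) ⨾ (13 [ lit 0ℤ ]≔ lit 1ℤ) ⨾ (17 [ lit 0ℤ ]≔ lit 1ℤ) ⨾ find-log ⨾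
  divide 4 5 (scalar 0) ⨾ divide 6 7 (scalar 14) ⨾ divide 8 9 (scalar 15) ⨾
  fill-edges 0F (lit 1ℤ ⊖ scalar 14) ⨾ fill-edges 1F (lit 1ℤ ⊕ scalar 14) ⨾
  fill-edges 2F (lit 1ℤ) ⨾ fill-edges 3F (lit 1ℤ) ⨾ fill-identity 2F ⨾ fill-identity 3F ⨾
  saturate p ⨾ write-output

-- Correctness and cost of the whole program

module Solution
  (p : Program) {n : ℕ} .{{n≢0 : NonZero n}} (G : Graph n) (W₋ : ℕ) (maxWeight≡ : maxWeight G ≡ suc W₋)
  (Fine : ℕ → Set) (Fine-⊔ : ∀ {s t} → Fine s → Fine t → Fine (s ⊔ t))
  (multiplies : ∀ (A B : Matrix (n * suc W₋)) → (∀ i j → ∣ A i j ∣ ≤ 1) → (∀ i j → ∣ B i j ∣ ≤ 1) →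
    ∃[ σ ] ∃[ t ] ⟨ p , input A B ⟩⇓⟨ σ , t ⟩ × IsProduct A B (output σ) × Fine t)
  where

  private
    A₀ B₀ : Matrix n
    A₀ = adjacency G
    B₀ = weightMatrix G
    σ₀ : Store
    σ₀ = input A₀ B₀
    f : ℕ → ℤ
    f k = rowMajor B₀ (+ k)

  W = suc W₋
  N = n * W

  instance
    N≢0 : NonZero N
    N≢0 = ℕ.m*n≢0 n W

  abstract
    L : ℕ
    L = ⌈log₂ suc (N * N) ⌉

    L≡ : L ≡ ⌈log₂ suc (N * N) ⌉
    L≡ = refl

    NN<2^L : N * N < 2 ^ L
    NN<2^L = n≤2^⌈log₂n⌉ (suc (N * N))

    2^k≤NN : ∀ {k} → k < L → 2 ^ k ≤ N * N
    2^k≤NN {k} k<L = ℕ.≮⇒≥ λ lt → ℕ.<⇒≱ k<L (ℕ.≤-trans (⌈log₂⌉-mono-≤ lt) (ℕ.≤-reflexive (⌈log₂2^n⌉≡n k)))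

  -- The rounds use L * (7 + L) products and the final closure L more. Each doubles the stride,
  -- which must stay below 2 ^ b at every call; as L is logarithmic in N, b is polylogarithmic.
  b : ℕ
  b = suc (L + L * (7 + L))

  enough : L + L * (7 + L) ≤ b
  enough = ℕ.n≤1+n (L + L * (7 + L))

  L<b : L < b
  L<b = s≤s (ℕ.m≤m+n L _)

  NN<2^b : N * N < 2 ^ b
  NN<2^b = ℕ.<-≤-trans NN<2^L (ℕ.^-monoʳ-≤ 2 {L} {b} (ℕ.<⇒≤ L<b))

  open Saturation p N b NN<2^b Fine Fine-⊔ multiplies L enough public

  n≤N : n ≤ N
  n≤N = ℕ.m≤m*n n W

  W≤N : W ≤ N
  W≤N = ℕ.m≤n*m W n

  nn≤NN : n * n ≤ N * N
  nn≤NN = ℕ.*-mono-≤ n≤N n≤N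

  n<2^b : n < 2 ^ b
  n<2^b = ℕ.≤-<-trans n≤N N<2^b

  W<2^b : W < 2 ^ b
  W<2^b = ℕ.≤-<-trans W≤N N<2^b

  weight≤W : ∀ {k} → k < n * n → ∣ f k ∣ ≤ W
  weight≤W k< = subst (∣ f _ ∣ ≤_) maxWeight≡ (∣f∣≤maximum f k<)

  run-raise : ∀ {σ e v m d w} → Eval σ e v d w → σ 14 0ℤ ≡ + m → m < 2 ^ b →
    Plain.Runs (raise e) σ ((suc (suc (d + 1)) + (w + 3)) + ((1 + w) + (1 + 3)))
      (λ σ′ → σ′ ≡ σ [ 14 , 0ℤ ↦ + (m ⊔ positivePart v) ])
  run-raise {σ} {e} {v} {m} {d} {w} ev cell m< = Plain.run-if (eval-⊖ ev read) above below
    where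
    P : Store → Set
    P σ′ = σ′ ≡ σ [ 14 , 0ℤ ↦ + (m ⊔ positivePart v) ]
    read : Eval σ (scalar 14) (+ m) 1 3
    read = eval-read (eval-lit 0ℤ) cell m<
    higher : ∀ v → 0ℤ ℤ.< v ℤ.- + m → v ≡ + (m ⊔ positivePart v)
    higher (+ a) lt = cong +_ (sym (ℕ.m≤n⇒m⊔n≡n (ℤ.drop‿+≤+ (ℤ.0≤i-j⇒j≤i (ℤ.<⇒≤ lt)))))
    higher -[1+ a ] lt = contradiction (ℤ.≤-trans (ℤ.+≤+ z≤n) (ℤ.0≤i-j⇒j≤i { -[1+ a ]} {+ m} (ℤ.<⇒≤ lt))) λ ()
    lower : ∀ v → ¬ 0ℤ ℤ.< v ℤ.- + m → m ≡ m ⊔ positivePart v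
    lower (+ a) ¬lt = sym (ℕ.m≥n⇒m⊔n≡m (ℤ.drop‿+≤+ (ℤ.i-j≤0⇒i≤j (ℤ.≮⇒≥ ¬lt))))
    lower -[1+ a ] _ = sym (ℕ.⊔-identityʳ m)
    above : 0ℤ ℤ.< v ℤ.- + m → Plain.Runs (14 [ lit 0ℤ ]≔ e) σ ((1 + w) + (1 + 3)) P
    above lt = Plain.weaken (ℕ.m≤m+n (1 + w) 4) (Plain.run-assign {P = P} (eval-lit 0ℤ) ev
      (cong (λ u → σ [ 14 , 0ℤ ↦ u ]) (higher v lt)))
    below : ¬ 0ℤ ℤ.< v ℤ.- + m → Plain.Runs (14 [ lit 0ℤ ]≔ scalar 14) σ ((1 + w) + (1 + 3)) P
    below ¬lt = Plain.weaken (ℕ.m≤n+m 4 (1 + w)) (Plain.run-assign {P = P} (eval-lit 0ℤ) read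
      (cong (λ u → σ [ 14 , 0ℤ ↦ + u ]) (lower v ¬lt)))

  eval-nn : ∀ {σ} → σ 0 0ℤ ≡ + n → Eval σ (scalar 0 ⊗ scalar 0) (+ (n * n)) 2 9
  eval-nn {σ} eq = subst (λ v → Eval σ (scalar 0 ⊗ scalar 0) v 2 9) (sym (ℤ.pos-* n n))
    (eval-⊗ (eval-read (eval-lit 0ℤ) eq n<2^b) (eval-read (eval-lit 0ℤ) eq n<2^b))

  run-find-max : Fast.Runs find-max σ₀ 102
    (λ σ → σ 14 0ℤ ≡ + W × (∀ y j → y ≢ 10 → y ≢ 14 → σ y j ≡ σ₀ y j))
  run-find-max =
    Fast.run-assign {P = λ σ → σ ≡ σ₀ [ 14 , 0ℤ ↦ 1ℤ ]} (eval-lit 0ℤ) (eval-lit 1ℤ) refl Fast.then λ { refl →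
    speed (loop-weight 2 9 53) (for-cost≤ 2 9 53 nn≤NN) (Plain.map-post
      (λ { (cell , fr) → trans cell (cong +_ maxWeight≡) , fr })
      (Plain.run-for 10 I (ℕ.≤-<-trans nn≤NN NN<2^b)
        (λ _ h → eval-nn (proj₂ h 0 0ℤ (λ ()) λ ()))
        (λ { {σ = σ} {v} (cell , fr) → cell , λ y j y≢10 y≢14 → trans (update-array σ 0ℤ v j (y≢10 ∘ sym)) (fr y j y≢10 y≢14) })
        body
        (refl , λ y j _ y≢14 → update-array σ₀ 0ℤ 1ℤ j (y≢14 ∘ sym)))) }
    where
    I : ℕ → Store → Set
    I k σ = σ 14 0ℤ ≡ + maximum f k × (∀ y j → y ≢ 10 → y ≢ 14 → σ y j ≡ σ₀ y j)
    body : ∀ k {σ} → k < n * n → σ 10 0ℤ ≡ + k → I k σ →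
      Plain.Runs (raise (2 [ scalar 10 ]) ⨾ raise (lit 0ℤ ⊖ 2 [ scalar 10 ])) σ 53 (λ σ′ → σ′ 10 0ℤ ≡ + k × I (suc k) σ′)
    body k {σ} k< ctr (cell , fr) =
      run-raise read cell max< Plain.then λ { refl → Plain.map-post
        (λ { refl → ctr , refl , λ y j y≢10 y≢14 → trans (update-array σ₁ 0ℤ (+ maximum f (suc k)) j (y≢14 ∘ sym))
            (trans (update-array σ 0ℤ (+ m₁) j (y≢14 ∘ sym)) (fr y j y≢10 y≢14)) })
        (run-raise (eval-⊖ (eval-lit 0ℤ) (eval-read (eval-index k<NN ctr) (fr 2 (+ k) (λ ()) (λ ())) z<)) refl
          (ℕ.≤-<-trans (ℕ.m≤m⊔n _ _) (ℕ.≤-<-trans (ℕ.≤-trans (maximum-mono f k<) (ℕ.≤-reflexive maxWeight≡)) W<2^b))) }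
      where
      m₁ = maximum f k ⊔ positivePart (f k)
      σ₁ = σ [ 14 , 0ℤ ↦ + m₁ ]
      k<NN = ℕ.<-≤-trans k< nn≤NN
      z< : ∣ f k ∣ < 2 ^ b
      z< = ℕ.≤-<-trans (weight≤W k<) W<2^b
      max< : maximum f k < 2 ^ b
      max< = ℕ.≤-<-trans (ℕ.≤-trans (maximum-mono f (ℕ.<⇒≤ k<)) (ℕ.≤-reflexive maxWeight≡)) W<2^b
      read : Eval σ (2 [ scalar 10 ]) (f k) 1 5
      read = eval-read (eval-index k<NN ctr) (fr 2 (+ k) (λ ()) (λ ())) z<

  eval-≡ : ∀ {σ e v v′ d w} → v ≡ v′ → Eval σ e v d w → Eval σ e v′ d w
  eval-≡ refl ev = ev

  run-find-log : ∀ {σ₀} → σ₀ 15 0ℤ ≡ + N → σ₀ 17 0ℤ ≡ 1ℤ → σ₀ 16 0ℤ ≡ 0ℤ →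
    Fast.Runs find-log σ₀ (L * (26 + 21) + 26) (λ σ → σ 16 0ℤ ≡ + L × (∀ y j → y ≢ 16 → y ≢ 17 → σ y j ≡ σ₀ y j))
  run-find-log {σ₀} dim one zer = Fast.map-post
    (λ { (k , eq , _ , len , fr) → trans len (cong +_ (trans (sym (ℕ.+-identityʳ k)) eq)) , fr })
    (Fast.run-while {w = 26} I step stop L (0 , refl , one , zer , λ _ _ _ _ → refl))
    where
    I : ℕ → Store → Set
    I r σ = ∃ λ k → k + r ≡ L × σ 17 0ℤ ≡ + (2 ^ k) × σ 16 0ℤ ≡ + k × (∀ y j → y ≢ 16 → y ≢ 17 → σ y j ≡ σ₀ y j)

    power< : ∀ {k r} → k + r ≡ L → 2 ^ k < 2 ^ b
    power< {k} {r} eq = ℕ.^-monoʳ-< 2 (s≤s (s≤s z≤n)) (ℕ.≤-<-trans (ℕ.≤-trans (ℕ.m≤m+n k r) (ℕ.≤-reflexive eq)) L<b)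

    test : ∀ {k r σ} → k + r ≡ L → σ 17 0ℤ ≡ + (2 ^ k) → (∀ y j → y ≢ 16 → y ≢ 17 → σ y j ≡ σ₀ y j) →
      Eval σ ((entries ⊕ lit 1ℤ) ⊖ scalar 17) (+ (N * N) ℤ.+ 1ℤ ℤ.- + (2 ^ k)) 6 26
    test {k} eq pw fr = eval-⊖ (eval-⊕ (eval-entries (trans (fr 15 0ℤ (λ ()) λ ()) dim)) (eval-lit 1ℤ))
      (eval-read (eval-lit 0ℤ) pw (power< {k} eq))

    step : ∀ r {σ} → I (suc r) σ → 0ℤ ℤ.< ⟦ (entries ⊕ lit 1ℤ) ⊖ scalar 17 ⟧ σ ×
      cost ((entries ⊕ lit 1ℤ) ⊖ scalar 17) σ ≤ 26 * suc b ×
      Fast.Runs ((17 [ lit 0ℤ ]≔ scalar 17 ⊕ scalar 17) ⨾ (16 [ lit 0ℤ ]≔ scalar 16 ⊕ lit 1ℤ)) σ 21 (I r)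
    step r {σ} (k , eq , pw , len , fr) =
      subst (0ℤ ℤ.<_) (sym (Eval.value ev)) positive , Eval.cheap {w = 26} ev ,
      (Fast.run-assign {P = λ σ′ → σ′ ≡ σ [ 17 , 0ℤ ↦ + (2 ^ k) ℤ.+ + (2 ^ k) ]} (eval-lit 0ℤ) (eval-⊕ pow pow) refl
       Fast.then λ { refl → Fast.run-assign {P = I r} (eval-lit 0ℤ) (eval-⊕ (eval-read (eval-lit 0ℤ) len k<2^b′) (eval-lit 1ℤ))
         (suc k , trans (sym (ℕ.+-suc k r)) eq , cong (λ a → + (2 ^ k + a)) (sym (ℕ.+-identityʳ (2 ^ k))) ,
          cong +_ (ℕ.+-comm k 1) ,
          λ y j y≢16 y≢17 → trans (update-array (σ [ 17 , 0ℤ ↦ + (2 ^ k) ℤ.+ + (2 ^ k) ]) 0ℤ (+ k ℤ.+ 1ℤ) j (y≢16 ∘ sym))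
            (trans (update-array σ 0ℤ (+ (2 ^ k) ℤ.+ + (2 ^ k)) j (y≢17 ∘ sym)) (fr y j y≢16 y≢17))) })
      where
      ev : Eval σ ((entries ⊕ lit 1ℤ) ⊖ scalar 17) (+ (N * N) ℤ.+ 1ℤ ℤ.- + (2 ^ k)) 6 26
      ev = test {k} {suc r} {σ} eq pw fr
      pow : Eval σ (scalar 17) (+ (2 ^ k)) 1 3
      pow = eval-read (eval-lit 0ℤ) pw (power< {k} eq)
      k<L : k < L
      k<L = ℕ.≤-trans (s≤s (ℕ.m≤m+n k r)) (ℕ.≤-reflexive (trans (sym (ℕ.+-suc k r)) eq))
      k<2^b′ : k < 2 ^ b
      k<2^b′ = ℕ.<-trans (ℕ.<-trans k<L L<b) (n<2^n b)
      positive : 0ℤ ℤ.< + (N * N) ℤ.+ 1ℤ ℤ.- + (2 ^ k)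
      positive = subst (0ℤ ℤ.<_) (trans (ℤ.+-assoc (+ (N * N)) (ℤ.- (+ (2 ^ k))) 1ℤ)
          (trans (cong (λ z → + (N * N) ℤ.+ z) (ℤ.+-comm (ℤ.- (+ (2 ^ k))) 1ℤ)) (sym (ℤ.+-assoc (+ (N * N)) 1ℤ (ℤ.- (+ (2 ^ k)))))))
        (≤⇒0<1+diff (ℤ.+≤+ (2^k≤NN k<L)))

    stop : ∀ {σ} → I 0 σ → ¬ 0ℤ ℤ.< ⟦ (entries ⊕ lit 1ℤ) ⊖ scalar 17 ⟧ σ × cost ((entries ⊕ lit 1ℤ) ⊖ scalar 17) σ ≤ 26 * suc b
    stop {σ} (k , eq , pw , len , fr) = (λ lt → ℤ.<⇒≱ (subst (0ℤ ℤ.<_) (Eval.value ev) lt) (ℤ.i≤j⇒i-j≤0 (ℤ.+≤+ done))) , Eval.cheap {w = 26} ev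
      where
      ev : Eval σ ((entries ⊕ lit 1ℤ) ⊖ scalar 17) (+ (N * N) ℤ.+ 1ℤ ℤ.- + (2 ^ k)) 6 26
      ev = test {k} {0} {σ} eq pw fr
      done : N * N + 1 ≤ 2 ^ k
      done = subst (λ l → N * N + 1 ≤ 2 ^ l) (trans (sym eq) (ℕ.+-identityʳ k)) (ℕ.≤-trans (ℕ.≤-reflexive (ℕ.+-comm (N * N) 1)) NN<2^L)

  Division : ℕ → ℕ → ℕ → ℕ → Store → Set
  Division Q R m j σ = ∃ λ q → ∃ λ r → σ Q (+ j) ≡ + q × σ R (+ j) ≡ + r × j ≡ m * q + r × r < m

  run-divide : ∀ {σ₀} Q R x m .{{_ : NonZero m}} → Q ≢ R → Q ≢ 10 → R ≢ 10 → Q ≢ 15 → R ≢ 15 → Q ≢ x → R ≢ x → x ≢ 10 →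
    σ₀ 15 0ℤ ≡ + N → σ₀ x 0ℤ ≡ + m → m < 2 ^ b → σ₀ Q 0ℤ ≡ 0ℤ → σ₀ R 0ℤ ≡ 0ℤ →
    Fast.Runs (divide Q R (scalar x)) σ₀ 100 (λ σ → (∀ j → j ≤ N * N → Division Q R m j σ) ×
      (∀ y j → y ≢ Q → y ≢ R → y ≢ 10 → σ y j ≡ σ₀ y j))
  run-divide {σ₀} Q R x m Q≢R Q≢10 R≢10 Q≢15 R≢15 Q≢x R≢x x≢10 dim mod m< Q₀ R₀ =
    speed (loop-weight 2 9 54) (for-cost≤ 2 9 54 ℕ.≤-refl) (Plain.run-for 10 I NN<2^b
      (λ _ h → eval-entries (trans (proj₂ h 15 0ℤ (Q≢15 ∘ sym) (R≢15 ∘ sym) λ ()) dim))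
      (λ { {σ = σ} {v} (div , fr) →
        (λ j j≤ → let q , r , a , c , rest = div j j≤ in q , r ,
          trans (update-array σ 0ℤ v (+ j) (Q≢10 ∘ sym)) a , trans (update-array σ 0ℤ v (+ j) (R≢10 ∘ sym)) c , rest) ,
        λ y j y≢Q y≢R y≢10 → trans (update-array σ 0ℤ v j (y≢10 ∘ sym)) (fr y j y≢Q y≢R y≢10) })
      body
      ((λ { zero z≤n → 0 , 0 , Q₀ , R₀ , sym (trans (ℕ.+-identityʳ (m * 0)) (ℕ.*-zeroʳ m)) , ℕ.>-nonZero⁻¹ m }) , λ _ _ _ _ _ → refl))
    where
    Frame′ : Store → Set
    Frame′ σ = ∀ y j → y ≢ Q → y ≢ R → y ≢ 10 → σ y j ≡ σ₀ y j
    I : ℕ → Store → Set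
    I k σ = (∀ j → j ≤ k → Division Q R m j σ) × Frame′ σ

    k+1 : ∀ k → + k ℤ.+ 1ℤ ≡ + suc k
    k+1 k = cong +_ (ℕ.+-comm k 1)

    extend : ∀ {k σ} q r → suc k ≡ m * q + r → r < m → σ 10 0ℤ ≡ + k → I k σ →
      let σ′ = (σ [ R , + suc k ↦ + r ]) [ Q , + suc k ↦ + q ] in σ′ 10 0ℤ ≡ + k × I (suc k) σ′
    extend {k} {σ} q r eq r< ctr (div , fr) =
      trans (update-array σ₁ (+ suc k) (+ q) 0ℤ Q≢10) (trans (update-array σ (+ suc k) (+ r) 0ℤ R≢10) ctr) , div′ ,
      λ y j y≢Q y≢R y≢10 → trans (update-array σ₁ (+ suc k) (+ q) j (y≢Q ∘ sym))
        (trans (update-array σ (+ suc k) (+ r) j (y≢R ∘ sym)) (fr y j y≢Q y≢R y≢10))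
      where
      σ₁ = σ [ R , + suc k ↦ + r ]
      div′ : ∀ j → j ≤ suc k → Division Q R m j (σ₁ [ Q , + suc k ↦ + q ])
      div′ j j≤ with j ℕ.≟ suc k
      ... | yes refl = q , r , update-same σ₁ Q (+ suc k) (+ q) ,
        trans (update-array σ₁ (+ suc k) (+ q) (+ suc k) Q≢R) (update-same σ R (+ suc k) (+ r)) , eq , r<
      ... | no j≢ = let q′ , r′ , a , c , rest = div j (ℕ.≤-pred (ℕ.≤∧≢⇒< j≤ j≢)) in q′ , r′ ,
        trans (update-index σ₁ Q (+ q) (j≢ ∘ sym ∘ ℤ.+-injective)) (trans (update-array σ (+ suc k) (+ r) (+ j) (Q≢R ∘ sym)) a) ,
        trans (update-array σ₁ (+ suc k) (+ q) (+ j) Q≢R) (trans (update-index σ R (+ r) (j≢ ∘ sym ∘ ℤ.+-injective)) c) , rest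

    body : ∀ k {σ} → k < N * N → σ 10 0ℤ ≡ + k → I k σ → Plain.Runs _ σ 54 (λ σ′ → σ′ 10 0ℤ ≡ + k × I (suc k) σ′)
    body k {σ} k< ctr h@(div , fr) with div k ℕ.≤-refl
    ... | q , r , Q[k] , R[k] , k≡ , r< =
      -- Positivity of (m - 1) - r means that r + 1 is still a remainder. Otherwise r = m - 1, the
      -- remainder returns to 0 and the quotient grows by one.
      Plain.run-if (eval-⊖ (eval-⊖ (eval-read (eval-lit 0ℤ) (trans (fr x 0ℤ (Q≢x ∘ sym) (R≢x ∘ sym) x≢10) mod) m<) (eval-lit 1ℤ)) read-R)
        (λ lt →
          Plain.run-assign {P = λ σ′ → σ′ ≡ σ [ R , + suc k ↦ + suc r ]} next (eval-≡ (k+1 r) (eval-⊕ read-R (eval-lit 1ℤ))) refl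
          Plain.then λ { refl → Plain.run-assign {P = λ σ′ → σ′ 10 0ℤ ≡ + k × I (suc k) σ′} (next′ (+ suc r)) (read-Q′ (+ suc r))
            (extend q (suc r) (trans (cong suc k≡) (sym (ℕ.+-suc (m * q) r))) (inside lt) ctr h) })
        (λ ¬lt → Plain.weaken (ℕ.≤ᵇ⇒≤ 30 34 tt)
          (Plain.run-assign {P = λ σ′ → σ′ ≡ σ [ R , + suc k ↦ 0ℤ ]} next (eval-lit 0ℤ) refl
          Plain.then λ { refl → Plain.run-assign {P = λ σ′ → σ′ 10 0ℤ ≡ + k × I (suc k) σ′} (next′ 0ℤ) (eval-≡ (k+1 q) (eval-⊕ (read-Q′ 0ℤ) (eval-lit 1ℤ)))
            (extend (suc q) 0 (carry ¬lt) (ℕ.>-nonZero⁻¹ m) ctr h) }))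
      where
      q<2^b : q < 2 ^ b
      q<2^b = ℕ.≤-<-trans (ℕ.≤-trans (ℕ.m≤n*m q m) (ℕ.≤-trans (ℕ.m≤m+n (m * q) r) (ℕ.≤-reflexive (sym k≡)))) (k<2^b k<)
      r<2^b : r < 2 ^ b
      r<2^b = ℕ.<-trans r< m<
      next : Eval σ (scalar 10 ⊕ lit 1ℤ) (+ suc k) 3 9
      next = eval-≡ (k+1 k) (eval-⊕ (eval-index k< ctr) (eval-lit 1ℤ))
      read-R : Eval σ (R [ scalar 10 ]) (+ r) 1 5
      read-R = eval-read (eval-index k< ctr) R[k] r<2^b
      module _ (v : ℤ) where
        ctr′ : (σ [ R , + suc k ↦ v ]) 10 0ℤ ≡ + k
        ctr′ = trans (update-array σ (+ suc k) v 0ℤ R≢10) ctr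
        next′ : Eval (σ [ R , + suc k ↦ v ]) (scalar 10 ⊕ lit 1ℤ) (+ suc k) 3 9
        next′ = eval-≡ (k+1 k) (eval-⊕ (eval-index k< ctr′) (eval-lit 1ℤ))
        read-Q′ : Eval (σ [ R , + suc k ↦ v ]) (Q [ scalar 10 ]) (+ q) 1 5
        read-Q′ = eval-read (eval-index k< ctr′) (trans (update-array σ (+ suc k) v (+ k) (Q≢R ∘ sym)) Q[k]) q<2^b
      m-1-r : + m ℤ.- 1ℤ ℤ.- + r ≡ + m ℤ.- + suc r
      m-1-r = trans (ℤ.+-assoc (+ m) (ℤ.- 1ℤ) (ℤ.- (+ r))) (cong (λ z → + m ℤ.+ z) (sym (ℤ.neg-distrib-+ 1ℤ (+ r))))
      inside : 0ℤ ℤ.< + m ℤ.- 1ℤ ℤ.- + r → suc r < m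
      inside lt = ℕ.≤∧≢⇒< r< λ { refl → ℤ.<-irrefl (sym (trans m-1-r (ℤ.i≡j⇒i-j≡0 {+ m} refl))) lt }
      carry : ¬ 0ℤ ℤ.< + m ℤ.- 1ℤ ℤ.- + r → suc k ≡ m * suc q + 0
      carry ¬lt = begin
        suc k              ≡⟨ cong suc k≡ ⟩
        suc (m * q + r)    ≡⟨ sym (ℕ.+-suc (m * q) r) ⟩
        m * q + suc r      ≡⟨ cong (λ z → m * q + z) (ℕ.≤-antisym r< (ℤ.drop‿+≤+ (ℤ.i-j≤0⇒i≤j (subst (ℤ._≤ 0ℤ) m-1-r (ℤ.≮⇒≥ ¬lt))))) ⟩
        m * q + m          ≡⟨ ℕ.+-comm (m * q) m ⟩
        m + m * q          ≡⟨ sym (ℕ.*-suc m q) ⟩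
        m * suc q          ≡⟨ sym (ℕ.+-identityʳ (m * suc q)) ⟩
        m * suc q + 0      ∎
        where open ≡-Reasoning

  bounded : WeightsBoundedBy G W
  bounded u v w eq = lower w ∣w∣≤W , upper w ∣w∣≤W
    where
    ∣w∣≤W : ∣ w ∣ ≤ W
    ∣w∣≤W = subst (λ z → ∣ z ∣ ≤ W) (trans (rowMajor-combine B₀ u v) (cong (maybe′ (λ w → w) 0ℤ) eq))
              (weight≤W (Fin.toℕ<n (combine u v)))
    lower : ∀ w → ∣ w ∣ ≤ W → ℤ.- (+ W) ℤ.≤ w
    lower (+ a)    _       = ℤ.-≤+
    lower -[1+ a ] (s≤s h) = ℤ.-≤- h
    upper : ∀ w → ∣ w ∣ ≤ W → w ℤ.≤ + W
    upper (+ a)    h = ℤ.+≤+ h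
    upper -[1+ a ] _ = ℤ.-≤+

  module E = Encoding G W₋ bounded

  record Ready (σ : Store) : Set where
    field
      vertices  : σ 0 0ℤ ≡ + n
      adjacent  : ∀ k → k < n * n → σ 1 (+ k) ≡ rowMajor A₀ (+ k)
      weighted  : ∀ k → k < n * n → σ 2 (+ k) ≡ rowMajor B₀ (+ k)
      by-n      : ∀ j → j ≤ N * N → Division 4 5 n j σ
      by-W      : ∀ j → j ≤ N * N → Division 6 7 W j σ
      by-N      : ∀ j → j ≤ N * N → Division 8 9 N j σ
      unit      : σ 13 0ℤ ≡ 1ℤ
      width     : σ 14 0ℤ ≡ + W
      dimension : σ 15 0ℤ ≡ + N
      len       : σ 16 0ℤ ≡ + L

  Division-cong : ∀ Q R {m j} σ τ → (∀ j → τ Q j ≡ σ Q j) → (∀ j → τ R j ≡ σ R j) → Division Q R m j σ → Division Q R m j τ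
  Division-cong Q R σ τ eq eq′ (q , r , a , c , rest) = q , r , trans (eq _) a , trans (eq′ _) c , rest

  Ready-frame : ∀ {σ τ} → (∀ y {_ : T (y ℕ.<ᵇ 20)} j → y ≢ 10 → τ y j ≡ σ y j) → Ready σ → Ready τ
  Ready-frame {σ} {τ} fr r = record
    { vertices  = trans (fr 0 0ℤ λ ()) vertices
    ; adjacent  = λ k k< → trans (fr 1 (+ k) λ ()) (adjacent k k<)
    ; weighted  = λ k k< → trans (fr 2 (+ k) λ ()) (weighted k k<)
    ; by-n      = λ j j≤ → Division-cong 4 5 σ τ (λ i → fr 4 i λ ()) (λ i → fr 5 i λ ()) (by-n j j≤)
    ; by-W      = λ j j≤ → Division-cong 6 7 σ τ (λ i → fr 6 i λ ()) (λ i → fr 7 i λ ()) (by-W j j≤)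
    ; by-N      = λ j j≤ → Division-cong 8 9 σ τ (λ i → fr 8 i λ ()) (λ i → fr 9 i λ ()) (by-N j j≤)
    ; unit      = trans (fr 13 0ℤ λ ()) unit
    ; width     = trans (fr 14 0ℤ λ ()) width
    ; dimension = trans (fr 15 0ℤ λ ()) dimension
    ; len       = trans (fr 16 0ℤ λ ()) len }
    where open Ready r

  quotient-remainder : ∀ {a m} Q R {σ} (i : Fin a) (r : Fin m) → Division Q R m (toℕ (combine i r)) σ →
    σ Q (+ toℕ (combine i r)) ≡ + toℕ i × σ R (+ toℕ (combine i r)) ≡ + toℕ r
  quotient-remainder Q R i r (q′ , r′ , a , c , eq , r′<)
    with division-unique r′< (Fin.toℕ<n r) (trans (sym eq) (Fin.toℕ-combine i r))
  ... | refl , refl = a , c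

  k≤NN : ∀ {k} → k < N → k ≤ N * N
  k≤NN k<N = ℕ.≤-trans (ℕ.<⇒≤ k<N) (ℕ.m≤m*n N N)

  module Reads {σ} (r : Ready σ) where
    open Ready r

    vertex-offset : ∀ s → σ 6 (+ toℕ s) ≡ + toℕ (E.vertex s) × σ 7 (+ toℕ s) ≡ + E.offset s
    vertex-offset s = subst (λ t → σ 6 (+ toℕ t) ≡ + toℕ (E.vertex s) × σ 7 (+ toℕ t) ≡ + E.offset s) (Fin.combine-remQuot {n} W s)
      (quotient-remainder 6 7 {σ} (E.vertex s) (proj₂ (remQuot {n} W s)) (by-W _ (k≤NN (Fin.toℕ<n _))))

    fin<2^b : ∀ {a} (i : Fin a) → a ≤ N * N → ∣ + toℕ i ∣ < 2 ^ b
    fin<2^b i a≤ = ℕ.<-trans (ℕ.<-≤-trans (Fin.toℕ<n i) a≤) NN<2^b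

    N≤NN : N ≤ N * N
    N≤NN = ℕ.m≤m*n N N

    module _ (s t : Fin N) (ctr : σ 10 0ℤ ≡ + toℕ (combine s t)) where

      index : Eval σ (scalar 10) (+ toℕ (combine s t)) 1 3
      index = eval-index (Fin.toℕ<n (combine s t)) ctr

      row-col : σ 8 (+ toℕ (combine s t)) ≡ + toℕ s × σ 9 (+ toℕ (combine s t)) ≡ + toℕ t
      row-col = quotient-remainder 8 9 {σ} s t (by-N _ (ℕ.<⇒≤ (Fin.toℕ<n (combine s t))))

      read-s : Eval σ (8 [ scalar 10 ]) (+ toℕ s) 1 5
      read-s = eval-read index (proj₁ row-col) (fin<2^b s N≤NN)

      read-t : Eval σ (9 [ scalar 10 ]) (+ toℕ t) 1 5
      read-t = eval-read index (proj₂ row-col) (fin<2^b t N≤NN)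

      read-vertex : ∀ {e d w} i → Eval σ e (+ toℕ i) d w → Eval σ (6 [ e ]) (+ toℕ (E.vertex i)) 1 (2 + w)
      read-vertex i ev = eval-read ev (proj₁ (vertex-offset i)) (fin<2^b (E.vertex i) (ℕ.≤-trans n≤N N≤NN))

      read-offset : ∀ {e d w} i → Eval σ e (+ toℕ i) d w → Eval σ (7 [ e ]) (+ E.offset i) 1 (2 + w)
      read-offset i ev = eval-read ev (proj₂ (vertex-offset i)) (fin<2^b (proj₂ (remQuot {n} W i)) (ℕ.≤-trans W≤N N≤NN))

      pair-index : Eval σ (scalar 0 ⊗ 6 [ 8 [ scalar 10 ] ] ⊕ 6 [ 9 [ scalar 10 ] ]) (+ toℕ (combine (E.vertex s) (E.vertex t))) 4 25
      pair-index = eval-≡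
        (trans (cong (ℤ._+ (+ toℕ (E.vertex t))) (sym (ℤ.pos-* n (toℕ (E.vertex s))))) (cong +_ (sym (Fin.toℕ-combine (E.vertex s) (E.vertex t)))))
        (eval-⊕ (eval-⊗ (eval-read (eval-lit 0ℤ) vertices n<2^b) (read-vertex s read-s)) (read-vertex t read-t))

      read-adjacent : Eval σ (pair 1 (6 [ 8 [ scalar 10 ] ]) (6 [ 9 [ scalar 10 ] ])) (A₀ (E.vertex s) (E.vertex t)) 1 27
      read-adjacent = eval-read pair-index
        (trans (adjacent _ (Fin.toℕ<n (combine (E.vertex s) (E.vertex t)))) (rowMajor-combine A₀ (E.vertex s) (E.vertex t)))
        (ℕ.≤-<-trans (∣adjacency∣≤1 (G (E.vertex s) (E.vertex t))) (ℕ.≤-<-trans 1≤NN NN<2^b))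
        where
        ∣adjacency∣≤1 : ∀ (e : Maybe ℤ) → ∣ maybe′ (λ _ → 1ℤ) 0ℤ e ∣ ≤ 1
        ∣adjacency∣≤1 (just _) = ℕ.≤-refl
        ∣adjacency∣≤1 nothing  = z≤n

      read-weight : Eval σ (pair 2 (6 [ 8 [ scalar 10 ] ]) (6 [ 9 [ scalar 10 ] ])) (B₀ (E.vertex s) (E.vertex t)) 1 27
      read-weight = eval-read pair-index
        (trans (weighted _ (Fin.toℕ<n (combine (E.vertex s) (E.vertex t)))) (rowMajor-combine B₀ (E.vertex s) (E.vertex t)))
        (ℕ.≤-<-trans (subst (λ z → ∣ z ∣ ≤ W) (rowMajor-combine B₀ (E.vertex s) (E.vertex t))
          (weight≤W (Fin.toℕ<n (combine (E.vertex s) (E.vertex t))))) W<2^b)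

      eval-slack : ∀ {θᵉ θ d w} → Eval σ θᵉ θ d w → Eval σ (slackᵉ θᵉ) (E.slack θ s t) (1 + suc (5 + d)) (slack-weight d w)
      eval-slack ev = eval-⊗ read-adjacent (eval-⊕ (eval-⊖ (eval-⊕ (read-offset s read-s) read-weight) (read-offset t read-t)) ev)

      eval-diagonal : Eval σ diagonalᵉ (E.diagonal s t) 8 46
      eval-diagonal = eval-⊖ (eval-lit 1ℤ) (eval-⊗ (eval-⊖ read-s read-t) (eval-⊖ read-s read-t))

  record Prepared (ν : Fin 6 → BMat N) (σ : Store) : Set where
    field
      ready    : Ready σ
      contents : ∀ m k → k < N * N → σ (matrix m) (+ k) ≡ rowMajor (ints (ν m)) (+ k)
      blank    : ∀ x j → σ (30 + x) j ≡ 0ℤ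

  prepared-fill : ∀ {ν σ₀ σ} m A → Prepared ν σ₀ →
    Plain.Filled (matrix m) (N * N) +_ (λ k → rowMajor (ints A) (+ k)) σ₀ σ → Prepared (ν [ m ≔ A ]) σ
  prepared-fill {ν} {σ₀} {σ} m A P (Plain.filled fr wr _) = record
    { ready    = Ready-frame (λ y {t} j y≢10 → fr y j (λ { refl → ℕ.<⇒≱ (ℕ.<ᵇ⇒< y 20 t) (ℕ.m≤m+n 20 (toℕ m)) }) y≢10) ready
    ; contents = contents′
    ; blank    = λ x j → trans (fr (30 + x) j (p≢matrix m x ∘ sym) λ ()) (blank x j) }
    where
    open Prepared P
    contents′ : ∀ m′ k → k < N * N → σ (matrix m′) (+ k) ≡ rowMajor (ints ((ν [ m ≔ A ]) m′)) (+ k)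
    contents′ m′ k k< with m′ Fin.≟ m
    ... | yes refl = wr k k<
    ... | no m′≢m  = trans (fr (matrix m′) (+ k) (m′≢m ∘ Fin.toℕ-injective ∘ ℕ.+-cancelˡ-≡ 20 _ _) λ ()) (contents m′ k k<)

  test-true : ∀ x {z} → 0ℤ ℤ.< z → 1ℤ ≡ + bit (x ∨ ⌊ 0ℤ ℤ.<? z ⌋)
  test-true true  lt = refl
  test-true false {z} lt with 0ℤ ℤ.<? z
  ... | yes _  = refl
  ... | no ¬lt = contradiction lt ¬lt

  test-false : ∀ x {z} → ¬ 0ℤ ℤ.< z → + bit x ≡ + bit (x ∨ ⌊ 0ℤ ℤ.<? z ⌋)
  test-false true  ¬lt = refl
  test-false false {z} ¬lt with 0ℤ ℤ.<? z
  ... | yes lt = contradiction lt ¬lt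
  ... | no _   = refl

  module _ {ν σ₀} (P : Prepared ν σ₀) (m : Fin 6) where
    open Prepared P

    private
      ready′ : ∀ {σ} → (∀ y j → y ≢ matrix m → y ≢ 10 → σ y j ≡ σ₀ y j) → Ready σ
      ready′ fr = Ready-frame (λ y {t} j y≢10 → fr y j (λ { refl → ℕ.<⇒≱ (ℕ.<ᵇ⇒< y 20 t) (ℕ.m≤m+n 20 (toℕ m)) }) y≢10) ready

    run-fill-edges : ∀ {θᵉ θ d w} → (∀ {σ} → Ready σ → Eval σ θᵉ θ d w) →
      Fast.Runs (fill-edges m θᵉ) σ₀ (loop-weight 2 9 (slack-weight d w + ((3 + 2) + (3 + 1))))
        (Prepared (ν [ m ≔ E.edges θ ]))
    run-fill-edges {θᵉ} {θ} {d} {w} evθ = Fast.map-post (prepared-fill m (E.edges θ) P)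
      (run-fill {w₁ = 2} {w₂ = 1} +_ (λ k → rowMajor (ints (E.edges θ)) (+ k)) (λ ()) ℕ.≤-refl (λ _ _ → ℤ.+-injective)
        (λ fr → eval-entries (Ready.dimension (ready′ fr))) entry)
      where
      entry : ∀ k {σ} → k < N * N → σ 10 0ℤ ≡ + k → (∀ y j → y ≢ matrix m → y ≢ 10 → σ y j ≡ σ₀ y j) →
        σ (matrix m) (+ k) ≡ σ₀ (matrix m) (+ k) →
        ∃ λ v → Eval σ (slackᵉ θᵉ) v (1 + suc (5 + d)) (slack-weight d w) × Eval σ (scalar 10) (+ k) 1 3 ×
          (0ℤ ℤ.< v → Eval σ (lit 1ℤ) (rowMajor (ints (E.edges θ)) (+ k)) 1 2) ×
          (¬ 0ℤ ℤ.< v → Eval σ (lit 0ℤ) (rowMajor (ints (E.edges θ)) (+ k)) 0 1)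
      entry k {σ} k< ctr fr _ with row-column {N} k<
      ... | s , t , refl = E.slack θ s t , eval-slack s t ctr (evθ (ready′ fr)) , index s t ctr ,
        (λ lt → eval-≡ (trans (test-true false lt) (sym (rowMajor-combine (ints (E.edges θ)) s t))) (eval-lit 1ℤ)) ,
        λ ¬lt → eval-≡ (trans (test-false false ¬lt) (sym (rowMajor-combine (ints (E.edges θ)) s t))) (eval-lit 0ℤ)
        where open Reads (ready′ fr)

    run-fill-identity : Fast.Runs (fill-identity m) σ₀ 105 (Prepared (ν [ m ≔ ν m ⊍ E.identity ]))
    run-fill-identity = Fast.map-post (prepared-fill m new P)
      (run-fill {w₁ = 2} {w₂ = 5} +_ (λ k → rowMajor (ints new) (+ k)) (λ ()) ℕ.≤-refl (λ _ _ → ℤ.+-injective)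
        (λ fr → eval-entries (Ready.dimension (ready′ fr))) entry)
      where
      new : BMat N
      new = ν m ⊍ E.identity
      entry : ∀ k {σ} → k < N * N → σ 10 0ℤ ≡ + k → (∀ y j → y ≢ matrix m → y ≢ 10 → σ y j ≡ σ₀ y j) →
        σ (matrix m) (+ k) ≡ σ₀ (matrix m) (+ k) →
        ∃ λ v → Eval σ diagonalᵉ v 8 46 × Eval σ (scalar 10) (+ k) 1 3 ×
          (0ℤ ℤ.< v → Eval σ (lit 1ℤ) (rowMajor (ints new) (+ k)) 1 2) ×
          (¬ 0ℤ ℤ.< v → Eval σ (matrix m [ scalar 10 ]) (rowMajor (ints new) (+ k)) 1 5)
      entry k {σ} k< ctr fr same with row-column {N} k<
      ... | s , t , refl = E.diagonal s t , eval-diagonal s t ctr , index s t ctr ,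
        (λ lt → eval-≡ (trans (test-true (ν m s t) lt) (sym (rowMajor-combine (ints new) s t))) (eval-lit 1ℤ)) ,
        λ ¬lt → eval-≡ (trans (test-false (ν m s t) ¬lt) (sym (rowMajor-combine (ints new) s t)))
          (eval-read (index s t ctr) (trans same (trans (contents m _ k<) (rowMajor-combine (ints (ν m)) s t))) (bits<2^b (ν m s t)))
        where open Reads (ready′ fr)

  initial : ℕ → Bool
  initial y = (y ℕ.<ᵇ 4) ∨ (20 ℕ.≤ᵇ y)

  nothing-filled : Fin 6 → BMat N
  nothing-filled _ _ _ = false

  module _ {σ₁ σ₅ σ₆ σ₇ σ₈ : Store}
    (W-cell : σ₁ 14 0ℤ ≡ + W) (fr₁ : ∀ y j → y ≢ 10 → y ≢ 14 → σ₁ y j ≡ σ₀ y j)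
    (L-cell : σ₅ 16 0ℤ ≡ + L)
    (fr₅ : ∀ y j → y ≢ 16 → y ≢ 17 → σ₅ y j ≡ (((σ₁ [ 15 , 0ℤ ↦ + N ]) [ 13 , 0ℤ ↦ 1ℤ ]) [ 17 , 0ℤ ↦ 1ℤ ]) y j)
    (div₆ : ∀ j → j ≤ N * N → Division 4 5 n j σ₆) (fr₆ : ∀ y j → y ≢ 4 → y ≢ 5 → y ≢ 10 → σ₆ y j ≡ σ₅ y j)
    (div₇ : ∀ j → j ≤ N * N → Division 6 7 W j σ₇) (fr₇ : ∀ y j → y ≢ 6 → y ≢ 7 → y ≢ 10 → σ₇ y j ≡ σ₆ y j)
    (div₈ : ∀ j → j ≤ N * N → Division 8 9 N j σ₈) (fr₈ : ∀ y j → y ≢ 8 → y ≢ 9 → y ≢ 10 → σ₈ y j ≡ σ₇ y j)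
    where

    private
      back₅ : ∀ y j → y ≢ 4 → y ≢ 5 → y ≢ 6 → y ≢ 7 → y ≢ 8 → y ≢ 9 → y ≢ 10 → σ₈ y j ≡ σ₅ y j
      back₅ y j n4 n5 n6 n7 n8 n9 n10 = trans (fr₈ y j n8 n9 n10) (trans (fr₇ y j n6 n7 n10) (fr₆ y j n4 n5 n10))

      back : ∀ y {t : T (initial y)} j → σ₈ y j ≡ σ₀ y j
      back y {t} j = trans (back₅ y j (λ { refl → t }) (λ { refl → t }) (λ { refl → t }) (λ { refl → t }) (λ { refl → t }) (λ { refl → t }) (λ { refl → t }))
        (trans (fr₅ y j (λ { refl → t }) (λ { refl → t }))
          (trans (update-array ((σ₁ [ 15 , 0ℤ ↦ + N ]) [ 13 , 0ℤ ↦ 1ℤ ]) {17} {y} 0ℤ 1ℤ j (λ { refl → t }))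
            (trans (update-array (σ₁ [ 15 , 0ℤ ↦ + N ]) {13} {y} 0ℤ 1ℤ j (λ { refl → t }))
              (trans (update-array σ₁ {15} {y} 0ℤ (+ N) j (λ { refl → t }))
                (fr₁ y j (λ { refl → t }) (λ { refl → t }))))))

    prepared : Prepared nothing-filled σ₈
    prepared = record
      { ready = record
        { vertices  = back 0 0ℤ
        ; adjacent  = λ k _ → back 1 (+ k)
        ; weighted  = λ k _ → back 2 (+ k)
        ; by-n      = λ j j≤ → Division-cong 4 5 σ₆ σ₈ (λ i → trans (fr₈ 4 i (λ ()) (λ ()) λ ()) (fr₇ 4 i (λ ()) (λ ()) λ ()))
                        (λ i → trans (fr₈ 5 i (λ ()) (λ ()) λ ()) (fr₇ 5 i (λ ()) (λ ()) λ ())) (div₆ j j≤)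
        ; by-W      = λ j j≤ → Division-cong 6 7 σ₇ σ₈ (λ i → fr₈ 6 i (λ ()) (λ ()) λ ()) (λ i → fr₈ 7 i (λ ()) (λ ()) λ ()) (div₇ j j≤)
        ; by-N      = div₈
        ; unit      = trans (back₅ 13 0ℤ (λ ()) (λ ()) (λ ()) (λ ()) (λ ()) (λ ()) λ ()) (fr₅ 13 0ℤ (λ ()) λ ())
        ; width     = trans (back₅ 14 0ℤ (λ ()) (λ ()) (λ ()) (λ ()) (λ ()) (λ ()) λ ()) (trans (fr₅ 14 0ℤ (λ ()) λ ()) W-cell)
        ; dimension = trans (back₅ 15 0ℤ (λ ()) (λ ()) (λ ()) (λ ()) (λ ()) (λ ()) λ ()) (fr₅ 15 0ℤ (λ ()) λ ())
        ; len       = trans (back₅ 16 0ℤ (λ ()) (λ ()) (λ ()) (λ ()) (λ ()) (λ ()) λ ()) L-cell }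
      ; contents = λ m k k< → trans (back (matrix m) (+ k)) (sym (zeros k k<))
      ; blank    = λ x j → back (30 + x) j }
      where
      zeros : ∀ k → k < N * N → rowMajor (ints (λ (_ _ : Fin N) → false)) (+ k) ≡ 0ℤ
      zeros k k< = rowMajor-< (ints (λ (_ _ : Fin N) → false)) k<

  prepared-state : ∀ {ν σ} → Prepared ν σ → State ν 0 σ
  prepared-state P = record
    { dimension = Ready.dimension ready ; stride = Ready.unit ready ; fresh = λ x i → blank x _ ; matrices = contents }
    where open Prepared P

  answers : BMat n
  answers u v = E.reachable-base L NN<2^L (E.base u) (E.base v)

  run-write-output : ∀ {σ} → σ 0 0ℤ ≡ + n → σ 14 0ℤ ≡ + W → σ 15 0ℤ ≡ + N →
    (∀ j → j ≤ N * N → Division 4 5 n j σ) →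
    (∀ k → k < N * N → σ 23 (+ k) ≡ rowMajor (ints (E.reachable-base L NN<2^L)) (+ k)) →
    Fast.Runs write-output σ 91 (λ σ′ → ∀ u v → output σ′ u v ≡ + bit (answers u v))
  run-write-output {σ} vertices width dimension by-n contents = Fast.map-post
    (λ { (Plain.filled _ wr _) u v → trans (wr _ (Fin.toℕ<n (combine u v))) (rowMajor-combine (ints answers) u v) })
    (run-fill {d₁ = 0} {w₁ = 0} {w₂ = 38} +_ (λ k → rowMajor (ints answers) (+ k)) (λ ()) nn≤NN (λ _ _ → ℤ.+-injective)
      (λ fr → eval-nn (trans (fr 0 0ℤ (λ ()) λ ()) vertices)) entry)
    where
    entry : ∀ k {τ} → k < n * n → τ 10 0ℤ ≡ + k → (∀ y j → y ≢ 3 → y ≢ 10 → τ y j ≡ σ y j) → τ 3 (+ k) ≡ σ 3 (+ k) →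
      ∃ λ z → Eval τ (lit 0ℤ) z 0 1 × Eval τ (scalar 10) (+ k) 1 3 × (0ℤ ℤ.< z → Eval τ (lit 0ℤ) (rowMajor (ints answers) (+ k)) 0 0) ×
        (¬ 0ℤ ℤ.< z → Eval τ (23 [ scalar 15 ⊗ (scalar 14 ⊗ 4 [ scalar 10 ]) ⊕ scalar 14 ⊗ 5 [ scalar 10 ] ])
          (rowMajor (ints answers) (+ k)) 1 38)
    entry k {τ} k< ctr fr _ with row-column {n} k<
    ... | u , v , refl = 0ℤ , eval-lit 0ℤ , index , (λ lt → contradiction lt (ℤ.<-irrefl refl)) , λ _ →
      eval-read
        (eval-≡ position (eval-⊕ (eval-⊗ (eval-read (eval-lit 0ℤ) (trans (fr 15 0ℤ (λ ()) λ ()) dimension) N<2^b)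
            (eval-⊗ read-W (eval-read index (trans (fr 4 _ (λ ()) λ ()) (proj₁ row-col)) (fin<2^b u))))
          (eval-⊗ read-W (eval-read index (trans (fr 5 _ (λ ()) λ ()) (proj₂ row-col)) (fin<2^b v)))))
        (trans (fr 23 _ (λ ()) λ ()) (trans (contents _ (Fin.toℕ<n (combine (E.base u) (E.base v))))
          (trans (rowMajor-combine (ints (E.reachable-base L NN<2^L)) (E.base u) (E.base v)) (sym (rowMajor-combine (ints answers) u v)))))
        (subst (λ z → ∣ z ∣ < 2 ^ b) (sym (rowMajor-combine (ints answers) u v)) (bits<2^b (answers u v)))
      where
      index : Eval τ (scalar 10) (+ toℕ (combine u v)) 1 3
      index = eval-index (ℕ.<-≤-trans k< nn≤NN) ctr
      row-col = quotient-remainder 4 5 {σ} u v (by-n _ (ℕ.<⇒≤ (ℕ.<-≤-trans k< nn≤NN)))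
      fin<2^b : ∀ (i : Fin n) → ∣ + toℕ i ∣ < 2 ^ b
      fin<2^b i = ℕ.<-trans (Fin.toℕ<n i) n<2^b
      read-W : Eval τ (scalar 14) (+ W) 1 3
      read-W = eval-read (eval-lit 0ℤ) (trans (fr 14 0ℤ (λ ()) λ ()) width) W<2^b
      base≡ : ∀ i → toℕ (E.base i) ≡ W * toℕ i
      base≡ i = trans (Fin.toℕ-combine i (zero {W₋})) (ℕ.+-identityʳ (W * toℕ i))
      position : + N ℤ.* (+ W ℤ.* + toℕ u) ℤ.+ + W ℤ.* + toℕ v ≡ + toℕ (combine (E.base u) (E.base v))
      position = begin
        + N ℤ.* (+ W ℤ.* + toℕ u) ℤ.+ + W ℤ.* + toℕ v
          ≡⟨ cong₂ (λ a c → + N ℤ.* a ℤ.+ c) (sym (ℤ.pos-* W (toℕ u))) (sym (ℤ.pos-* W (toℕ v))) ⟩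
        + N ℤ.* + (W * toℕ u) ℤ.+ + (W * toℕ v)   ≡⟨ cong (ℤ._+ (+ (W * toℕ v))) (sym (ℤ.pos-* N (W * toℕ u))) ⟩
        + (N * (W * toℕ u) + W * toℕ v)           ≡⟨ cong₂ (λ a c → + (N * a + c)) (sym (base≡ u)) (sym (base≡ v)) ⟩
        + (N * toℕ (E.base u) + toℕ (E.base v))   ≡⟨ cong +_ (sym (Fin.toℕ-combine (E.base u) (E.base v))) ⟩
        + toℕ (combine (E.base u) (E.base v))     ∎
        where open ≡-Reasoning

  total-cost : ℕ
  total-cost = 102 + (10 + (3 + (3 + ((L * 47 + 26) + (100 + (100 + (100 +
    (163 + (163 + (152 + (152 + (105 + (105 + (saturate-cost + 91))))))))))))))

  run-solve : Fast.Runs (solve p) σ₀ total-cost (λ σ → ∀ u v → output σ u v ≡ + bit (answers u v))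
  run-solve =
    run-find-max Fast.then λ { {σ₁} (W₁ , fr₁) →
    Fast.run-assign {P = λ σ → σ ≡ σ₁ [ 15 , 0ℤ ↦ + N ]} (eval-lit 0ℤ)
      (eval-≡ (sym (ℤ.pos-* n W)) (eval-⊗ (eval-read (eval-lit 0ℤ) (fr₁ 0 0ℤ (λ ()) λ ()) n<2^b) (eval-read (eval-lit 0ℤ) W₁ W<2^b)))
      refl Fast.then λ { refl →
    Fast.run-assign {P = λ σ → σ ≡ (σ₁ [ 15 , 0ℤ ↦ + N ]) [ 13 , 0ℤ ↦ 1ℤ ]} (eval-lit 0ℤ) (eval-lit 1ℤ) refl Fast.then λ { refl →
    Fast.run-assign {P = λ σ → σ ≡ ((σ₁ [ 15 , 0ℤ ↦ + N ]) [ 13 , 0ℤ ↦ 1ℤ ]) [ 17 , 0ℤ ↦ 1ℤ ]} (eval-lit 0ℤ) (eval-lit 1ℤ) refl Fast.then λ { refl →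
    run-find-log refl refl (fr₁ 16 0ℤ (λ ()) λ ()) Fast.then λ { {σ₅} (L₅ , fr₅) →
    let clear : ∀ y → y ≢ 10 → y ≢ 13 → y ≢ 14 → y ≢ 15 → y ≢ 16 → y ≢ 17 → σ₅ y 0ℤ ≡ σ₀ y 0ℤ
        clear y n10 n13 n14 n15 n16 n17 = trans (fr₅ y 0ℤ n16 n17)
          (trans (update-array ((σ₁ [ 15 , 0ℤ ↦ + N ]) [ 13 , 0ℤ ↦ 1ℤ ]) {17} {y} 0ℤ 1ℤ 0ℤ (n17 ∘ sym))
            (trans (update-array (σ₁ [ 15 , 0ℤ ↦ + N ]) {13} {y} 0ℤ 1ℤ 0ℤ (n13 ∘ sym))
              (trans (update-array σ₁ {15} {y} 0ℤ (+ N) 0ℤ (n15 ∘ sym)) (fr₁ y 0ℤ n10 n14)))) in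
    run-divide 4 5 0 n (λ ()) (λ ()) (λ ()) (λ ()) (λ ()) (λ ()) (λ ()) (λ ())
      (fr₅ 15 0ℤ (λ ()) λ ()) (clear 0 (λ ()) (λ ()) (λ ()) (λ ()) (λ ()) λ ()) n<2^b
      (clear 4 (λ ()) (λ ()) (λ ()) (λ ()) (λ ()) λ ()) (clear 5 (λ ()) (λ ()) (λ ()) (λ ()) (λ ()) λ ()) Fast.then λ { {σ₆} (div₆ , fr₆) →
    run-divide 6 7 14 W (λ ()) (λ ()) (λ ()) (λ ()) (λ ()) (λ ()) (λ ()) (λ ())
      (trans (fr₆ 15 0ℤ (λ ()) (λ ()) λ ()) (fr₅ 15 0ℤ (λ ()) λ ()))
      (trans (fr₆ 14 0ℤ (λ ()) (λ ()) λ ()) (trans (fr₅ 14 0ℤ (λ ()) λ ()) W₁)) W<2^b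
      (trans (fr₆ 6 0ℤ (λ ()) (λ ()) λ ()) (clear 6 (λ ()) (λ ()) (λ ()) (λ ()) (λ ()) λ ()))
      (trans (fr₆ 7 0ℤ (λ ()) (λ ()) λ ()) (clear 7 (λ ()) (λ ()) (λ ()) (λ ()) (λ ()) λ ())) Fast.then λ { {σ₇} (div₇ , fr₇) →
    run-divide 8 9 15 N (λ ()) (λ ()) (λ ()) (λ ()) (λ ()) (λ ()) (λ ()) (λ ())
      (trans (fr₇ 15 0ℤ (λ ()) (λ ()) λ ()) (trans (fr₆ 15 0ℤ (λ ()) (λ ()) λ ()) (fr₅ 15 0ℤ (λ ()) λ ())))
      (trans (fr₇ 15 0ℤ (λ ()) (λ ()) λ ()) (trans (fr₆ 15 0ℤ (λ ()) (λ ()) λ ()) (fr₅ 15 0ℤ (λ ()) λ ()))) N<2^b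
      (trans (fr₇ 8 0ℤ (λ ()) (λ ()) λ ()) (trans (fr₆ 8 0ℤ (λ ()) (λ ()) λ ()) (clear 8 (λ ()) (λ ()) (λ ()) (λ ()) (λ ()) λ ())))
      (trans (fr₇ 9 0ℤ (λ ()) (λ ()) λ ()) (trans (fr₆ 9 0ℤ (λ ()) (λ ()) λ ()) (clear 9 (λ ()) (λ ()) (λ ()) (λ ()) (λ ()) λ ()))) Fast.then λ { {σ₈} (div₈ , fr₈) →
    run-fill-edges (prepared {σ₁} {σ₅} {σ₆} {σ₇} {σ₈} W₁ fr₁ L₅ fr₅ div₆ fr₆ div₇ fr₇ div₈ fr₈) 0F
      (λ r → eval-⊖ (eval-lit 1ℤ) (eval-read (eval-lit 0ℤ) (Ready.width r) W<2^b)) Fast.then λ P₁ →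
    run-fill-edges P₁ 1F (λ r → eval-⊕ (eval-lit 1ℤ) (eval-read (eval-lit 0ℤ) (Ready.width r) W<2^b)) Fast.then λ P₂ →
    run-fill-edges P₂ 2F (λ _ → eval-lit 1ℤ) Fast.then λ P₃ →
    run-fill-edges P₃ 3F (λ _ → eval-lit 1ℤ) Fast.then λ P₄ →
    run-fill-identity P₄ 2F Fast.then λ P₅ →
    run-fill-identity P₅ 3F Fast.then λ { {σ₈′} P₆ →
    let open Ready (Prepared.ready P₆) in
    run-saturate (prepared-state P₆) len Fast.then λ { {σ₉} (contents , dim , keep) →
    run-write-output (trans (keep 0 (λ ()) (λ ()) 0ℤ) vertices) (trans (keep 14 (λ ()) (λ ()) 0ℤ) width) dim
      (λ j j≤ → Division-cong 4 5 σ₈′ σ₉ (keep 4 (λ ()) λ ()) (keep 5 (λ ()) λ ()) (by-n j j≤)) contents } } } } } } } } } }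

  answers-decide : ∀ {σ} → (∀ u v → output σ u v ≡ + bit (answers u v)) → DecidesNonnegativePrefixPaths G (output σ)
  answers-decide {σ} out u v with answers u v in eq | out u v
  ... | true  | o = inj₁ (o , E.result⇒path L NN<2^L (subst T (sym eq) tt))
  ... | false | o = inj₂ (o , λ path → subst T eq (E.path⇒result L NN<2^L path))

-- Asymptotics

^-cancelˡ-≤ : ∀ d {m n} → m ^ suc d ≤ n ^ suc d → m ≤ n
^-cancelˡ-≤ d le = ℕ.≮⇒≥ λ lt → ℕ.<⇒≱ (ℕ.^-monoˡ-< (suc d) lt) le

^-distribʳ-* : ∀ d m n → (m * n) ^ d ≡ m ^ d * n ^ d
^-distribʳ-* zero    m n = refl
^-distribʳ-* (suc d) m n = trans (cong (m * n *_) (^-distribʳ-* d m n)) (interchange m n (m ^ d) (n ^ d))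
  where
  interchange : ∀ a b c d → a * b * (c * d) ≡ a * c * (b * d)
  interchange = ℕ-Solver.solve-∀

-- If suc k is a power 2 ^ j, only the exponents C + j c and 2 k have to be compared. With i = C +
-- c, the choice j = 2 i works because (i + 1)² ≤ 2 ^ j = suc k, that is, i² + 2 i ≤ k.
exponential>polylog : ∀ C c → ∃ λ k → C * suc k ^ c < 2 ^ k * 2 ^ k
exponential>polylog C c = k , (begin-strict
  C * suc k ^ c          ≡⟨ cong (λ x → C * x ^ c) 1+k ⟩
  C * (2 ^ j) ^ c        <⟨ ℕ.*-monoˡ-< ((2 ^ j) ^ c) {{ℕ.m^n≢0 (2 ^ j) c {{ℕ.m^n≢0 2 j}}}} (n<2^n C) ⟩
  2 ^ C * (2 ^ j) ^ c    ≡⟨ cong (2 ^ C *_) (ℕ.^-*-assoc 2 j c) ⟩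
  2 ^ C * 2 ^ (j * c)    ≡⟨ sym (ℕ.^-distribˡ-+-* 2 C (j * c)) ⟩
  2 ^ (C + j * c)        ≤⟨ ℕ.^-monoʳ-≤ 2 exponent ⟩
  2 ^ (k + k)            ≡⟨ ℕ.^-distribˡ-+-* 2 k k ⟩
  2 ^ k * 2 ^ k          ∎)
  where
  open ℕ.≤-Reasoning
  i = C + c
  j = i + i
  k = ℕ.pred (2 ^ j)
  1+k : suc k ≡ 2 ^ j
  1+k = ℕ.suc-pred (2 ^ j) {{ℕ.m^n≢0 2 j}}
  square : i * i + (i + i) ≤ k
  square = ℕ.≤-pred (begin
    suc (i * i + (i + i))   ≡⟨ expand i ⟩
    suc i * suc i           ≤⟨ ℕ.*-mono-≤ (n<2^n i) (n<2^n i) ⟩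
    2 ^ i * 2 ^ i           ≡⟨ sym (ℕ.^-distribˡ-+-* 2 i i) ⟩
    2 ^ j                   ≡⟨ sym 1+k ⟩
    suc k                   ∎)
    where
    expand : ∀ i → suc (i * i + (i + i)) ≡ suc i * suc i
    expand = ℕ-Solver.solve-∀
  exponent : C + j * c ≤ k + k
  exponent = begin
    C + j * c                                    ≤⟨ ℕ.+-mono-≤ (ℕ.m≤m+n C c) (ℕ.*-monoʳ-≤ j (ℕ.m≤n+m c C)) ⟩
    i + j * i                                    ≤⟨ ℕ.m≤m+n (i + j * i) (i + (i + i)) ⟩
    i + j * i + (i + (i + i))                    ≡⟨ regroup i ⟩
    (i * i + (i + i)) + (i * i + (i + i))        ≤⟨ ℕ.+-mono-≤ square square ⟩
    k + k                                        ∎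
    where
    regroup : ∀ i → i + (i + i) * i + (i + (i + i)) ≡ (i * i + (i + i)) + (i * i + (i + i))
    regroup = ℕ-Solver.solve-∀

-- Writing the output alone rules out negative exponents.
no-negative-exponent : ∀ {τ a d} → MatrixMultiplicationIn τ → ¬ τ (mkℚᵘ -[1+ a ] d)
no-negative-exponent {τ} {a} {d} (p , C , c , mm) neg
  with exponential>polylog C c
... | k , lt with mm (2 ^ k) 1 {{ℕ.m^n≢0 2 k}} (ints all-ones) (ints all-ones) (λ _ _ → ℕ.≤-refl) (λ _ _ → ℕ.≤-refl)
...   | σ , t , e , prod , bound = ℕ.<⇒≱ lt (begin
  2 ^ k * 2 ^ k                      ≤⟨ product-time {{ℕ.m^n≢0 2 k}} e prod ⟩
  t                                  ≤⟨ ^-cancelˡ-≤ d (ℕ.≤-trans (ℕ.m≤m*n (t ^ suc d) ((2 ^ k) ^ suc a) {{ℕ.m^n≢0 (2 ^ k) (suc a) {{ℕ.m^n≢0 2 k}}}}) (bound _ neg)) ⟩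
  C * suc ⌈log₂ 2 ^ k * 1 ⌉ ^ c      ≡⟨ cong (λ l → C * suc l ^ c) (trans (cong ⌈log₂_⌉ (ℕ.*-identityʳ (2 ^ k))) (⌈log₂2^n⌉≡n k)) ⟩
  C * suc k ^ c                      ∎)
  where open ℕ.≤-Reasoning

-- A record, so that the numeral x is never unfolded.
record AtMost (m x a : ℕ) : Set where
  constructor at-most
  field bound : a ≤ x * m

at-most-+ : ∀ {m x y z a b c} → AtMost m x a → AtMost m y b → x + y ≡ z → a + b ≡ c → AtMost m z c
at-most-+ {m} {x} {y} (at-most p) (at-most q) refl refl =
  at-most (ℕ.≤-trans (ℕ.+-mono-≤ p q) (ℕ.≤-reflexive (sym (ℕ.*-distribʳ-+ m x y))))

at-most-* : ∀ {m k x y z a b} → AtMost m x a → AtMost k y b → x * y ≡ z → AtMost (m * k) z (a * b)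
at-most-* {m} {k} {x} {y} (at-most p) (at-most q) refl =
  at-most (ℕ.≤-trans (ℕ.*-mono-≤ p q) (ℕ.≤-reflexive (interchange x m y k)))
  where
  interchange : ∀ a b c d → a * b * (c * d) ≡ a * c * (b * d)
  interchange = ℕ-Solver.solve-∀

module Scaled (ℓ : ℕ) .{{_ : NonZero ℓ}} where

  constant : ∀ k → AtMost ℓ k k
  constant k = at-most (ℕ.m≤m*n k ℓ)

  square : ∀ {x a} → AtMost ℓ x a → AtMost (ℓ * ℓ) x a
  square {x} (at-most p) = at-most (ℕ.≤-trans p (ℕ.*-monoʳ-≤ x (ℕ.m≤m*n ℓ ℓ)))

  scaled : ∀ {x a} k → AtMost ℓ x a → AtMost ℓ (x * k) (a * k)
  scaled {x} {a} k (at-most p) = at-most (ℕ.≤-trans (ℕ.*-monoˡ-≤ k p) (ℕ.≤-reflexive (swap x ℓ k)))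
    where
    swap : ∀ x ℓ k → x * ℓ * k ≡ x * k * ℓ
    swap = ℕ-Solver.solve-∀

abstract
  -- 9117 * 22, the factors from `total≤` and `1+b≤`.
  κ : ℕ
  κ = 200574

  κ≡ : κ ≡ 200574
  κ≡ = refl

module Running
  (p : Program) {n : ℕ} .{{n≢0 : NonZero n}} (G : Graph n) (W₋ : ℕ) (maxWeight≡ : maxWeight G ≡ suc W₋)
  (Fine : ℕ → Set) (Fine-⊔ : ∀ {s t} → Fine s → Fine t → Fine (s ⊔ t))
  (multiplies : ∀ (A B : Matrix (n * suc W₋)) → (∀ i j → ∣ A i j ∣ ≤ 1) → (∀ i j → ∣ B i j ∣ ≤ 1) →
    ∃[ σ ] ∃[ t ] ⟨ p , input A B ⟩⇓⟨ σ , t ⟩ × IsProduct A B (output σ) × Fine t)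
  where

  open Solution p G W₋ maxWeight≡ Fine Fine-⊔ multiplies

  time-factor : ℕ
  time-factor = total-cost * suc b

  L≤ : L ≤ 2 * suc ⌈log₂ N ⌉
  L≤ = ℕ.≤-trans (ℕ.≤-reflexive L≡) (ℕ.≤-trans (⌈log₂⌉-mono-≤ bound) (ℕ.≤-trans (ℕ.≤-reflexive (⌈log₂2^n⌉≡n (suc (l + l)))) (ℕ.≤-trans (ℕ.n≤1+n _) (ℕ.≤-reflexive (doubled l)))))
    where
    l = ⌈log₂ N ⌉
    doubled : ∀ l → suc (suc (l + l)) ≡ 2 * suc l
    doubled = ℕ-Solver.solve-∀
    bound : suc (N * N) ≤ 2 ^ suc (l + l)
    bound = ℕ.≤-trans (ℕ.+-mono-≤ (ℕ.m^n>0 2 (l + l)) (ℕ.≤-trans (ℕ.*-mono-≤ (n≤2^⌈log₂n⌉ N) (n≤2^⌈log₂n⌉ N))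
      (ℕ.≤-reflexive (sym (ℕ.^-distribˡ-+-* 2 l l))))) (ℕ.≤-reflexive (cong (λ x → 2 ^ (l + l) + x) (sym (ℕ.+-identityʳ (2 ^ (l + l))))))

  module _ (ℓ : ℕ) .{{_ : NonZero ℓ}} (L≤2ℓ : L ≤ 2 * ℓ) where
    open Scaled ℓ

    length≤ : AtMost ℓ 2 L
    length≤ = at-most L≤2ℓ

    closure≤ : AtMost ℓ 796 closure-cost
    -- `closure-cost` is 2 + (L * 392 + 10), where 392 = 10 + (372 + 10): test, product and
    -- increment.
    closure≤ = at-most-+ (constant 2) (at-most-+ (scaled 392 length≤) (constant 10) refl refl) refl refl

    round≤ : AtMost ℓ 3400 round-cost
    round≤ = at-most-+ closure≤ (constant 2604) refl refl

    round′≤ : AtMost ℓ 3420 (10 + (round-cost + 10))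
    round′≤ = at-most-+ (constant 10) (at-most-+ round≤ (constant 10) refl refl) refl refl

    rounds≤ : AtMost (ℓ * ℓ) 6840 (L * (10 + (round-cost + 10)))
    rounds≤ = at-most-* length≤ round′≤ refl

    saturate≤ : AtMost (ℓ * ℓ) 7648 saturate-cost
    saturate≤ = at-most-+ (at-most-+ (square (constant 2)) (at-most-+ rounds≤ (square (constant 10)) refl refl) refl refl) (square closure≤) refl refl

    total≤ : AtMost (ℓ * ℓ) 9117 total-cost
    total≤ = fixed 102 (fixed 10 (fixed 3 (fixed 3 (at-most-+ log≤
      (fixed 100 (fixed 100 (fixed 100 (fixed 163 (fixed 163 (fixed 152 (fixed 152 (fixed 105 (fixed 105
        (at-most-+ saturate≤ (square (constant 91)) refl refl) refl) refl) refl) refl) refl) refl) refl) refl) refl) refl refl) refl) refl) refl) refl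
      where
      log≤ : AtMost (ℓ * ℓ) 120 (L * 47 + 26)
      log≤ = square (at-most-+ (scaled 47 length≤) (constant 26) refl refl)
      fixed : ∀ k {x z a} → AtMost (ℓ * ℓ) x a → k + x ≡ z → AtMost (ℓ * ℓ) z (k + a)
      fixed k h eq = at-most-+ (square (constant k)) h eq refl

    1+b≤ : AtMost (ℓ * ℓ) 22 (suc b)
    1+b≤ = at-most-+ (square (constant 2)) (at-most-+ (square length≤)
      (at-most-* length≤ (at-most-+ (constant 7) length≤ refl refl) refl) refl refl) refl refl

    -- One ℓ * ℓ counts the products, from L rounds with L squarings each; the other is the bit
    -- length b, which must be as large as the number of products because of the strides.
    overall≤ : time-factor ≤ κ * (ℓ * ℓ * (ℓ * ℓ))
    overall≤ = AtMost.bound (at-most-* total≤ 1+b≤ (sym κ≡))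

  solution : ∃[ σ ] ∃[ t ] ∃[ s ] ⟨ solve p , input (adjacency G) (weightMatrix G) ⟩⇓⟨ σ , t ⟩ ×
    DecidesNonnegativePrefixPaths G (output σ) × t ≤ time-factor * s × Fine s
  solution = let σ , t , s , e , out , t≤ , fine = fast-time run-solve in σ , t , s , e , answers-decide {σ} out , t≤ , fine

-- From running times to exponents

maxWeight-positive : ∀ {n} (G : Graph n) → 1 ≤ maxWeight G
maxWeight-positive {n} G = maximum-mono (λ k → rowMajor (weightMatrix G) (+ k)) {0} {n * n} z≤n

maxWeight≤ : ∀ {n W} (G : Graph n) → 1 ≤ W → WeightsBoundedBy G W → maxWeight G ≤ W
maxWeight≤ {n} {W} G 1≤W bounded = maximum≤ _ 1≤W (n * n) entry
  where
  absolute : ∀ {w} → ℤ.- (+ W) ℤ.≤ w → w ℤ.≤ + W → ∣ w ∣ ≤ W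
  absolute {+ a} _ hi = ℤ.drop‿+≤+ hi
  absolute { -[1+ a ]} lo _ = ℤ.drop‿+≤+ (ℤ.≤-trans (ℤ.neg-mono-≤ lo) (ℤ.≤-reflexive (ℤ.neg-involutive (+ W))))
  weight : ∀ u v → ∣ weightMatrix G u v ∣ ≤ W
  weight u v with G u v in eq
  ... | just w  = absolute (proj₁ (bounded u v w eq)) (proj₂ (bounded u v w eq))
  ... | nothing = z≤n
  entry : ∀ k → k < n * n → ∣ rowMajor (weightMatrix G) (+ k) ∣ ≤ W
  entry k k< with row-column {n} k<
  ... | u , v , refl = subst (λ z → ∣ z ∣ ≤ W) (sym (rowMajor-combine (weightMatrix G) u v)) (weight u v)

scale-bound : ∀ t Q K {T K′ N N′} a d → T ≤ Q * t → Q * K ≤ K′ → N ≤ N′ →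
  t ≤ K · N ^ℚ mkℚᵘ (+ a) d → T ≤ K′ · N′ ^ℚ mkℚᵘ (+ a) d
scale-bound t Q K {T} {K′} {N} {N′} a d T≤ K≤ N≤ t≤ = begin
  T ^ suc d                            ≤⟨ ℕ.^-monoˡ-≤ (suc d) T≤ ⟩
  (Q * t) ^ suc d                      ≡⟨ ^-distribʳ-* (suc d) Q t ⟩
  Q ^ suc d * t ^ suc d                ≤⟨ ℕ.*-monoʳ-≤ (Q ^ suc d) t≤ ⟩
  Q ^ suc d * (K ^ suc d * N ^ a)      ≡⟨ sym (ℕ.*-assoc (Q ^ suc d) (K ^ suc d) (N ^ a)) ⟩
  Q ^ suc d * K ^ suc d * N ^ a        ≡⟨ cong (_* N ^ a) (sym (^-distribʳ-* (suc d) Q K)) ⟩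
  (Q * K) ^ suc d * N ^ a              ≤⟨ ℕ.*-mono-≤ (ℕ.^-monoˡ-≤ (suc d) K≤) (ℕ.^-monoˡ-≤ a N≤) ⟩
  K′ ^ suc d * N′ ^ a                  ∎
  where open ℕ.≤-Reasoning

-- The inclusion says τ′ ≤ τ as reals. Two exponents are kept apart because an exponent above the
-- infimum ω is reached through an achieved one strictly below it.
all-pairs : ∀ {τ τ′ : Exponent} → (∀ r → τ r → τ′ r) →
  MatrixMultiplicationIn τ′ → AllPairsNonnegativePrefixPathsIn τ
all-pairs {τ} {τ′} τ⊆τ′ mm@(p , C , c , multiply) = solve p , κ * C , 4 + c , λ n W G bounded → main n W G bounded
  where
  main : ∀ n W .{{_ : NonZero n}} .{{_ : NonZero W}} (G : Graph n) → WeightsBoundedBy G W →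
    ∃[ σ ] ∃[ t ] ⟨ solve p , input (adjacency G) (weightMatrix G) ⟩⇓⟨ σ , t ⟩ ×
      DecidesNonnegativePrefixPaths G (output σ) × t ≤ polylog (κ * C) (4 + c) (n * W) · (n * W) ^ τ
  main n W G bounded = answer solution
    where
    -- The program is not told W. It works with the largest absolute weight of G, or 1 if that is
    -- larger, which is at most W.
    W₋ = ℕ.pred (maxWeight G)
    maxWeight≡ : maxWeight G ≡ suc W₋
    maxWeight≡ = sym (ℕ.suc-pred (maxWeight G) {{ℕ.>-nonZero (maxWeight-positive G)}})
    N = n * suc W₋
    N≤nW : N ≤ n * W
    N≤nW = ℕ.*-monoʳ-≤ n (subst (_≤ W) maxWeight≡ (maxWeight≤ G (ℕ.>-nonZero⁻¹ W) bounded))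
    ℓ = suc ⌈log₂ n * W ⌉

    Fine : ℕ → Set
    -- All matrices multiplied have entries 0 and 1, hence M = 1.
    Fine t = t ≤ polylog C c (N * 1) · N ^ τ′

    Fine-⊔ : ∀ {s t} → Fine s → Fine t → Fine (s ⊔ t)
    Fine-⊔ {s} {t} f g with ℕ.⊔-sel s t
    ... | inj₁ eq = subst Fine (sym eq) f
    ... | inj₂ eq = subst Fine (sym eq) g

    multiply-N : ∀ (A B : Matrix N) → (∀ i j → ∣ A i j ∣ ≤ 1) → (∀ i j → ∣ B i j ∣ ≤ 1) →
      ∃[ σ ] ∃[ t ] ⟨ p , input A B ⟩⇓⟨ σ , t ⟩ × IsProduct A B (output σ) × Fine t
    multiply-N A B = multiply N 1 {{ℕ.m*n≢0 n (suc W₋)}} A B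

    open Running p G W₋ maxWeight≡ Fine Fine-⊔ multiply-N

    ℓ-mono : suc ⌈log₂ N ⌉ ≤ ℓ
    ℓ-mono = s≤s (⌈log₂⌉-mono-≤ N≤nW)

    factor≤ : time-factor * polylog C c (N * 1) ≤ polylog (κ * C) (4 + c) (n * W)
    factor≤ = begin
      time-factor * (C * suc ⌈log₂ N * 1 ⌉ ^ c)
        ≤⟨ ℕ.*-mono-≤ (overall≤ ℓ (ℕ.≤-trans L≤ (ℕ.*-monoʳ-≤ 2 ℓ-mono)))
             (ℕ.*-monoʳ-≤ C (ℕ.^-monoˡ-≤ c (subst (λ N → suc ⌈log₂ N ⌉ ≤ ℓ) (sym (ℕ.*-identityʳ N)) ℓ-mono))) ⟩
      κ * (ℓ * ℓ * (ℓ * ℓ)) * (C * ℓ ^ c)      ≡⟨ regroup κ (ℓ * ℓ * (ℓ * ℓ)) C (ℓ ^ c) ⟩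
      κ * C * (ℓ * ℓ * (ℓ * ℓ) * ℓ ^ c)        ≡⟨ cong (κ * C *_) (power ℓ (ℓ ^ c)) ⟩
      κ * C * ℓ ^ (4 + c)                      ∎
      where
      open ℕ.≤-Reasoning
      regroup : ∀ k x C y → k * x * (C * y) ≡ k * C * (x * y)
      regroup = ℕ-Solver.solve-∀
      power : ∀ ℓ y → ℓ * ℓ * (ℓ * ℓ) * y ≡ ℓ * (ℓ * (ℓ * (ℓ * y)))
      power = ℕ-Solver.solve-∀

    answer : _ → _
    answer (σ , t , s , e , decides , t≤ , fine) = σ , t , e , decides , bound
      where
      bound : t ≤ polylog (κ * C) (4 + c) (n * W) · (n * W) ^ τ
      bound (mkℚᵘ (+ a) d)    r = scale-bound s time-factor (polylog C c (N * 1)) a d t≤ factor≤ N≤nW (fine (mkℚᵘ (+ a) d) (τ⊆τ′ _ r))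
      -- Passing from N to the larger n W is sound only for a nonnegative exponent; a negative one
      -- above τ would be above τ′, where none exists.
      bound (mkℚᵘ -[1+ a ] d) r = ⊥-elim (no-negative-exponent mm (τ⊆τ′ _ r))

-- An infimum need not be attained, so the bound with exponent ω is read in the usual way, as
-- holding for every rational exponent above ω. If ω is itself attained up to logarithmic factors,
-- the second component gives the exponent ω exactly.
theorem1p2 : (∀ q → ω q → AllPairsNonnegativePrefixPathsIn (rational q)) ×
    (MatrixMultiplicationIn ω → AllPairsNonnegativePrefixPathsIn ω)
theorem1p2 = (λ q (q′ , q′<q , mm) → all-pairs (λ r q<r → ℚᵘ.<-trans q′<q q<r) mm) , all-pairs (λ r w → w)
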